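{- Let $\mathcal{G}$ be a (non-degenerate) $[n,k,d]_q$ A$^s$MDS code whose dual $\mathcal{G}^\perp$ is an $[n,k^\perp,d^\perp]_q$ A$^t$MDS code, where $k^\perp=n-k$, $d>1$, and $s,t\ge 1$. Then: \begin{enumerate} \item (a) If $t>1$ then $n\le s(q+1)+k-1$. (b) If $s>1$ then $k\le t(q+1)-1$. \item If $t=1$ and $\mathcal{G}$ has a codeword of weight $d+s+1-\alpha$ for some integer $0\le \alpha\le s+1$, then $n\le q(s+1)+k-2+\alpha$. \item If $s=1$ then $n\le (t+1)(q+1)+k^\perp-2$, or equivalently $k\le (t+1)(q+1)-2$. \item If $s=t=1$, $q>3$ and $k\ge 3$, then $n\le 2q+k-2$, and if moreover $n>k+2$ then $k\le 2q-2$. \item If $t=1$ then $k+s-1\le m(k-1,q)$, equivalently $n\le m(k-1,q)+k^\perp-s+1$. \item If $s=1$ then $k^\perp+t-1\le m(k^\perp-1,q)$, so $n\le m(k^\perp-1,q)+k-t+1$. \item If $s=t=1$ then $k\le m(k-1,q)$ and $k^\perp\le m(k^\perp-1,q)$. \item $k\le (t+1)(q+1)-2$. \end{enumerate}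
   Context: A linear $[n,k,d]_q$ code is identified with a projective system: a finite multiset $\mathcal{G}$ of $n$ points (counted with multiplicity) of $\Sigma=\mathrm{PG}(k-1,q)$, not all lying in one hyperplane, such that $n-d=\max_H|\mathcal{G}\cap H|$ over all hyperplanes $H$ of $\Sigma$ (intersections counted with multiplicity). Equivalently, $\mathcal{G}$ is the multiset of columns of a $k\times n$ generator matrix of a non-degenerate linear code $C\subseteq\mathbb{F}_q^n$ of dimension $k$ and minimum distance $d$; a nonzero codeword has weight $n-|\mathcal{G}\cap H|$ for the corresponding hyperplane $H$. The Singleton defect is $S(\mathcal{G})=n-k+1-d$; $\mathcal{G}$ is an A$^s$MDS code if $S(\mathcal{G})=s$ (MDS if $s=0$). The dual code $\mathcal{G}^\perp$ is $C^\perp$, an $[n,n-k,d^\perp]_q$ code; $d^\perp$ equals the minimum size of a subfamily $Q\subseteq\mathcal{G}$ whose points (as vectors) span a vector space of dimension $|Q|-1$. $m(k,q)$ denotes the maximum length $n$ of a non-degenerate $[n,k,n-k+1]_q$ MDS code. -}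

module Defs where

open import Level using (0ℓ)
open import Data.Nat using (ℕ; zero; suc; _≤_) renaming (_+_ to _+ℕ_)
open import Data.Fin using (Fin; zero; suc)
open import Data.Product using (Σ; ∃; _×_; _,_)
open import Relation.Nullary using (¬_; yes; no)
open import Relation.Binary.Definitions using (DecidableEquality)
open import Relation.Binary.PropositionalEquality using (_≡_)
open import Algebra.Core using (Op₁; Op₂)
open import Algebra.Structures using (IsCommutativeRing)
open import Function.Bundles using (_↔_)

-- A finite field with exactly q elements (equality is propositional;
-- every finite field is isomorphic to one of this form, e.g. on Fin q).

record FiniteField (q : ℕ) : Set₁ where
  infixl 7 _*_
  infixl 6 _+_
  field
    Carrier           : Set
    _+_ _*_           : Op₂ Carrier
    -_                : Op₁ Carrier
    0# 1#             : Carrier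
    isCommutativeRing : IsCommutativeRing _≡_ _+_ _*_ -_ 0# 1#
    0≢1               : ¬ (0# ≡ 1#)
    inverse           : ∀ x → ¬ (x ≡ 0#) → ∃ λ y → x * y ≡ 1#
    _≟_               : DecidableEquality Carrier
    enumeration       : Fin q ↔ Carrier

module _ {q : ℕ} (F : FiniteField q) where
  open FiniteField F

  Vect : ℕ → Set
  Vect m = Fin m → Carrier

  ∑ : ∀ {m} → (Fin m → Carrier) → Carrier
  ∑ {zero}  f = 0#
  ∑ {suc m} f = f zero + ∑ (λ i → f (suc i))

  ⟨_,_⟩ : ∀ {m} → Vect m → Vect m → Carrier
  ⟨ x , y ⟩ = ∑ (λ i → x i * y i)

  IsZeroVec : ∀ {m} → Vect m → Set
  IsZeroVec x = ∀ i → x i ≡ 0#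

  NonZeroVec : ∀ {m} → Vect m → Set
  NonZeroVec x = ¬ IsZeroVec x

  wt : ∀ {m} → Vect m → ℕ
  wt {zero}  x = 0
  wt {suc m} x with x zero ≟ 0#
  ... | yes _ = wt (λ i → x (suc i))
  ... | no  _ = suc (wt (λ i → x (suc i)))

  Code : ℕ → Set₁
  Code n = Vect n → Set

  IsMinDist : ∀ {n} → Code n → ℕ → Set
  IsMinDist C d =
    (∃ λ c → C c × NonZeroVec c × wt c ≡ d) ×
    (∀ c → C c → NonZeroVec c → d ≤ wt c)

  -- Generator matrix given by its n columns g i ∈ F^k (the projective
  -- system).  The code generated: all words (⟨a , g i⟩)_i, a ∈ F^k.
  GenMat : ℕ → ℕ → Set
  GenMat k n = Fin n → Vect k

  codeword : ∀ {k n} → GenMat k n → Vect k → Vect n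
  codeword g a i = ⟨ a , g i ⟩

  CodeOf : ∀ {k n} → GenMat k n → Code n
  CodeOf {k} g c = ∃ λ (a : Vect k) → ∀ i → c i ≡ codeword g a i

  Dual : ∀ {n} → Code n → Code n
  Dual C c = ∀ x → C x → ⟨ c , x ⟩ ≡ 0#

  -- Non-degenerate projective system: every column is a point of
  -- PG(k-1,q) (nonzero), and the points do not all lie in one hyperplane
  -- (hyperplanes = kernels of nonzero functionals a).
  NonDegenerate : ∀ {k n} → GenMat k n → Set
  NonDegenerate {k} g =
    (∀ i → NonZeroVec (g i)) ×
    (∀ (a : Vect k) → NonZeroVec a → ∃ λ i → ¬ (⟨ a , g i ⟩ ≡ 0#))

  IsCode : ∀ {k n} → GenMat k n → ℕ → Set
  IsCode g d = NonDegenerate g × IsMinDist (CodeOf g) d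

  -- "N ≤ m(k,q)", where m(k,q) is the maximum length of a non-degenerate
  -- [n,k,n-k+1]_q MDS code (possibly unbounded): some such MDS code of
  -- length n ≥ N exists.
  MDSLengthAtLeast : ℕ → ℕ → Set
  MDSLengthAtLeast k N =
    ∃ λ n → N ≤ n × Σ (GenMat k n) λ g → ∃ λ d → IsCode g d × d +ℕ k ≡ suc n

{-# OPTIONS --safe #-}
-- A code C and its dual D enter symmetrically, through words with prescribed zeros, so each bound on
-- n yields its dual. Counting positions over the q + 1 codewords of a pencil with at least k − 2
-- common zeros gives (1), (2), (3) and (8); in (1) the support of a dual word of weight below k
-- supplies one further common zero. For (5)–(7), if every dual word has weight at least k, the zero
-- set of a minimum weight word carries an MDS code of dimension k − 1.
--
-- For (4), prescribing k − 3 zeros turns the code into a set of n − k + 3 points of PG(2, q) meeting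
-- every line in at most 3 points, which must be shown to have at most 2q + 1 points. If it had 2q + 2,
-- each point would lie on a unique 2-secant; counting the 2-secants through the points of a 2-secant
-- and of an external line shows that they all pass through one point, which completes the set to one
-- with 2q + 3 points met by every line in 0 or 3 points. For three of its points a, b, c, Segre's
-- product argument makes the lines joining each to the third point of the opposite side concurrent
-- (Ceva). Fix a and normalise the other points so that the third point on the line through a and v is
-- a + v. By Ceva the normalised vectors are closed under v, w ↦ − (v + w) off the lines through a, and
-- the values on them of a linear functional vanishing on one such line form an additive subgroup of
-- F_q with more than q / 2 elements, hence F_q; but each nonzero value is taken at least 3 times by
-- these 2q + 2 vectors, so q ≤ 3.
module Submission where

open import Defs
open import Data.Bool using (Bool; true; false; not; _∧_; _∨_; if_then_else_)
open import Data.Empty using (⊥; ⊥-elim)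
open import Data.Fin using (Fin; zero; suc; punchIn; punchOut; splitAt; _↑ˡ_; _↑ʳ_) renaming (_≟_ to _≟ᶠ_)
open import Data.Fin.Permutation using (permutation)
open import Data.Fin.Properties using (any?; ¬∀⟶∃¬; punchInᵢ≢i; punchIn-punchOut; splitAt-↑ˡ; splitAt-↑ʳ; suc-injective)
import Data.Integer as ℤ
import Data.Integer.Properties as ℤₚ
open import Data.Maybe using (Maybe; just; nothing)
open import Data.Nat as ℕ using (ℕ; zero; suc; _∸_; _≤_; _<_; z≤n; s≤s; _≤?_)
open import Data.Nat.Divisibility using (_∣_; _∣?_; divides; ∣m+n∣m⇒∣n; m∣m*n; ∣⇒≤)
import Data.Nat.Properties as ℕₚ
open ℕₚ using (*-monoʳ-≤; *-zeroʳ; +-cancelʳ-≡; +-cancelʳ-≤; +-cancelˡ-≡; +-cancelˡ-≤; +-mono-≤; +-monoʳ-<; +-monoʳ-≤; +-monoˡ-≤; +-suc; <-irrefl; <-trans; <-≤-connex; <-≤-trans; <⇒≤; [m+n]∸[m+o]≡n∸o; m+[n∸m]≡n; m+n∸n≡m; m<m+n; m∸n≤m; m≤m+n; m≤n+m; m≤n⇒m<n∨m≡n; m≤n⇒∃[o]m+o≡n; n<1+n; n≤0⇒n≡0; n≤1+n; ∸-monoʳ-<; ≤-antisym; ≤-pred; ≤-refl; ≤-reflexive; ≤-trans; ≰⇒>)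
open import Data.Nat.Tactic.RingSolver using (solve-∀)
open import Data.Product using (∃; _×_; _,_; proj₁; proj₂)
open import Data.Sum using (_⊎_; inj₁; inj₂; [_,_]′)
open import Function using (_∘_; Inverse)
open import Relation.Nullary using (¬_; Dec; yes; no; ¬?; does)
open import Relation.Nullary.Decidable using (decidable-stable; dec-true; dec-false; _×-dec_)
open import Relation.Binary.PropositionalEquality
open import Algebra.Bundles using (CommutativeRing; CommutativeMonoid)
import Algebra.Properties.CommutativeMonoid.Sum as MonoidSum
open import Algebra.Solver.Ring.AlmostCommutativeRing using (fromCommutativeRing; _-Raw-AlmostCommutative⟶_)

-- A point lies on q + 1 lines, each with at most 2 further points, so 2q + 3 is an upper bound for
-- a plane set with at most 3 points on a line. One point less leaves a deficit of exactly one at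
-- every point; hence the unique 2-secants, and hence a single added point can repair all of them.
-- What remains is to exclude maximal arcs of degree 3, for all q > 3 at once and whatever the
-- characteristic.
--
-- Each line through a point of such an arc has exactly two further points, so the product of the
-- nonzero field elements enters squared and no sign survives in Ceva's condition. The normalisation
-- makes collinear triples sum to zero: a, v, - (a + v) on a line through a, and v, w, - (v + w)
-- elsewhere. Composing two such reflections gives translations by a - u. With u of value zero they
-- keep the value of the functional, and two choices of u yield 3 vectors for each nonzero value;
-- with u of the same value they lead back to value zero, which bounds every fibre by 4. Thus 2q + 2
-- vectors take more than q / 2 values.

module FieldArithmetic {q : ℕ} (F : FiniteField q) where

  -- Field arithmetic and a ring solver with integer coefficients.

  open import Data.Integer using (ℤ; -[1+_]) renaming (+_ to ⁺_)

  open FiniteField F public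

  commutativeRing : CommutativeRing _ _
  commutativeRing = record { isCommutativeRing = isCommutativeRing }

  open CommutativeRing commutativeRing public
    using (+-assoc; +-comm; +-identityˡ; +-identityʳ; -‿inverseˡ; -‿inverseʳ;
           *-assoc; *-comm; *-identityˡ; *-identityʳ; zeroˡ; zeroʳ; distribˡ; distribʳ; ring; semiring;
           *-commutativeMonoid; +-commutativeMonoid)
  open import Algebra.Properties.Ring ring public
    using (-‿distribˡ-*; -‿distribʳ-*; -‿involutive; -0#≈0#)
    renaming (-‿+-comm to neg-+)
  open import Algebra.Properties.Semiring.Mult semiring using (×-homo-+; ×1-homo-*) renaming (_×_ to _·ₙ_)

  private
    -- Integer coefficients let the solver cancel terms of opposite sign by deciding equality in ℤ.
    -- The coefficient 1 is read as `1# + 0#`, so most identities that contain `1#` hand it to the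
    -- solver as a variable.
    ι : ℕ → Carrier
    ι n = n ·ₙ 1#

    ⟦_⟧ℤ : ℤ → Carrier
    ⟦ ⁺ n ⟧ℤ = ι n
    ⟦ -[1+ n ] ⟧ℤ = - ι (suc n)

    ⟦⊖⟧ : ∀ m n → ⟦ m ℤ.⊖ n ⟧ℤ ≡ ι m + - ι n
    ⟦⊖⟧ m zero = sym (trans (cong (ι m +_) -0#≈0#) (+-identityʳ _))
    ⟦⊖⟧ zero (suc n) = sym (+-identityˡ _)
    ⟦⊖⟧ (suc m) (suc n) = begin
      ⟦ suc m ℤ.⊖ suc n ⟧ℤ             ≡⟨ cong ⟦_⟧ℤ (ℤₚ.[1+m]⊖[1+n]≡m⊖n m n) ⟩
      ⟦ m ℤ.⊖ n ⟧ℤ                     ≡⟨ ⟦⊖⟧ m n ⟩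
      ι m + - ι n                      ≡⟨ cong (_+ - ι n) (sym (+-identityˡ (ι m))) ⟩
      0# + ι m + - ι n                 ≡⟨ cong (λ z → z + ι m + - ι n) (sym (-‿inverseʳ 1#)) ⟩
      1# + - 1# + ι m + - ι n          ≡⟨ cong (_+ - ι n) (+-assoc _ _ _) ⟩
      1# + (- 1# + ι m) + - ι n        ≡⟨ cong (λ z → 1# + z + - ι n) (+-comm _ _) ⟩
      1# + (ι m + - 1#) + - ι n        ≡⟨ cong (_+ - ι n) (sym (+-assoc _ _ _)) ⟩
      1# + ι m + - 1# + - ι n          ≡⟨ +-assoc _ _ _ ⟩
      1# + ι m + (- 1# + - ι n)        ≡⟨ cong (1# + ι m +_) (neg-+ 1# (ι n)) ⟩
      1# + ι m + - (1# + ι n)          ∎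
      where open ≡-Reasoning

    ⟦+⟧ : ∀ x y → ⟦ x ℤ.+ y ⟧ℤ ≡ ⟦ x ⟧ℤ + ⟦ y ⟧ℤ
    ⟦+⟧ (⁺ m) (⁺ n) = ×-homo-+ 1# m n
    ⟦+⟧ (⁺ m) -[1+ n ] = ⟦⊖⟧ m (suc n)
    ⟦+⟧ -[1+ m ] (⁺ n) = trans (⟦⊖⟧ n (suc m)) (+-comm _ _)
    ⟦+⟧ -[1+ m ] -[1+ n ] = begin
      - ι (suc (suc (m ℕ.+ n)))     ≡⟨ cong (λ z → - ι (suc z)) (sym (+-suc m n)) ⟩
      - ι (suc m ℕ.+ suc n)         ≡⟨ cong -_ (×-homo-+ 1# (suc m) (suc n)) ⟩
      - (ι (suc m) + ι (suc n))     ≡⟨ sym (neg-+ _ _) ⟩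
      - ι (suc m) + - ι (suc n)     ∎
      where open ≡-Reasoning

    ⟦-⟧ : ∀ x → ⟦ ℤ.- x ⟧ℤ ≡ - ⟦ x ⟧ℤ
    ⟦-⟧ (⁺ zero) = sym -0#≈0#
    ⟦-⟧ (⁺ suc n) = refl
    ⟦-⟧ -[1+ n ] = sym (-‿involutive _)

    ⟦*⟧ : ∀ x y → ⟦ x ℤ.* y ⟧ℤ ≡ ⟦ x ⟧ℤ * ⟦ y ⟧ℤ
    ⟦*⟧ (⁺ m) (⁺ n) = trans (cong ⟦_⟧ℤ (sym (ℤₚ.pos-* m n))) (×1-homo-* m n)
    ⟦*⟧ (⁺ m) -[1+ n ] = begin
      ⟦ ⁺ m ℤ.* -[1+ n ] ⟧ℤ            ≡⟨ cong ⟦_⟧ℤ (sym (ℤₚ.neg-distribʳ-* (⁺ m) (⁺ suc n))) ⟩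
      ⟦ ℤ.- (⁺ m ℤ.* ⁺ suc n) ⟧ℤ       ≡⟨ ⟦-⟧ (⁺ m ℤ.* ⁺ suc n) ⟩
      - ⟦ ⁺ m ℤ.* ⁺ suc n ⟧ℤ           ≡⟨ cong -_ (⟦*⟧ (⁺ m) (⁺ suc n)) ⟩
      - (ι m * ι (suc n))              ≡⟨ -‿distribʳ-* _ _ ⟩
      ι m * - ι (suc n)                ∎
      where open ≡-Reasoning
    ⟦*⟧ -[1+ m ] y = begin
      ⟦ -[1+ m ] ℤ.* y ⟧ℤ              ≡⟨ cong ⟦_⟧ℤ (sym (ℤₚ.neg-distribˡ-* (⁺ suc m) y)) ⟩
      ⟦ ℤ.- (⁺ suc m ℤ.* y) ⟧ℤ         ≡⟨ ⟦-⟧ (⁺ suc m ℤ.* y) ⟩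
      - ⟦ ⁺ suc m ℤ.* y ⟧ℤ             ≡⟨ cong -_ (pos y) ⟩
      - (ι (suc m) * ⟦ y ⟧ℤ)           ≡⟨ -‿distribˡ-* _ _ ⟩
      - ι (suc m) * ⟦ y ⟧ℤ             ∎
      where
      open ≡-Reasoning
      pos : ∀ y → ⟦ ⁺ suc m ℤ.* y ⟧ℤ ≡ ι (suc m) * ⟦ y ⟧ℤ
      pos (⁺ n) = trans (cong ⟦_⟧ℤ (sym (ℤₚ.pos-* (suc m) n))) (×1-homo-* (suc m) n)
      pos -[1+ n ] = trans (cong ⟦_⟧ℤ (sym (ℤₚ.neg-distribʳ-* (⁺ suc m) (⁺ suc n))))
        (trans (⟦-⟧ (⁺ suc m ℤ.* ⁺ suc n))
        (trans (cong (λ z → - ⟦ z ⟧ℤ) (sym (ℤₚ.pos-* (suc m) (suc n))))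
        (trans (cong -_ (×1-homo-* (suc m) (suc n))) (-‿distribʳ-* _ _))))

    integers⟶F : CommutativeRing.rawRing ℤₚ.+-*-commutativeRing -Raw-AlmostCommutative⟶ fromCommutativeRing commutativeRing
    integers⟶F = record
      { ⟦_⟧ = ⟦_⟧ℤ ; +-homo = ⟦+⟧ ; *-homo = ⟦*⟧ ; -‿homo = ⟦-⟧ ; 0-homo = refl ; 1-homo = +-identityʳ 1# }

    sameInteger? : ∀ x y → Maybe (⟦ x ⟧ℤ ≡ ⟦ y ⟧ℤ)
    sameInteger? x y with x ℤ.≟ y
    ... | yes e = just (cong ⟦_⟧ℤ e)
    ... | no _  = nothing

  open import Algebra.Solver.Ring (CommutativeRing.rawRing ℤₚ.+-*-commutativeRing) (fromCommutativeRing commutativeRing)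
    integers⟶F sameInteger? public using (solve; _:=_; _:+_; _:*_; :-_; con; Polynomial)

  no-zero-divisors : ∀ {x y} → ¬ x ≡ 0# → ¬ y ≡ 0# → ¬ x * y ≡ 0#
  no-zero-divisors {x} {y} x≢0 y≢0 xy≡0 with inverse x x≢0
  ... | x′ , xx′≡1 = y≢0 (begin
    y              ≡⟨ sym (*-identityˡ y) ⟩
    1# * y         ≡⟨ cong (_* y) (sym xx′≡1) ⟩
    x * x′ * y     ≡⟨ solve 3 (λ x x′ y → x :* x′ :* y := x′ :* (x :* y)) refl x x′ y ⟩
    x′ * (x * y)   ≡⟨ cong (x′ *_) xy≡0 ⟩
    x′ * 0#        ≡⟨ zeroʳ x′ ⟩
    0#             ∎)
    where open ≡-Reasoning

  *-zeroˡ-cancel : ∀ {x y} → ¬ x ≡ 0# → x * y ≡ 0# → y ≡ 0#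
  *-zeroˡ-cancel {x} {y} x≢0 xy≡0 with y ≟ 0#
  ... | yes y≡0 = y≡0
  ... | no y≢0  = ⊥-elim (no-zero-divisors x≢0 y≢0 xy≡0)

  x-y≡0⇒x≡y : ∀ {x y} → x + - y ≡ 0# → x ≡ y
  x-y≡0⇒x≡y {x} {y} e = begin
    x               ≡⟨ solve 2 (λ x y → x := x :+ :- y :+ y) refl x y ⟩
    x + - y + y     ≡⟨ cong (_+ y) e ⟩
    0# + y          ≡⟨ +-identityˡ y ⟩
    y               ∎
    where open ≡-Reasoning

  *-cancelˡ : ∀ {x y z} → ¬ x ≡ 0# → x * y ≡ x * z → y ≡ z
  *-cancelˡ {x} {y} {z} x≢0 e = x-y≡0⇒x≡y (*-zeroˡ-cancel x≢0 (begin
    x * (y + - z)        ≡⟨ solve 3 (λ x y z → x :* (y :+ :- z) := x :* y :+ :- (x :* z)) refl x y z ⟩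
    x * y + - (x * z)    ≡⟨ cong (_+ - (x * z)) e ⟩
    x * z + - (x * z)    ≡⟨ -‿inverseʳ _ ⟩
    0#                   ∎))
    where open ≡-Reasoning

  -‿≢0 : ∀ {x} → ¬ x ≡ 0# → ¬ - x ≡ 0#
  -‿≢0 x≢0 e = x≢0 (trans (sym (-‿involutive _)) (trans (cong -_ e) -0#≈0#))

  1≢0 : ¬ 1# ≡ 0#
  1≢0 e = 0≢1 (sym e)

  -- The junk value is 0# ⁻¹ = 0#.
  infix 9 _⁻¹
  abstract
    _⁻¹ : Carrier → Carrier
    x ⁻¹ with x ≟ 0#
    ... | yes _  = 0#
    ... | no x≢0 = proj₁ (inverse x x≢0)

    *-inverseʳ : ∀ {x} → ¬ x ≡ 0# → x * x ⁻¹ ≡ 1#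
    *-inverseʳ {x} x≢0 with x ≟ 0#
    ... | yes x≡0 = ⊥-elim (x≢0 x≡0)
    ... | no x≢0′ = proj₂ (inverse x x≢0′)

    ⁻¹-≢0 : ∀ {x} → ¬ x ≡ 0# → ¬ x ⁻¹ ≡ 0#
    ⁻¹-≢0 {x} x≢0 e = 1≢0 (trans (sym (*-inverseʳ x≢0)) (trans (cong (x *_) e) (zeroʳ x)))

    0⁻¹≡0 : 0# ⁻¹ ≡ 0#
    0⁻¹≡0 with 0# ≟ 0#
    ... | yes _ = refl
    ... | no ¬r = ⊥-elim (¬r refl)

    ⁻¹-involutive : ∀ x → (x ⁻¹) ⁻¹ ≡ x
    ⁻¹-involutive x with x ≟ 0# in e
    ... | yes x≡0 = trans 0⁻¹≡0 (sym x≡0)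
    ... | no x≢0 = let y = proj₁ (inverse x x≢0); xy≡1 = proj₂ (inverse x x≢0)
                       y≢0 = λ (y≡0 : y ≡ 0#) → 1≢0 (trans (sym xy≡1) (trans (cong (x *_) y≡0) (zeroʳ x)))
                   in *-cancelˡ y≢0 (trans (*-inverseʳ y≢0) (trans (sym xy≡1) (*-comm x y)))

-- Subsets of a finite set and double counting.

module FiniteSubsets where
  open import Data.Nat using (pred; _+_; _*_)
  open ℕₚ hiding (suc-injective)

  module SumSingle {c ℓ} (M : CommutativeMonoid c ℓ) where
    open CommutativeMonoid M hiding (sym) renaming (trans to ≈-trans)
    open MonoidSum M

    sum-single : ∀ {n} (f : Fin n → Carrier) i → (∀ j → ¬ j ≡ i → f j ≈ ε) → sum f ≈ f i
    sum-single {suc n} f i others =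
      ≈-trans (sum-remove {i = i} f)
      (≈-trans (∙-congˡ (≈-trans (sum-cong-≋ (λ j → others (punchIn i j) (punchInᵢ≢i i j))) (sum-replicate-zero n)))
               (identityʳ (f i)))

  open MonoidSum +-0-commutativeMonoid public using (sum; ∑-distrib-+; ∑-comm; sum-cong-≗)
  open SumSingle +-0-commutativeMonoid public

  sum-mono : ∀ {n} {f g : Fin n → ℕ} → (∀ i → f i ≤ g i) → sum f ≤ sum g
  sum-mono {zero}  f≤g = z≤n
  sum-mono {suc n} f≤g = +-mono-≤ (f≤g zero) (sum-mono (f≤g ∘ suc))

  sum-const : ∀ n c → sum {n} (λ _ → c) ≡ n * c
  sum-const zero    c = refl
  sum-const (suc n) c = cong (c +_) (sum-const n c)

  sum-*ˡ : ∀ {n} c (f : Fin n → ℕ) → sum (λ i → c * f i) ≡ c * sum f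
  sum-*ˡ {zero}  c f = sym (*-zeroʳ c)
  sum-*ˡ {suc n} c f = trans (cong (c * f zero +_) (sum-*ˡ c (f ∘ suc))) (sym (*-distribˡ-+ c _ _))

  sum-≤-const : ∀ {n} {f : Fin n → ℕ} c → (∀ i → f i ≤ c) → sum f ≤ n * c
  sum-≤-const {n} c f≤c = ≤-trans (sum-mono f≤c) (≤-reflexive (sum-const n c))

  const-≤-sum : ∀ {n} {f : Fin n → ℕ} c → (∀ i → c ≤ f i) → n * c ≤ sum f
  const-≤-sum {n} c c≤f = ≤-trans (≤-reflexive (sym (sum-const n c))) (sum-mono c≤f)

  from-does : ∀ {p} {P : Set p} (d : Dec P) → does d ≡ true → P
  from-does (yes p) _ = p

  from-¬does : ∀ {p} {P : Set p} (d : Dec P) → does d ≡ false → ¬ P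
  from-¬does (no ¬p) _ = ¬p

  true≢false : ∀ {b} → b ≡ true → ¬ b ≡ false
  true≢false refl ()

  ≢true⇒false : ∀ {b} → ¬ b ≡ true → b ≡ false
  ≢true⇒false {true}  h = ⊥-elim (h refl)
  ≢true⇒false {false} h = refl

  ∧-true : ∀ {b c} → b ≡ true → c ≡ true → b ∧ c ≡ true
  ∧-true refl refl = refl

  ∧-trueˡ : ∀ {b c} → b ∧ c ≡ true → b ≡ true
  ∧-trueˡ {true} _ = refl

  ∧-trueʳ : ∀ {b c} → b ∧ c ≡ true → c ≡ true
  ∧-trueʳ {true} e = e

  not-true : ∀ {b} → not b ≡ true → b ≡ false
  not-true {false} _ = refl

  Sub : ℕ → Set
  Sub n = Fin n → Bool

  𝟙 : Bool → ℕ
  𝟙 true  = 1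
  𝟙 false = 0

  size : ∀ {n} → Sub n → ℕ
  size S = sum (λ i → 𝟙 (S i))

  𝟙-mono : ∀ {x y} → (x ≡ true → y ≡ true) → 𝟙 x ≤ 𝟙 y
  𝟙-mono {true}  f = ≤-reflexive (cong 𝟙 (sym (f refl)))
  𝟙-mono {false} f = z≤n

  size-mono : ∀ {n} {S T : Sub n} → (∀ i → S i ≡ true → T i ≡ true) → size S ≤ size T
  size-mono S⊆T = sum-mono (λ i → 𝟙-mono (S⊆T i))

  size-iff : ∀ {n} {S T : Sub n} → (∀ i → S i ≡ true → T i ≡ true) → (∀ i → T i ≡ true → S i ≡ true) → size S ≡ size T
  size-iff {S = S} {T} S⊆T T⊆S = ≤-antisym (size-mono {S = S} {T} S⊆T) (size-mono {S = T} {S} T⊆S)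

  size-cong : ∀ {n} {S T : Sub n} → (∀ i → S i ≡ T i) → size S ≡ size T
  size-cong S≗T = sum-cong-≗ (λ i → cong 𝟙 (S≗T i))

  size-complement : ∀ {n} (S : Sub n) → size S + size (not ∘ S) ≡ n
  size-complement {n} S = trans (sym (∑-distrib-+ (𝟙 ∘ S) (𝟙 ∘ not ∘ S)))
    (trans (sum-cong-≗ (λ i → pointwise (S i))) (trans (sum-const n 1) (*-identityʳ n)))
    where
    pointwise : ∀ b → 𝟙 b + 𝟙 (not b) ≡ 1
    pointwise true  = refl
    pointwise false = refl

  size-∨ : ∀ {n} (S T : Sub n) → size (λ i → S i ∨ T i) ≤ size S + size T
  size-∨ S T = ≤-trans (sum-mono (λ i → ∨-split (S i) (T i))) (≤-reflexive (∑-distrib-+ (𝟙 ∘ S) (𝟙 ∘ T)))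
    where
    ∨-split : ∀ x y → 𝟙 (x ∨ y) ≤ 𝟙 x + 𝟙 y
    ∨-split true  y = s≤s z≤n
    ∨-split false y = ≤-refl

  infixl 6 _∖_ _∪₁_
  _∖_ _∪₁_ : ∀ {n} → Sub n → Fin n → Sub n
  (S ∖ i) j = S j ∧ not (does (j ≟ᶠ i))
  (S ∪₁ i) j = S j ∨ does (j ≟ᶠ i)

  ∖-true : ∀ {n} (S : Sub n) {i j} → S j ≡ true → ¬ j ≡ i → (S ∖ i) j ≡ true
  ∖-true S {i} {j} Sj j≢i rewrite Sj | dec-false (j ≟ᶠ i) j≢i = refl

  ∖⇒S : ∀ {n} (S : Sub n) {i j} → (S ∖ i) j ≡ true → S j ≡ true
  ∖⇒S S {i} {j} e with S j
  ... | true = refl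

  ∖⇒≢ : ∀ {n} (S : Sub n) {i j} → (S ∖ i) j ≡ true → ¬ j ≡ i
  ∖⇒≢ S {i} {j} e with S j | j ≟ᶠ i
  ... | true | no j≢i = j≢i

  ∖-self : ∀ {n} (S : Sub n) i → (S ∖ i) i ≡ false
  ∖-self S i rewrite dec-true (i ≟ᶠ i) refl with S i
  ... | true  = refl
  ... | false = refl

  ∪₁-old : ∀ {n} (S : Sub n) {i j} → S j ≡ true → (S ∪₁ i) j ≡ true
  ∪₁-old S Sj rewrite Sj = refl

  ∪₁-new : ∀ {n} (S : Sub n) i → (S ∪₁ i) i ≡ true
  ∪₁-new S i rewrite dec-true (i ≟ᶠ i) refl with S i
  ... | true  = refl
  ... | false = refl

  ∪₁-false : ∀ {n} (S : Sub n) {i j} → S j ≡ false → ¬ j ≡ i → (S ∪₁ i) j ≡ false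
  ∪₁-false S {i} {j} Sj j≢i rewrite Sj | dec-false (j ≟ᶠ i) j≢i = refl

  ∪₁-cases : ∀ {n} (S : Sub n) {i j} → (S ∪₁ i) j ≡ true → S j ≡ true ⊎ j ≡ i
  ∪₁-cases S {i} {j} h with S j in e | j ≟ᶠ i
  ... | true  | _       = inj₁ refl
  ... | false | yes j≡i = inj₂ j≡i

  size-∖ : ∀ {n} (S : Sub n) {i} → S i ≡ true → size S ≡ suc (size (S ∖ i))
  size-∖ S {i} Si = begin
    sum (𝟙 ∘ S)                                            ≡⟨ sum-cong-≗ (λ j → pointwise (S j) (j ≟ᶠ i) (λ { refl → Si })) ⟩
    sum (λ j → 𝟙 (does (j ≟ᶠ i)) + 𝟙 ((S ∖ i) j))          ≡⟨ ∑-distrib-+ (λ j → 𝟙 (does (j ≟ᶠ i))) (𝟙 ∘ (S ∖ i)) ⟩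
    sum (λ j → 𝟙 (does (j ≟ᶠ i))) + size (S ∖ i)           ≡⟨ cong (_+ size (S ∖ i)) one ⟩
    1 + size (S ∖ i)                                       ∎
    where
    open ≡-Reasoning
    pointwise : ∀ b {j} (d : Dec (j ≡ i)) → (j ≡ i → b ≡ true) → 𝟙 b ≡ 𝟙 (does d) + 𝟙 (b ∧ not (does d))
    pointwise true  (yes _) _ = refl
    pointwise true  (no _)  _ = refl
    pointwise false (yes p) h with () ← h p
    pointwise false (no _)  _ = refl
    one : sum (λ j → 𝟙 (does (j ≟ᶠ i))) ≡ 1
    one = trans (sum-single _ i (λ j j≢i → cong 𝟙 (dec-false (j ≟ᶠ i) j≢i))) (cong 𝟙 (dec-true (i ≟ᶠ i) refl))

  size-∪₁ : ∀ {n} (S : Sub n) {i} → S i ≡ false → size (S ∪₁ i) ≡ suc (size S)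
  size-∪₁ S {i} Si = trans (size-∖ (S ∪₁ i) (∪₁-new S i)) (cong suc (size-cong (λ j → pointwise (S j) (j ≟ᶠ i) (λ { refl → Si }))))
    where
    pointwise : ∀ b {j} (d : Dec (j ≡ i)) → (j ≡ i → b ≡ false) → (b ∨ does d) ∧ not (does d) ≡ b
    pointwise true  (yes p) h = sym (h p)
    pointwise true  (no _)  _ = refl
    pointwise false (yes _) _ = refl
    pointwise false (no _)  _ = refl

  inhabited : ∀ {n} (S : Sub n) → 0 < size S → ∃ λ i → S i ≡ true
  inhabited {suc n} S pos with S zero in e
  ... | true  = zero , e
  ... | false = let i , Si = inhabited (S ∘ suc) pos in suc i , Si

  member-size : ∀ {n} (S : Sub n) {i} → S i ≡ true → 1 ≤ size S
  member-size S Si rewrite size-∖ S Si = s≤s z≤n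

  size-2 : ∀ {n} (S : Sub n) {i j} → S i ≡ true → S j ≡ true → ¬ j ≡ i → 2 ≤ size S
  size-2 S {i} Si Sj j≢i rewrite size-∖ S Si = s≤s (member-size (S ∖ i) (∖-true S Sj j≢i))

  size-3 : ∀ {n} (S : Sub n) {i j k} → S i ≡ true → S j ≡ true → S k ≡ true → ¬ j ≡ i → ¬ k ≡ i → ¬ k ≡ j → 3 ≤ size S
  size-3 S {i} Si Sj Sk j≢i k≢i k≢j rewrite size-∖ S Si =
    s≤s (size-2 (S ∖ i) (∖-true S Sj j≢i) (∖-true S Sk k≢i) k≢j)

  size-4 : ∀ {n} (S : Sub n) {i j k l} → S i ≡ true → S j ≡ true → S k ≡ true → S l ≡ true →
           ¬ j ≡ i → ¬ k ≡ i → ¬ k ≡ j → ¬ l ≡ i → ¬ l ≡ j → ¬ l ≡ k → 4 ≤ size S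
  size-4 S {i} Si Sj Sk Sl j≢i k≢i k≢j l≢i l≢j l≢k rewrite size-∖ S Si =
    s≤s (size-3 (S ∖ i) (∖-true S Sj j≢i) (∖-true S Sk k≢i) (∖-true S Sl l≢i) k≢j l≢j l≢k)

  size-≤1 : ∀ {n} (S : Sub n) → (∀ {i j} → S i ≡ true → S j ≡ true → i ≡ j) → size S ≤ 1
  size-≤1 S unique with size S in e
  ... | zero = z≤n
  ... | suc zero = ≤-refl
  ... | suc (suc m) with i , Si ← inhabited S (subst (0 <_) (sym e) (s≤s z≤n))
    with j , Sj ← inhabited (S ∖ i) (subst (0 <_) (sym (cong pred (trans (sym (size-∖ S Si)) e))) (s≤s z≤n)) =
    ⊥-elim (∖⇒≢ S Sj (unique (∖⇒S S Sj) Si))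

  intermediate : ∀ {n} (P R : Sub n) → (∀ i → P i ≡ true → R i ≡ true) → ∀ r → size P ≤ r → r ≤ size R →
    ∃ λ S → (∀ i → P i ≡ true → S i ≡ true) × (∀ i → S i ≡ true → R i ≡ true) × size S ≡ r
  intermediate P R P⊆R r P≤r r≤R with m≤n⇒∃[o]m+o≡n P≤r
  ... | o , e = grow o P P⊆R (trans (+-comm o (size P)) e)
    where
    grow : ∀ o P → (∀ i → P i ≡ true → R i ≡ true) → o + size P ≡ r →
      ∃ λ S → (∀ i → P i ≡ true → S i ≡ true) × (∀ i → S i ≡ true → R i ≡ true) × size S ≡ r
    grow zero    P P⊆R e = P , (λ _ Pi → Pi) , P⊆R , e
    grow (suc o) P P⊆R e with missing P P⊆R (≤-trans (s≤s (m≤n+m (size P) o)) (≤-trans (≤-reflexive e) r≤R))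
      where
      missing : ∀ {n} (P : Sub n) {R : Sub n} → (∀ i → P i ≡ true → R i ≡ true) → size P < size R → ∃ λ i → R i ≡ true × P i ≡ false
      missing {suc n} P {R} P⊆R lt with P zero in p | R zero in r
      ... | true  | true  = let i , Ri , Pi = missing (P ∘ suc) (P⊆R ∘ suc) (≤-pred lt) in suc i , Ri , Pi
      ... | true  | false with () ← trans (sym (P⊆R zero p)) r
      ... | false | true  = zero , r , p
      ... | false | false = let i , Ri , Pi = missing (P ∘ suc) (P⊆R ∘ suc) lt in suc i , Ri , Pi
    ... | i , Ri , Pi = let S , P⊆S , S⊆R , eq = grow o (P ∪₁ i) P∪i⊆R (trans (cong (o +_) (size-∪₁ P Pi)) (trans (+-suc o (size P)) e))
                        in S , (λ j Pj → P⊆S j (∪₁-old P Pj)) , S⊆R , eq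
      where
      P∪i⊆R : ∀ j → (P ∪₁ i) j ≡ true → R j ≡ true
      P∪i⊆R j h with P j in Pj | j ≟ᶠ i
      ... | true  | _        = P⊆R j Pj
      ... | false | yes refl = Ri

  subset-of-size : ∀ {n} (R : Sub n) r → r ≤ size R → ∃ λ S → (∀ i → S i ≡ true → R i ≡ true) × size S ≡ r
  subset-of-size {n} R r r≤ with S , _ , S⊆R , e ← intermediate (λ _ → false) R (λ _ ()) r
    (≤-trans (≤-reflexive (trans (sum-const n 0) (*-zeroʳ n))) z≤n) r≤ = S , S⊆R , e

  -- Used to restrict words to the positions in `S`: they become vectors over `Fin N`, and `size-at`
  -- transfers the counts of their zeros.
  record Enumeration {n} (S : Sub n) (N : ℕ) : Set where
    field
      at         : Fin N → Fin n
      at-true    : ∀ j → S (at j) ≡ true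
      at-inj     : ∀ {i j} → at i ≡ at j → i ≡ j
      index      : ∀ {i} → S i ≡ true → ∃ λ j → at j ≡ i
      size-at    : ∀ (T : Sub n) → size (T ∘ at) ≡ size (λ i → S i ∧ T i)

  enumerate : ∀ {n} (S : Sub n) N → size S ≡ N → Enumeration S N
  enumerate {zero}  S .0 refl = record
    { at = λ () ; at-true = λ () ; at-inj = λ { {()} } ; index = λ { {()} } ; size-at = λ _ → refl }
  enumerate {suc n} S N refl with S zero in e
  ... | false = record
    { at = suc ∘ at ; at-true = at-true ; at-inj = at-inj ∘ suc-injective
    ; index = λ { {zero} Sz → ⊥-elim (true≢false Sz e) ; {suc i} Si → let j , eq = index Si in j , cong suc eq }
    ; size-at = λ T → trans (size-at (T ∘ suc)) (cong (λ b → 𝟙 (b ∧ T zero) + size (λ i → S (suc i) ∧ T (suc i))) (sym e)) }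
    where
    open Enumeration (enumerate (S ∘ suc) _ refl)
  ... | true = record
    { at = at⁺ ; at-true = at-true⁺ ; at-inj = at-inj⁺
    ; index = λ { {zero} _ → zero , refl ; {suc i} Si → let j , eq = index Si in suc j , cong suc eq }
    ; size-at = λ T → trans (cong (𝟙 (T zero) +_) (size-at (T ∘ suc))) (cong (λ b → 𝟙 (b ∧ T zero) + size (λ i → S (suc i) ∧ T (suc i))) (sym e)) }
    where
    open Enumeration (enumerate (S ∘ suc) _ refl)
    at⁺ : Fin (suc (size (S ∘ suc))) → Fin (suc n)
    at⁺ zero    = zero
    at⁺ (suc j) = suc (at j)
    at-true⁺ : ∀ j → S (at⁺ j) ≡ true
    at-true⁺ zero    = e
    at-true⁺ (suc j) = at-true j
    at-inj⁺ : ∀ {i j} → at⁺ i ≡ at⁺ j → i ≡ j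
    at-inj⁺ {zero}  {zero}  _  = refl
    at-inj⁺ {suc i} {suc j} eq = cong suc (at-inj (suc-injective eq))

-- Linear algebra over F by Gaussian elimination.

module LinearAlgebra {q : ℕ} (F : FiniteField q) where
  open FieldArithmetic F
  open FiniteSubsets using (module SumSingle)

  ∑F : ∀ {m} → (Fin m → Carrier) → Carrier
  ∑F = ∑ F

  infix 8 _∙_
  _∙_ : ∀ {m} → Vect F m → Vect F m → Carrier
  x ∙ y = ⟨_,_⟩ F x y

  open MonoidSum +-commutativeMonoid using (sum)

  ∑≡sum : ∀ {m} (f : Fin m → Carrier) → ∑F f ≡ sum f
  ∑≡sum {zero}  f = refl
  ∑≡sum {suc m} f = cong (f zero +_) (∑≡sum (f ∘ suc))

  ∑-cong : ∀ {m} {f g : Fin m → Carrier} → (∀ i → f i ≡ g i) → ∑F f ≡ ∑F g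
  ∑-cong {zero}  f≗g = refl
  ∑-cong {suc m} f≗g = cong₂ _+_ (f≗g zero) (∑-cong (f≗g ∘ suc))

  ∑-zero : ∀ {m} {f : Fin m → Carrier} → (∀ i → f i ≡ 0#) → ∑F f ≡ 0#
  ∑-zero {zero}  f≗0 = refl
  ∑-zero {suc m} f≗0 = trans (cong₂ _+_ (f≗0 zero) (∑-zero (f≗0 ∘ suc))) (+-identityˡ 0#)

  ∑-linear : ∀ {m} l l′ (f g : Fin m → Carrier) → ∑F (λ i → l * f i + l′ * g i) ≡ l * ∑F f + l′ * ∑F g
  ∑-linear {zero}  l l′ f g = sym (trans (cong₂ _+_ (zeroʳ l) (zeroʳ l′)) (+-identityˡ 0#))
  ∑-linear {suc m} l l′ f g = trans (cong (_ +_) (∑-linear l l′ (f ∘ suc) (g ∘ suc)))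
    (solve 6 (λ l l′ a b s t → (l :* a :+ l′ :* b) :+ (l :* s :+ l′ :* t) := l :* (a :+ s) :+ l′ :* (b :+ t)) refl
       l l′ (f zero) (g zero) (∑F (f ∘ suc)) (∑F (g ∘ suc)))

  ∑-*ˡ : ∀ {m} l (f : Fin m → Carrier) → ∑F (λ i → l * f i) ≡ l * ∑F f
  ∑-*ˡ {zero}  l f = sym (zeroʳ l)
  ∑-*ˡ {suc m} l f = trans (cong (l * f zero +_) (∑-*ˡ l (f ∘ suc))) (sym (distribˡ l _ _))

  ∑-swap : ∀ {m n} (f : Fin m → Fin n → Carrier) → ∑F (λ i → ∑F (f i)) ≡ ∑F (λ j → ∑F (λ i → f i j))
  ∑-swap f = begin
    ∑F (λ i → ∑F (f i))              ≡⟨ ∑-cong (λ i → ∑≡sum (f i)) ⟩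
    ∑F (λ i → sum (f i))             ≡⟨ ∑≡sum (λ i → sum (f i)) ⟩
    sum (λ i → sum (f i))            ≡⟨ MonoidSum.∑-comm +-commutativeMonoid f ⟩
    sum (λ j → sum (λ i → f i j))    ≡⟨ sym (∑≡sum (λ j → sum (λ i → f i j))) ⟩
    ∑F (λ j → sum (λ i → f i j))     ≡⟨ ∑-cong {f = λ j → sum (λ i → f i j)} (λ j → sym (∑≡sum (λ i → f i j))) ⟩
    ∑F (λ j → ∑F (λ i → f i j))      ∎
    where open ≡-Reasoning

  ∑-single : ∀ {m} (f : Fin m → Carrier) i → (∀ j → ¬ j ≡ i → f j ≡ 0#) → ∑F f ≡ f i
  ∑-single f i others = trans (∑≡sum f) (SumSingle.sum-single +-commutativeMonoid f i others)

  ∙-linearˡ : ∀ {m} l l′ (x y z : Vect F m) → (λ i → l * x i + l′ * y i) ∙ z ≡ l * (x ∙ z) + l′ * (y ∙ z)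
  ∙-linearˡ l l′ x y z = trans
    (∑-cong (λ i → solve 5 (λ l l′ x y z → (l :* x :+ l′ :* y) :* z := l :* (x :* z) :+ l′ :* (y :* z)) refl l l′ (x i) (y i) (z i)))
    (∑-linear l l′ (λ i → x i * z i) (λ i → y i * z i))

  ∙-comm : ∀ {m} (x y : Vect F m) → x ∙ y ≡ y ∙ x
  ∙-comm x y = ∑-cong (λ i → *-comm (x i) (y i))

  ∙-linearʳ : ∀ {m} l l′ (x y z : Vect F m) → z ∙ (λ i → l * x i + l′ * y i) ≡ l * (z ∙ x) + l′ * (z ∙ y)
  ∙-linearʳ l l′ x y z = trans (∙-comm z _) (trans (∙-linearˡ l l′ x y z) (cong₂ (λ s t → l * s + l′ * t) (∙-comm x z) (∙-comm y z)))

  unit : ∀ {m} → Fin m → Vect F m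
  unit i j = if does (j ≟ᶠ i) then 1# else 0#

  unit-diag : ∀ {m} (i : Fin m) → unit i i ≡ 1#
  unit-diag i rewrite dec-true (i ≟ᶠ i) refl = refl

  unit-off : ∀ {m} {i j : Fin m} → ¬ j ≡ i → unit i j ≡ 0#
  unit-off {i = i} {j} j≢i rewrite dec-false (j ≟ᶠ i) j≢i = refl

  ∙-unit : ∀ {m} (x : Vect F m) i → x ∙ unit i ≡ x i
  ∙-unit x i = trans (∑-single _ i (λ j j≢i → trans (cong (x j *_) (unit-off j≢i)) (zeroʳ (x j))))
    (trans (cong (x i *_) (unit-diag i)) (*-identityʳ (x i)))

  nonZero-index : ∀ {m} {x : Vect F m} → NonZeroVec F x → ∃ λ i → ¬ x i ≡ 0#
  nonZero-index {m} {x} x≢0 = ¬∀⟶∃¬ m (λ i → x i ≡ 0#) (λ i → x i ≟ 0#) x≢0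

  index-nonZero : ∀ {m} {x : Vect F m} {i} → ¬ x i ≡ 0# → NonZeroVec F x
  index-nonZero xi≢0 x≡0 = xi≢0 (x≡0 _)

  private
    -- Subtracts from `w` the multiple of the pivot `v` that clears the first coordinate, and drops
    -- that coordinate. The factor `1#` gives the shape of `∙-linearʳ`.
    eliminate : ∀ {k} → Vect F (suc k) → Vect F (suc k) → Vect F k
    eliminate v w i = 1# * w (suc i) + - (w zero * v zero ⁻¹) * v (suc i)

    prepend : ∀ {k} → Carrier → Vect F k → Vect F (suc k)
    prepend c y zero    = c
    prepend c y (suc i) = y i

    -- The prepended coordinate is the one that makes the extended vector orthogonal to the pivot
    -- `v`; pairing with `w` may then be computed after reduction.
    back-substitute : ∀ {k} (v w : Vect F (suc k)) (y : Vect F k) →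
      prepend (- ((y ∙ (v ∘ suc)) * v zero ⁻¹)) y ∙ w ≡ y ∙ eliminate v w
    back-substitute v w y = begin
      - ((y ∙ (v ∘ suc)) * v zero ⁻¹) * w zero + y ∙ (w ∘ suc)
        ≡⟨ solve 4 (λ s p w₀ t → :- (s :* p) :* w₀ :+ t := con (ℤ.+ 1) :* t :+ :- (w₀ :* p) :* s) refl
             (y ∙ (v ∘ suc)) (v zero ⁻¹) (w zero) (y ∙ (w ∘ suc)) ⟩
      (1# + 0#) * (y ∙ (w ∘ suc)) + - (w zero * v zero ⁻¹) * (y ∙ (v ∘ suc))
        ≡⟨ cong (λ u → u * (y ∙ (w ∘ suc)) + - (w zero * v zero ⁻¹) * (y ∙ (v ∘ suc))) (+-identityʳ 1#) ⟩
      1# * (y ∙ (w ∘ suc)) + - (w zero * v zero ⁻¹) * (y ∙ (v ∘ suc))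
        ≡⟨ sym (∙-linearʳ 1# _ (w ∘ suc) (v ∘ suc) y) ⟩
      y ∙ eliminate v w ∎
      where open ≡-Reasoning

    eliminate-self : ∀ {k} (v : Vect F (suc k)) → ¬ v zero ≡ 0# → ∀ i → eliminate v v i ≡ 0#
    eliminate-self v v₀≢0 i = begin
      1# * v (suc i) + - (v zero * v zero ⁻¹) * v (suc i)
        ≡⟨ cong (λ u → 1# * v (suc i) + - u * v (suc i)) (*-inverseʳ v₀≢0) ⟩
      1# * v (suc i) + - 1# * v (suc i)
        ≡⟨ solve 2 (λ o x → o :* x :+ :- o :* x := con (ℤ.+ 0)) refl 1# (v (suc i)) ⟩
      0# ∎
      where open ≡-Reasoning

    ∙-zeroʳ : ∀ {k} (y : Vect F k) {w} → (∀ i → w i ≡ 0#) → y ∙ w ≡ 0#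
    ∙-zeroʳ y w≡0 = ∑-zero (λ i → trans (cong (y i *_) (w≡0 i)) (zeroʳ (y i)))

    e₀∙ : ∀ {k} (w : Vect F (suc k)) → prepend 1# (λ _ → 0#) ∙ w ≡ w zero
    e₀∙ w = trans (cong₂ _+_ (*-identityˡ (w zero)) (∑-zero (λ i → zeroˡ (w (suc i))))) (+-identityʳ _)

  -- A pivot uses up one vector and one coordinate, which preserves `m < k`. Without a pivot, the
  -- first unit vector is already orthogonal to all `v j`.
  kernel : ∀ {m} k (v : Fin m → Vect F k) → m < k → ∃ λ y → NonZeroVec F y × (∀ j → y ∙ v j ≡ 0#)
  kernel {m} (suc k) v m<k with any? (λ j → ¬? (v j zero ≟ 0#))
  ... | no none = prepend 1# (λ _ → 0#) , index-nonZero {i = zero} 1≢0 ,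
    λ j → trans (e₀∙ (v j)) (decidable-stable (v j zero ≟ 0#) (λ h → none (j , h)))
  kernel {suc m} (suc k) v (s≤s m<k) | yes (p , pivot)
    with y , y≢0 , y∙w ← kernel k (λ j → eliminate (v p) (v (punchIn p j))) m<k =
    prepend _ y , (λ z → y≢0 (λ i → z (suc i))) , λ j → trans (back-substitute (v p) (v j) y) (orthogonal j)
    where
    orthogonal : ∀ j → y ∙ eliminate (v p) (v j) ≡ 0#
    orthogonal j with p ≟ᶠ j
    ... | yes refl = ∙-zeroʳ y (eliminate-self (v p) pivot)
    ... | no p≢j   = subst (λ i → y ∙ eliminate (v p) (v i) ≡ 0#) (punchIn-punchOut p≢j) (y∙w (punchOut p≢j))

  -- Elimination as in `kernel`, with `b` reduced along. The pivot remains in the list, where its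
  -- reduction is zero, so that the coefficients `x` keep their index set.
  fredholm : ∀ {m} k (v : Fin m → Vect F k) (b : Vect F k) →
    (∃ λ (x : Vect F m) → ∀ l → b l ≡ x ∙ (λ j → v j l)) ⊎
    (∃ λ y → (∀ j → y ∙ v j ≡ 0#) × ¬ y ∙ b ≡ 0#)
  fredholm zero v b = inj₁ ((λ _ → 0#) , λ ())
  fredholm (suc k) v b with any? (λ j → ¬? (v j zero ≟ 0#))
  fredholm (suc k) v b | no none with b zero ≟ 0#
  ... | no b₀≢0 = inj₂ (prepend 1# (λ _ → 0#)
      , (λ j → trans (e₀∙ (v j)) (decidable-stable (v j zero ≟ 0#) (λ h → none (j , h))))
      , λ e → b₀≢0 (trans (sym (e₀∙ b)) e))
  ... | yes b₀≡0 with fredholm k (λ j → v j ∘ suc) (b ∘ suc)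
  ...   | inj₁ (x , e) = inj₁ (x , λ { zero → trans b₀≡0 (sym (∙-zeroʳ x (λ j → decidable-stable (v j zero ≟ 0#) (λ h → none (j , h)))))
                                     ; (suc l) → e l })
  ...   | inj₂ (y , y∙v , y∙b) = inj₂ (prepend 0# y , (λ j → trans (0∙ (v j)) (y∙v j)) , λ e → y∙b (trans (sym (0∙ b)) e))
    where
    0∙ : ∀ w → prepend 0# y ∙ w ≡ y ∙ (w ∘ suc)
    0∙ w = trans (cong (_+ y ∙ (w ∘ suc)) (zeroˡ (w zero))) (+-identityˡ (y ∙ (w ∘ suc)))
  fredholm {m} (suc k) v b | yes (p , pivot) with fredholm k (λ j → eliminate (v p) (v j)) (eliminate (v p) b)
  ... | inj₂ (y , y∙w , y∙b) = inj₂ (prepend _ y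
      , (λ j → trans (back-substitute (v p) (v j) y) (y∙w j))
      , λ e → y∙b (trans (sym (back-substitute (v p) b y)) e))
  ... | inj₁ (x , e) = inj₁ (x⁺ , combination)
    where
    open ≡-Reasoning
    π = v p zero ⁻¹
    -- The pivot reduces to zero, so its coefficient is free in the reduced system; the first
    -- coordinate determines the correction.
    s = b zero * π + - (x ∙ (λ j → v j zero) * π)
    x⁺ : Vect F m
    x⁺ i = 1# * x i + s * unit p i
    x⁺∙ : ∀ l → x⁺ ∙ (λ j → v j l) ≡ 1# * (x ∙ (λ j → v j l)) + s * v p l
    x⁺∙ l = trans (∙-linearˡ 1# s x (unit p) (λ j → v j l))
      (cong (λ z → 1# * (x ∙ (λ j → v j l)) + s * z) (trans (∙-comm (unit p) (λ j → v j l)) (∙-unit (λ j → v j l) p)))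
    combination : ∀ l → b l ≡ x⁺ ∙ (λ j → v j l)
    combination zero = sym (begin
      x⁺ ∙ (λ j → v j zero)                 ≡⟨ x⁺∙ zero ⟩
      1# * X + s * v p zero                 ≡⟨ cong (λ u → u * X + s * v p zero) (sym (*-inverseʳ pivot)) ⟩
      v p zero * π * X + s * v p zero       ≡⟨ solve 4 (λ w π b X → w :* π :* X :+ (b :* π :+ :- (X :* π)) :* w := b :* (w :* π)) refl (v p zero) π (b zero) X ⟩
      b zero * (v p zero * π)               ≡⟨ cong (b zero *_) (*-inverseʳ pivot) ⟩
      b zero * 1#                           ≡⟨ *-identityʳ _ ⟩
      b zero                                ∎)
      where X = x ∙ (λ j → v j zero)
    combination (suc l) = sym (begin
      x⁺ ∙ (λ j → v j (suc l))                ≡⟨ x⁺∙ (suc l) ⟩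
      1# * Y + s * V                        ≡⟨ solve 6 (λ o Y b π X V → o :* Y :+ (b :* π :+ :- (X :* π)) :* V := (o :* Y :+ :- (π :* V) :* X) :+ b :* π :* V) refl 1# Y (b zero) π X V ⟩
      (1# * Y + - (π * V) * X) + b zero * π * V  ≡⟨ cong (_+ b zero * π * V) (sym (∙-linearʳ 1# (- (π * V)) (λ j → v j (suc l)) (λ j → v j zero) x)) ⟩
      x ∙ (λ j → 1# * v j (suc l) + - (π * V) * v j zero) + b zero * π * V
        ≡⟨ cong (_+ b zero * π * V) (∑-cong (λ j → cong (x j *_) (cong (1# * v j (suc l) +_)
             (solve 3 (λ π V a → :- (π :* V) :* a := :- (a :* π) :* V) refl π V (v j zero))))) ⟩
      x ∙ (λ j → eliminate (v p) (v j) l) + b zero * π * V ≡⟨ cong (_+ b zero * π * V) (sym (e l)) ⟩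
      eliminate (v p) b l + b zero * π * V
        ≡⟨ solve 3 (λ B w V → B :+ :- w :* V :+ w :* V := B) refl (1# * b (suc l)) (b zero * π) V ⟩
      1# * b (suc l)                          ≡⟨ *-identityˡ _ ⟩
      b (suc l)                               ∎)
      where
      X = x ∙ (λ j → v j zero)
      Y = x ∙ (λ j → v j (suc l))
      V = v p (suc l)

-- Pencils of words, and codes described by prescribed zeros.

module DualPairs {q : ℕ} (F : FiniteField q) where
  open FieldArithmetic F
  open FiniteSubsets
  open LinearAlgebra F

  open Inverse enumeration public using () renaming (to to elt; from to idx)

  elt-idx : ∀ x → elt (idx x) ≡ x
  elt-idx = Inverse.strictlyInverseˡ enumeration

  idx-elt : ∀ i → idx (elt i) ≡ i
  idx-elt = Inverse.strictlyInverseʳ enumeration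

  is0 : Carrier → Bool
  is0 x = does (x ≟ 0#)

  is0-true : ∀ {x} → x ≡ 0# → is0 x ≡ true
  is0-true {x} = dec-true (x ≟ 0#)

  is0-false : ∀ {x} → ¬ x ≡ 0# → is0 x ≡ false
  is0-false {x} = dec-false (x ≟ 0#)

  true⇒0 : ∀ {x} → is0 x ≡ true → x ≡ 0#
  true⇒0 {x} = from-does (x ≟ 0#)

  false⇒≢0 : ∀ {x} → is0 x ≡ false → ¬ x ≡ 0#
  false⇒≢0 {x} = from-¬does (x ≟ 0#)

  count-solutions : ∀ {P : Carrier → Bool} x → P x ≡ true → (∀ y → P y ≡ true → y ≡ x) → size (P ∘ elt) ≡ 1
  count-solutions {P} x Px unique = trans
    (sum-single (𝟙 ∘ P ∘ elt) (idx x) (λ j j≢ → cong 𝟙 (false′ j (λ e → j≢ (trans (sym (idx-elt j)) (cong idx e))))))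
    (cong 𝟙 (trans (cong P (elt-idx x)) Px))
    where
    false′ : ∀ j → ¬ elt j ≡ x → P (elt j) ≡ false
    false′ j ne with P (elt j) in e
    ... | true  = ⊥-elim (ne (unique (elt j) e))
    ... | false = refl

  -- The functionals β and α + lβ (l ∈ F) represent the lines of a pencil: a point lies on exactly
  -- one of them, or on all q + 1 of them.
  pencil-point : ∀ α β → 𝟙 (is0 β) ℕ.+ size (λ l → is0 (α + elt l * β)) ≡ 1 ℕ.+ q ℕ.* 𝟙 (is0 α ∧ is0 β)
  pencil-point α β with β ≟ 0# | α ≟ 0#
  ... | yes refl | yes refl = cong suc (trans
    (sum-cong-≗ {q} (λ l → cong 𝟙 (is0-true (trans (+-identityˡ _) (zeroʳ (elt l))))))
    (sum-const q 1))
  ... | yes refl | no α≢0 = cong suc (trans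
    (sum-cong-≗ {q} (λ l → cong 𝟙 (is0-false (λ e → α≢0 (trans (sym (trans (cong (α +_) (zeroʳ (elt l))) (+-identityʳ α))) e)))))
    (sum-const q 0))
  ... | no β≢0 | d = trans (count-solutions {λ l → is0 (α + l * β)} x (is0-true solves) unique)
      (cong suc (sym (trans (cong (λ b → q ℕ.* 𝟙 b) (∧-false (does d))) (*-zeroʳ q))))
    where
    ∧-false : ∀ b → b ∧ false ≡ false
    ∧-false true  = refl
    ∧-false false = refl
    x = - α * β ⁻¹
    solves : α + x * β ≡ 0#
    solves = begin
      α + - α * β ⁻¹ * β      ≡⟨ solve 3 (λ α β β′ → α :+ :- α :* β′ :* β := α :+ :- α :* (β :* β′)) refl α β (β ⁻¹) ⟩
      α + - α * (β * β ⁻¹)    ≡⟨ cong (λ u → α + - α * u) (*-inverseʳ β≢0) ⟩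
      α + - α * 1#            ≡⟨ cong (α +_) (*-identityʳ (- α)) ⟩
      α + - α                 ≡⟨ -‿inverseʳ α ⟩
      0#                      ∎
      where open ≡-Reasoning
    unique : ∀ y → is0 (α + y * β) ≡ true → y ≡ x
    unique y e = *-cancelˡ β≢0 (x-y≡0⇒x≡y (begin
      β * y + - (β * x)                ≡⟨ solve 4 (λ α β x y → β :* y :+ :- (β :* x) := (α :+ y :* β) :+ :- (α :+ x :* β)) refl α β x y ⟩
      (α + y * β) + - (α + x * β)      ≡⟨ cong₂ (λ s t → s + - t) (true⇒0 e) solves ⟩
      0# + - 0#                        ≡⟨ -‿inverseʳ 0# ⟩
      0#                               ∎))
      where open ≡-Reasoning

  -- `pencil-point` summed over all positions, with the order of summation exchanged.
  pencil-sum : ∀ {n} (a b : Fin n → Carrier) →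
    size (is0 ∘ b) ℕ.+ sum (λ l → size (λ i → is0 (a i + elt l * b i))) ≡ n ℕ.+ q ℕ.* size (λ i → is0 (a i) ∧ is0 (b i))
  pencil-sum {n} a b = begin
    size (is0 ∘ b) ℕ.+ sum (λ l → size (λ i → is0 (a i + elt l * b i)))
      ≡⟨ cong (size (is0 ∘ b) ℕ.+_) (∑-comm (λ l i → 𝟙 (is0 (a i + elt l * b i)))) ⟩
    size (is0 ∘ b) ℕ.+ sum (λ i → size (λ l → is0 (a i + elt l * b i)))
      ≡⟨ sym (∑-distrib-+ (λ i → 𝟙 (is0 (b i))) (λ i → size (λ l → is0 (a i + elt l * b i)))) ⟩
    sum (λ i → 𝟙 (is0 (b i)) ℕ.+ size (λ l → is0 (a i + elt l * b i)))
      ≡⟨ sum-cong-≗ (λ i → pencil-point (a i) (b i)) ⟩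
    sum (λ i → 1 ℕ.+ q ℕ.* 𝟙 (is0 (a i) ∧ is0 (b i)))
      ≡⟨ ∑-distrib-+ (λ _ → 1) (λ i → q ℕ.* 𝟙 (is0 (a i) ∧ is0 (b i))) ⟩
    sum {n} (λ _ → 1) ℕ.+ sum (λ i → q ℕ.* 𝟙 (is0 (a i) ∧ is0 (b i)))
      ≡⟨ cong₂ ℕ._+_ (trans (sum-const n 1) (ℕₚ.*-identityʳ n)) (sum-*ˡ q (λ i → 𝟙 (is0 (a i) ∧ is0 (b i)))) ⟩
    n ℕ.+ q ℕ.* size (λ i → is0 (a i) ∧ is0 (b i)) ∎
    where open ≡-Reasoning

  zeros : ∀ {n} → Vect F n → Sub n
  zeros x = is0 ∘ x

  wt≡size : ∀ {n} (x : Vect F n) → wt F x ≡ size (not ∘ zeros x)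
  wt≡size {zero}  x = refl
  wt≡size {suc n} x with x zero ≟ 0#
  ... | yes _ = wt≡size (x ∘ suc)
  ... | no _  = cong suc (wt≡size (x ∘ suc))

  zeros+wt : ∀ {n} (x : Vect F n) → size (zeros x) ℕ.+ wt F x ≡ n
  zeros+wt x = trans (cong (size (zeros x) ℕ.+_) (wt≡size x)) (size-complement (zeros x))

  wt-cong : ∀ {n} {x y : Vect F n} → (∀ i → x i ≡ y i) → wt F x ≡ wt F y
  wt-cong {x = x} {y} x≗y = trans (wt≡size x) (trans (size-cong (λ i → cong (not ∘ is0) (x≗y i))) (sym (wt≡size y)))

  wt-≤-support : ∀ {n} (x : Vect F n) (S : Sub n) → (∀ i → S i ≡ false → x i ≡ 0#) → wt F x ≤ size S
  wt-≤-support x S supported = ≤-trans (≤-reflexive (wt≡size x)) (size-mono inS)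
    where
    inS : ∀ i → not (zeros x i) ≡ true → S i ≡ true
    inS i h with S i in e
    ... | true  = refl
    ... | false with () ← trans (sym h) (cong not (is0-true (supported i e)))

  ∙-single : ∀ {n} {x y : Vect F n} i → (∀ j → ¬ j ≡ i → x j ≡ 0# ⊎ y j ≡ 0#) → x ∙ y ≡ x i * y i
  ∙-single {x = x} {y} i others = ∑-single _ i
    (λ j j≢i → [ (λ e → trans (cong (_* y j) e) (zeroˡ (y j))) , (λ e → trans (cong (x j *_) e) (zeroʳ (x j))) ]′ (others j j≢i))

  -- A pair of mutually orthogonal linear codes of complementary dimensions K and K′, described only
  -- through the words with prescribed zeros; unlike generator matrices, this is symmetric in C and D.
  record DualPair {n : ℕ} (C D : Code F n) (K K′ : ℕ) : Set where
    field
      dims  : K ℕ.+ K′ ≡ n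
      respC : ∀ {x y} → (∀ i → x i ≡ y i) → C x → C y
      respD : ∀ {x y} → (∀ i → x i ≡ y i) → D x → D y
      combC : ∀ {x y} → C x → C y → ∀ l l′ → C (λ i → l * x i + l′ * y i)
      combD : ∀ {x y} → D x → D y → ∀ l l′ → D (λ i → l * x i + l′ * y i)
      orth  : ∀ {x y} → C x → D y → x ∙ y ≡ 0#
      vanC  : ∀ S → size S < K → ∃ λ x → C x × NonZeroVec F x × (∀ i → S i ≡ true → x i ≡ 0#)
      vanD  : ∀ S → size S < K′ → ∃ λ x → D x × NonZeroVec F x × (∀ i → S i ≡ true → x i ≡ 0#)
      alt   : ∀ (S : Sub n) j → S j ≡ false →
              (∃ λ x → C x × (∀ i → S i ≡ true → x i ≡ 0#) × ¬ x j ≡ 0#) ⊎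
              (∃ λ y → D y × (∀ i → S i ≡ false → ¬ i ≡ j → y i ≡ 0#) × ¬ y j ≡ 0#)

  -- The alternative is self-dual: exchanging `C` and `D` amounts to replacing `S` by the complement
  -- of `S ∪₁ j`.
  swap : ∀ {n} {C D : Code F n} {K K′} → DualPair C D K K′ → DualPair D C K′ K
  swap {K = K} {K′} P = record
    { dims = trans (ℕₚ.+-comm K′ K) dims ; respC = respD ; respD = respC ; combC = combD ; combD = combC
    ; orth = λ {x} {y} Dx Cy → trans (∙-comm x y) (orth Cy Dx)
    ; vanC = vanD ; vanD = vanC ; alt = alt′ }
    where
    open DualPair P
    alt′ : _
    alt′ S j Sj with alt (not ∘ (S ∪₁ j)) j (cong not (∪₁-new S j))
    ... | inj₁ (x , Cx , x-zero , xj) = inj₂ (x , Cx , (λ i Si i≢j → x-zero i (cong not (∪₁-false S Si i≢j))) , xj)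
    ... | inj₂ (y , Dy , y-zero , yj) = inj₁ (y , Dy , (λ i Si → y-zero i (cong not (∪₁-old S Si)) (λ { refl → true≢false Si Sj })) , yj)

  -- Fewer than `k` columns would lie in a common hyperplane.
  length≥dimension : ∀ {k n} (g : GenMat F k n) → NonDegenerate F g → k ≤ n
  length≥dimension {k} {n} g (_ , spanning) with <-≤-connex n k
  ... | inj₂ k≤n = k≤n
  ... | inj₁ n<k with a , a≢0 , a∙g ← kernel k g n<k with i , ne ← spanning a a≢0 = ⊥-elim (ne (a∙g i))

  orthogonal-to-rows⇒dual : ∀ {k n} (g : GenMat F k n) x → (∀ l → x ∙ (λ i → g i l) ≡ 0#) → Dual F (CodeOf F g) x
  orthogonal-to-rows⇒dual g x x∙row c (a , c≡) = begin
    x ∙ c                                        ≡⟨ ∑-cong (λ i → cong (x i *_) (c≡ i)) ⟩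
    ∑F (λ i → x i * (a ∙ g i))                   ≡⟨ ∑-cong (λ i → sym (∑-*ˡ (x i) (λ l → a l * g i l))) ⟩
    ∑F (λ i → ∑F (λ l → x i * (a l * g i l)))    ≡⟨ ∑-swap (λ i l → x i * (a l * g i l)) ⟩
    ∑F (λ l → ∑F (λ i → x i * (a l * g i l)))    ≡⟨ ∑-zero (λ l → trans (∑-cong (λ i → solve 3 (λ x a g → x :* (a :* g) := a :* (x :* g)) refl (x i) (a l) (g i l)))
                                                      (trans (∑-*ˡ (a l) (λ i → x i * g i l)) (trans (cong (a l *_) (x∙row l)) (zeroʳ (a l))))) ⟩
    0#                                           ∎
    where open ≡-Reasoning

  codePair : ∀ {k n} (g : GenMat F k n) → NonDegenerate F g → DualPair (CodeOf F g) (Dual F (CodeOf F g)) k (n ∸ k)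
  codePair {k} {n} g nd@(_ , spanning) = record
    { dims  = m+[n∸m]≡n k≤n
    ; respC = λ { x≗y (a , e) → a , λ i → trans (sym (x≗y i)) (e i) }
    ; respD = λ {x} {y} x≗y Dx c Cc → trans (∑-cong (λ i → cong (_* c i) (sym (x≗y i)))) (Dx c Cc)
    ; combC = λ { (a , e) (a′ , e′) l l′ → (λ i → l * a i + l′ * a′ i) ,
                  λ i → trans (cong₂ (λ s t → l * s + l′ * t) (e i) (e′ i)) (sym (∙-linearˡ l l′ a a′ (g i))) }
    ; combD = λ {x} {y} Dx Dy l l′ c Cc → trans (∙-linearˡ l l′ x y c)
        (trans (cong₂ (λ s t → l * s + l′ * t) (Dx c Cc) (Dy c Cc)) (trans (cong₂ _+_ (zeroʳ l) (zeroʳ l′)) (+-identityˡ 0#)))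
    ; orth  = λ {x} {y} Cx Dy → trans (∙-comm x y) (Dy x Cx)
    ; vanC  = van-code
    ; vanD  = van-dual
    ; alt   = alternative }
    where
    k≤n = length≥dimension g nd

    van-code : ∀ S → size S < k → ∃ λ x → CodeOf F g x × NonZeroVec F x × (∀ i → S i ≡ true → x i ≡ 0#)
    van-code S S<k with enumerate S (size S) refl
    ... | E with kernel k (g ∘ Enumeration.at E) S<k
    ...   | a , a≢0 , a∙ = codeword F g a , (a , λ _ → refl) , index-nonZero (proj₂ (spanning a a≢0)) ,
            λ i Si → let j , e = Enumeration.index E Si in subst (λ i → a ∙ g i ≡ 0#) e (a∙ j)

    -- Orthogonality to the `k` rows and to the unit vectors at the positions in `S` amounts to
    -- fewer than `n` linear conditions.
    van-dual : ∀ S → size S < n ∸ k → ∃ λ x → Dual F (CodeOf F g) x × NonZeroVec F x × (∀ i → S i ≡ true → x i ≡ 0#)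
    van-dual S S<n-k with enumerate S (size S) refl
    ... | E with kernel n (λ e → [ (λ l i → g i l) , (λ j → unit (at j)) ]′ (splitAt k e))
                   (<-≤-trans (+-monoʳ-< k S<n-k) (≤-reflexive (m+[n∸m]≡n k≤n)))
      where open Enumeration E
    ...   | x , x≢0 , x∙ = x , orthogonal-to-rows⇒dual g x row , x≢0 , vanish
      where
      open Enumeration E
      row : ∀ l → x ∙ (λ i → g i l) ≡ 0#
      row l = subst (λ s → x ∙ [ (λ l i → g i l) , (λ j → unit (at j)) ]′ s ≡ 0#) (splitAt-↑ˡ k l (size S)) (x∙ (l ↑ˡ size S))
      vanish : ∀ i → S i ≡ true → x i ≡ 0#
      vanish i Si with j , refl ← index Si = trans (sym (∙-unit x (at j)))
        (subst (λ s → x ∙ [ (λ l i → g i l) , (λ j → unit (at j)) ]′ s ≡ 0#) (splitAt-↑ʳ k (size S) j) (x∙ (k ↑ʳ j)))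

    -- If column `j` is outside the span of the columns in `S`, a separating functional gives the
    -- word of the code; otherwise the linear dependency is a dual word. The factor `χ` erases the
    -- columns outside `S` without changing the index set.
    alternative : ∀ (S : Sub n) j → S j ≡ false →
              (∃ λ x → CodeOf F g x × (∀ i → S i ≡ true → x i ≡ 0#) × ¬ x j ≡ 0#) ⊎
              (∃ λ y → Dual F (CodeOf F g) y × (∀ i → S i ≡ false → ¬ i ≡ j → y i ≡ 0#) × ¬ y j ≡ 0#)
    alternative S j Sj with fredholm k (λ i l → χ i * g i l) (g j)
      where
      χ : Fin n → Carrier
      χ i = if S i then 1# else 0#
    ... | inj₂ (a , a∙ , a∙gj) = inj₁ (codeword F g a , (a , λ _ → refl) ,
        (λ i Si → trans (∑-cong (λ l → cong (a l *_) (trans (sym (*-identityˡ (g i l))) (cong (λ b → (if b then 1# else 0#) * g i l) (sym Si))))) (a∙ i)) , a∙gj)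
    ... | inj₁ (x , e) = inj₂ (y , orthogonal-to-rows⇒dual g y y∙row , (λ i Si i≢j → trans (y-off i i≢j) (trans (cong (λ b → x i * (if b then 1# else 0#)) Si) (zeroʳ (x i))))
                              , λ yj≡0 → -‿≢0 1≢0 (trans (sym yj) yj≡0))
      where
      open ≡-Reasoning
      χ : Fin n → Carrier
      χ i = if S i then 1# else 0#
      y : Vect F n
      y i = 1# * (x i * χ i) + - 1# * unit j i
      y-off : ∀ i → ¬ i ≡ j → y i ≡ x i * χ i
      y-off i i≢j = trans (cong₂ _+_ (*-identityˡ _) (trans (cong (- 1# *_) (unit-off i≢j)) (zeroʳ _))) (+-identityʳ _)
      yj : y j ≡ - 1#
      yj = trans (cong₂ _+_ (trans (*-identityˡ _) (trans (cong (λ b → x j * (if b then 1# else 0#)) Sj) (zeroʳ (x j))))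
                            (trans (cong (- 1# *_) (unit-diag j)) (*-identityʳ _))) (+-identityˡ _)
      y∙row : ∀ l → y ∙ (λ i → g i l) ≡ 0#
      y∙row l = begin
        y ∙ (λ i → g i l)                                                       ≡⟨ ∙-linearˡ 1# (- 1#) (λ i → x i * χ i) (unit j) (λ i → g i l) ⟩
        1# * ((λ i → x i * χ i) ∙ (λ i → g i l)) + - 1# * (unit j ∙ (λ i → g i l))
          ≡⟨ cong₂ (λ s t → 1# * s + - 1# * t) (trans (∑-cong (λ i → *-assoc (x i) (χ i) (g i l))) (sym (e l)))
               (trans (∙-comm (unit j) (λ i → g i l)) (∙-unit (λ i → g i l) j)) ⟩
        1# * g j l + - 1# * g j l                                               ≡⟨ solve 2 (λ o z → o :* z :+ :- o :* z := :- z :+ z) refl 1# (g j l) ⟩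
        - g j l + g j l                                                         ≡⟨ -‿inverseˡ _ ⟩
        0#                                                                      ∎

-- Length bounds from pencils, and MDS codes on zero sets.

module CodeBounds {q : ℕ} (F : FiniteField q) where
  open FieldArithmetic F
  open FiniteSubsets
  open LinearAlgebra F
  open DualPairs F

  module Bounds {n K K′ : ℕ} {C D : Code F n} (P : DualPair C D K K′) where
    open DualPair P

    ZerosAtMost : ℕ → Set
    ZerosAtMost M = ∀ x → C x → NonZeroVec F x → size (zeros x) ≤ M

    DualWeightAtLeast : ℕ → Set
    DualWeightAtLeast m = ∀ y → D y → NonZeroVec F y → m ≤ wt F y

    -- In `pencil-sum` the common zeros count q + 1 times, and each of the q words other than `b`
    -- has at most `M` zeros. The position `j` certifies that `a` and `b` are independent, so that
    -- none of these words is zero.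
    pencil-bound : ∀ {M} → ZerosAtMost M → ∀ {a b j} → C a → C b → NonZeroVec F a → a j ≡ 0# → ¬ b j ≡ 0# →
      (S : Sub n) → (∀ i → S i ≡ true → a i ≡ 0# × b i ≡ 0#) → n ℕ.+ q ℕ.* size S ≤ size (zeros b) ℕ.+ q ℕ.* M
    pencil-bound {M} zeros≤M {a} {b} {j} Ca Cb a≢0 aj≡0 bj≢0 S common = begin
      n ℕ.+ q ℕ.* size S
        ≤⟨ +-monoʳ-≤ n (*-monoʳ-≤ q (size-mono {S = S} (λ i Si → ∧-true (is0-true (proj₁ (common i Si))) (is0-true (proj₂ (common i Si)))))) ⟩
      n ℕ.+ q ℕ.* size (λ i → is0 (a i) ∧ is0 (b i))
        ≡⟨ sym (pencil-sum a b) ⟩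
      size (zeros b) ℕ.+ sum (λ l → size (λ i → is0 (a i + elt l * b i)))
        ≤⟨ +-monoʳ-≤ (size (zeros b)) (sum-≤-const M (λ l → zeros≤M _ (member l) (nonzero l))) ⟩
      size (zeros b) ℕ.+ q ℕ.* M ∎
      where
      open ℕₚ.≤-Reasoning
      member : ∀ l → C (λ i → a i + elt l * b i)
      member l = respC (λ i → cong (_+ elt l * b i) (*-identityˡ (a i))) (combC Ca Cb 1# (elt l))
      nonzero : ∀ l → NonZeroVec F (λ i → a i + elt l * b i)
      nonzero l z = a≢0 (λ i → trans (sym (trans (cong (a i +_) (trans (cong (_* b i) l≡0) (zeroˡ (b i)))) (+-identityʳ (a i)))) (z i))
        where
        l≡0 : elt l ≡ 0#
        l≡0 = *-zeroˡ-cancel bj≢0 (trans (*-comm (b j) (elt l)) (trans (sym (trans (cong (_+ elt l * b j) aj≡0) (+-identityˡ _))) (z j)))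

    -- A second word with the prescribed zeros, independent of b because it vanishes where b does not.
    second-word : ∀ {b : Vect F n} {j} (S : Sub n) → ¬ b j ≡ 0# → (∀ i → S i ≡ true → b i ≡ 0#) → suc (size S) < K →
      ∃ λ a → C a × NonZeroVec F a × a j ≡ 0# × (∀ i → S i ≡ true → a i ≡ 0#)
    second-word {b} {j} S bj≢0 b-zero S<K
      with a , Ca , a≢0 , a-zero ← vanC (S ∪₁ j) (subst (_< K) (sym (size-∪₁ S (≢true⇒false (λ Sj → bj≢0 (b-zero j Sj))))) S<K) =
      a , Ca , a≢0 , a-zero j (∪₁-new S j) , λ i Si → a-zero i (∪₁-old S Si)

    -- The second word is prescribed `r` of the zeros of `b` and one zero where `b` does not vanish,
    -- which the condition `suc r < K` permits.
    length-bound : ∀ {M r} → ZerosAtMost M → suc r < K → ∀ {b} → C b → NonZeroVec F b → r ≤ size (zeros b) →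
      n ℕ.+ q ℕ.* r ≤ size (zeros b) ℕ.+ q ℕ.* M
    length-bound {M} {r} zeros≤M r<K {b} Cb b≢0 r≤
      with S , S⊆ , refl ← subset-of-size (zeros b) r r≤
      with j , bj ← nonZero-index b≢0
      with a , Ca , a≢0 , aj , a-zero ← second-word {b} S bj (λ i Si → true⇒0 (S⊆ i Si)) r<K =
      pencil-bound zeros≤M Ca Cb a≢0 aj bj S (λ i Si → a-zero i Si , true⇒0 (S⊆ i Si))

    -- The `r` prescribed positions contain the support of `x` except for `i₀`, where the zero then
    -- comes for free: the words share r + 1 zeros.
    length-bound⁺ : ∀ {M r} → ZerosAtMost M → suc r < K → ∀ {x} → D x → NonZeroVec F x → wt F x ≤ suc r →
      n ℕ.+ q ℕ.* suc r ≤ M ℕ.+ q ℕ.* M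
    length-bound⁺ {M} {r} zeros≤M r<K {x} Dx x≢0 wt≤
      with i₀ , xi₀ ← nonZero-index x≢0
      with S , P₀⊆S , S⊆R , refl ← intermediate (not ∘ zeros x ∖ i₀) ((λ _ → true) ∖ i₀)
             (λ i h → ∖-true (λ _ → true) refl (∖⇒≢ (not ∘ zeros x) h)) r
             (≤-pred (≤-trans (≤-reflexive (trans (sym (size-∖ (not ∘ zeros x) {i₀} (cong not (is0-false xi₀)))) (sym (wt≡size x)))) wt≤))
             (≤-pred (≤-trans (<⇒≤ r<K) (≤-trans (m≤m+n K K′) (≤-reflexive
               (trans dims (trans (sym (trans (sum-const n 1) (ℕₚ.*-identityʳ n))) (size-∖ {n} (λ _ → true) {i₀} refl)))))))
      with b , Cb , b≢0 , b-zero ← vanC S (<-trans (n<1+n (size S)) r<K)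
      with j , bj ← nonZero-index b≢0
      with a , Ca , a≢0 , aj , a-zero ← second-word {b} S bj b-zero r<K =
      ≤-trans (subst (λ m → n ℕ.+ q ℕ.* m ≤ size (zeros b) ℕ.+ q ℕ.* M) (size-∪₁ S S-i₀)
        (pencil-bound zeros≤M Ca Cb a≢0 aj bj (S ∪₁ i₀) common)) (+-monoˡ-≤ (q ℕ.* M) (zeros≤M b Cb b≢0))
      where
      S-i₀ : S i₀ ≡ false
      S-i₀ = ≢true⇒false (λ h → ∖⇒≢ {n} (λ _ → true) {i₀} {i₀} (S⊆R i₀ h) refl)
      -- orthogonality to x propagates the zeros from supp x ∖ i₀ to i₀
      at-i₀ : ∀ {c} → C c → (∀ i → S i ≡ true → c i ≡ 0#) → c i₀ ≡ 0#
      at-i₀ {c} Cc c-zero = *-zeroˡ-cancel xi₀ (trans (*-comm _ _) (trans (sym (∙-single i₀ terms)) (orth Cc Dx)))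
        where
        terms : ∀ i → ¬ i ≡ i₀ → c i ≡ 0# ⊎ x i ≡ 0#
        terms i i≢ with x i ≟ 0#
        ... | yes xi = inj₂ xi
        ... | no xi  = inj₁ (c-zero i (P₀⊆S i (∖-true (not ∘ zeros x) (cong not (is0-false xi)) i≢)))
      common : ∀ i → (S ∪₁ i₀) i ≡ true → a i ≡ 0# × b i ≡ 0#
      common i h with ∪₁-cases S h
      ... | inj₁ Si   = a-zero i Si , b-zero i Si
      ... | inj₂ refl = at-i₀ Ca a-zero , at-i₀ Cb b-zero

    module Independent (dual≥K : DualWeightAtLeast K) where

      -- The other alternative would be a word of `D` supported on at most K - 1 positions.
      coordinate-word : ∀ (S : Sub n) j → S j ≡ false → size S < K ∸ 1 → ∃ λ x → C x × (∀ i → S i ≡ true → x i ≡ 0#) × ¬ x j ≡ 0#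
      coordinate-word S j Sj S<K with alt S j Sj
      ... | inj₁ found = found
      ... | inj₂ (y , Dy , y-zero , yj) = ⊥-elim (<-irrefl refl (begin-strict
        K                 ≤⟨ dual≥K y Dy (index-nonZero yj) ⟩
        wt F y            ≤⟨ wt-≤-support y (S ∪₁ j) supported ⟩
        size (S ∪₁ j)     ≡⟨ size-∪₁ S Sj ⟩
        suc (size S)      ≤⟨ S<K ⟩
        K ∸ 1             <⟨ ∸-monoʳ-< {K} (s≤s z≤n) (≤-trans (≤-trans (s≤s z≤n) S<K) (m∸n≤m K 1)) ⟩
        K                 ∎))
        where
        open ℕₚ.≤-Reasoning
        supported : ∀ i → (S ∪₁ j) i ≡ false → y i ≡ 0#
        supported i h with S i in Si | i ≟ᶠ j
        ... | false | no i≢j = y-zero i Si i≢j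

      -- The words vanishing on K − 1 positions form a line: two independent ones would, together with a
      -- word of D supported on two further positions, produce a word of D of weight below K.
      vanishing-unique : ∀ (S : Sub n) → suc (size S) ≡ K → ∀ {b w j} → C b → C w →
        (∀ i → S i ≡ true → b i ≡ 0#) → (∀ i → S i ≡ true → w i ≡ 0#) → ¬ b j ≡ 0# → w j ≡ 0# → ∀ i → w i ≡ 0#
      vanishing-unique S S≡K {b} {w} {j} Cb Cw b-zero w-zero bj wj i = decidable-stable (w i ≟ 0#) absurd
        where
        absurd : ¬ ¬ w i ≡ 0#
        absurd wi = contradiction-from (vanD (not ∘ S₂) complement<K′)
          where
          open ℕₚ.≤-Reasoning
          Si = ≢true⇒false (λ h → wi (w-zero i h))
          Sj = ≢true⇒false (λ h → bj (b-zero j h))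
          i≢j : ¬ i ≡ j
          i≢j refl = wi wj
          -- This set has K + 1 elements, so its complement has K′ - 1, just few enough for `vanD`.
          S₂ = S ∪₁ i ∪₁ j
          sizeS₂ : size S₂ ≡ suc K
          sizeS₂ = trans (size-∪₁ (S ∪₁ i) (∪₁-false S Sj (i≢j ∘ sym))) (cong suc (trans (size-∪₁ S Si) S≡K))
          complement<K′ : size (not ∘ S₂) < K′
          complement<K′ = +-cancelˡ-≤ K _ _ (≤-reflexive (trans (+-suc K _)
            (trans (cong (ℕ._+ size (not ∘ S₂)) (sym sizeS₂)) (trans (size-complement S₂) (sym dims)))))
          contradiction-from : (∃ λ x → D x × NonZeroVec F x × (∀ l → not (S₂ l) ≡ true → x l ≡ 0#)) → ⊥
          contradiction-from (x , Dx , x≢0 , x-zero) = <-irrefl refl (begin-strict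
            K         ≤⟨ dual≥K x Dx x≢0 ⟩
            wt F x    ≤⟨ wt-≤-support x S supported ⟩
            size S    <⟨ ≤-reflexive S≡K ⟩
            K         ∎)
            where
            outside : ∀ l → S l ≡ false → ¬ l ≡ i → ¬ l ≡ j → x l ≡ 0#
            outside l Sl l≢i l≢j = x-zero l (cong not (∪₁-false (S ∪₁ i) (∪₁-false S Sl l≢i) l≢j))
            -- Since `w` vanishes at `j`, orthogonality to `w` isolates position `i`. Only with
            -- `x i` known to be zero does orthogonality to `b`, which may be nonzero at both
            -- positions, isolate `j`.
            xi : x i ≡ 0#
            xi = *-zeroˡ-cancel wi (trans (sym (∙-single i terms)) (orth Cw Dx))
              where
              terms : ∀ l → ¬ l ≡ i → w l ≡ 0# ⊎ x l ≡ 0#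
              terms l l≢i with S l in Sl | l ≟ᶠ j
              ... | true  | _        = inj₁ (w-zero l Sl)
              ... | false | yes refl = inj₁ wj
              ... | false | no l≢j   = inj₂ (outside l Sl l≢i l≢j)
            xj : x j ≡ 0#
            xj = *-zeroˡ-cancel bj (trans (sym (∙-single j terms)) (orth Cb Dx))
              where
              terms : ∀ l → ¬ l ≡ j → b l ≡ 0# ⊎ x l ≡ 0#
              terms l l≢j with S l in Sl | l ≟ᶠ i
              ... | true  | _        = inj₁ (b-zero l Sl)
              ... | false | yes refl = inj₂ xi
              ... | false | no l≢i   = inj₂ (outside l Sl l≢i l≢j)
            supported : ∀ l → S l ≡ false → x l ≡ 0#
            supported l Sl with l ≟ᶠ i | l ≟ᶠ j
            ... | yes refl | _        = xi
            ... | no _     | yes refl = xj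
            ... | no l≢i   | no l≢j   = outside l Sl l≢i l≢j

      vanishing-multiple : ∀ (S : Sub n) → suc (size S) ≡ K → ∀ {b w j} → C b → C w →
        (∀ i → S i ≡ true → b i ≡ 0#) → (∀ i → S i ≡ true → w i ≡ 0#) → ¬ b j ≡ 0# → ∀ i → w i ≡ w j * b j ⁻¹ * b i
      vanishing-multiple S S≡K {b} {w} {j} Cb Cw b-zero w-zero bj i = x-y≡0⇒x≡y (trans
          (solve 3 (λ w μ b → w :+ :- (μ :* b) := w :+ :- μ :* b) refl (w i) μ (b i))
          (trans (cong (_+ - μ * b i) (sym (*-identityˡ (w i)))) (vanishing-unique S S≡K Cb (combC Cw Cb 1# (- μ)) b-zero zero-on-S bj zero-at-j i)))
        where
        open ≡-Reasoning
        μ = w j * b j ⁻¹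
        zero-on-S : ∀ l → S l ≡ true → 1# * w l + - μ * b l ≡ 0#
        zero-on-S l Sl = trans (cong₂ (λ s t → 1# * s + - μ * t) (w-zero l Sl) (b-zero l Sl)) (trans (cong₂ _+_ (zeroʳ 1#) (zeroʳ (- μ))) (+-identityˡ 0#))
        zero-at-j : 1# * w j + - μ * b j ≡ 0#
        zero-at-j = begin
          1# * w j + - (w j * b j ⁻¹) * b j    ≡⟨ solve 4 (λ o w b b′ → o :* w :+ :- (w :* b′) :* b := w :* o :+ :- (w :* (b :* b′))) refl 1# (w j) (b j) (b j ⁻¹) ⟩
          w j * 1# + - (w j * (b j * b j ⁻¹))  ≡⟨ cong (λ u → w j * 1# + - (w j * u)) (*-inverseʳ bj) ⟩
          w j * 1# + - (w j * 1#)              ≡⟨ -‿inverseʳ _ ⟩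
          0#                                   ∎

      -- With K - 1 common zeros, `w` would be a multiple of `b` and vanish at `l` together with it.
      few-common-zeros : ∀ {r} → suc r ≡ K → ∀ {b w l} → C b → C w → NonZeroVec F b → b l ≡ 0# → ¬ w l ≡ 0# →
        size (λ i → zeros b i ∧ zeros w i) < r
      few-common-zeros {r} r≡K {b} {w} {l} Cb Cw b≢0 bl wl with <-≤-connex (size (λ i → zeros b i ∧ zeros w i)) r
      ... | inj₁ lt = lt
      ... | inj₂ r≤
        with j , bj ← nonZero-index b≢0
        with S , S⊆ , refl ← subset-of-size (λ i → zeros b i ∧ zeros w i) r r≤ =
        ⊥-elim (wl (trans
          (vanishing-multiple S r≡K Cb Cw (λ i Si → true⇒0 (∧-trueˡ {is0 (b i)} (S⊆ i Si))) (λ i Si → true⇒0 (∧-trueʳ {is0 (b i)} (S⊆ i Si))) bj l)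
          (trans (cong (w j * b j ⁻¹ *_) bl) (zeroʳ _))))

      combination∈C : ∀ {m} {x₀} → C x₀ → (a : Vect F m) (u : Fin m → Vect F n) → (∀ j → C (u j)) → C (λ i → ∑F (λ j → a j * u j i))
      -- The closure field `combC` yields the zero word only from a given word, hence the argument
      -- `x₀`.
      combination∈C {zero} {x₀} Cx₀ a u Cu = respC (λ i → trans (cong₂ _+_ (zeroˡ (x₀ i)) (zeroˡ (x₀ i))) (+-identityˡ 0#)) (combC Cx₀ Cx₀ 0# 0#)
      combination∈C {suc m} Cx₀ a u Cu = respC (λ i → cong (a zero * u zero i +_) (*-identityˡ _))
        (combC (Cu zero) (combination∈C Cx₀ (a ∘ suc) (u ∘ suc) (Cu ∘ suc)) (a zero) 1#)

      -- The rows are words of `C` read on the zeros of `b`, diagonal on K - 1 of these zeros, the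
      -- set `J`. A combination with a nonzero coefficient is therefore nonzero at some zero of `b`,
      -- and `few-common-zeros` leaves it at most K - 2 zeros there, as the MDS property demands.
      mds-on-zeros : ∀ {r} → suc (suc r) ≡ K → ∀ {b} → C b → NonZeroVec F b → suc r ≤ size (zeros b) →
        MDSLengthAtLeast F (suc r) (size (zeros b))
      mds-on-zeros {r} r≡K {b} Cb b≢0 r≤N
        with J , J⊆ , sizeJ ← subset-of-size (zeros b) (suc r) r≤N
        with d , d≡ ← m≤n⇒∃[o]m+o≡n r≤N =
        N , ≤-refl , g , suc d , ((column≢0 , spanning) , (minimal-word , minimal)) , cong suc (trans (ℕₚ.+-comm d (suc r)) d≡)
        where
        N = size (zeros b)
        open Enumeration (enumerate (zeros b) N refl)
        open Enumeration (enumerate J (suc r) sizeJ) using () renaming (at to atJ; at-true to atJ-true; at-inj to atJ-inj; index to indexJ)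

        size-J∖ : ∀ j → size (J ∖ atJ j) ≡ r
        size-J∖ j = cong ℕ.pred (trans (sym (size-∖ J (atJ-true j))) sizeJ)

        row : ∀ j → ∃ λ x → C x × (∀ i → (J ∖ atJ j) i ≡ true → x i ≡ 0#) × ¬ x (atJ j) ≡ 0#
        row j = coordinate-word (J ∖ atJ j) (atJ j) (∖-self J (atJ j)) (subst (λ m → suc (size (J ∖ atJ j)) ≤ m ∸ 1) r≡K (s≤s (≤-reflexive (size-J∖ j))))

        u : Fin (suc r) → Vect F n
        u j = proj₁ (row j)
        Cu : ∀ j → C (u j)
        Cu j = proj₁ (proj₂ (row j))
        u-off : ∀ j i → J i ≡ true → ¬ i ≡ atJ j → u j i ≡ 0#
        u-off j i Ji i≢ = proj₁ (proj₂ (proj₂ (row j))) i (∖-true J Ji i≢)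
        u-diag : ∀ j → ¬ u j (atJ j) ≡ 0#
        u-diag j = proj₂ (proj₂ (proj₂ (row j)))

        g : GenMat F (suc r) N
        g i j = u j (at i)

        word : Vect F (suc r) → Vect F n
        word a i = ∑F (λ j → a j * u j i)
        Cword : ∀ a → C (word a)
        Cword a = combination∈C Cb a u Cu

        word-at : ∀ a j → word a (atJ j) ≡ a j * u j (atJ j)
        word-at a j = ∑-single _ j (λ l l≢j → trans (cong (a l *_) (u-off l (atJ j) (atJ-true j) (λ e → l≢j (sym (atJ-inj e))))) (zeroʳ (a l)))

        b-atJ : ∀ j → b (atJ j) ≡ 0#
        b-atJ j = true⇒0 (J⊆ _ (atJ-true j))

        zeros-codeword : ∀ a → size (zeros (codeword F g a)) ≡ size (λ i → zeros b i ∧ zeros (word a) i)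
        zeros-codeword a = size-at (zeros (word a))

        few-zeros : ∀ a {j} → ¬ a j ≡ 0# → size (zeros (codeword F g a)) ≤ r
        few-zeros a {j} aj = ≤-pred (≤-trans (s≤s (≤-reflexive (zeros-codeword a)))
          (few-common-zeros r≡K Cb (Cword a) b≢0 (b-atJ j) (λ e → no-zero-divisors aj (u-diag j) (trans (sym (word-at a j)) e))))

        wt-identity : ∀ a {z} → size (zeros (codeword F g a)) ≡ z → z ℕ.+ wt F (codeword F g a) ≡ r ℕ.+ suc d
        wt-identity a refl = trans (zeros+wt (codeword F g a)) (trans (sym d≡) (sym (+-suc r d)))

        wt≥ : ∀ a {j} → ¬ a j ≡ 0# → suc d ≤ wt F (codeword F g a)
        wt≥ a aj = +-cancelˡ-≤ r _ _ (≤-trans (≤-reflexive (sym (wt-identity a refl))) (+-monoˡ-≤ _ (few-zeros a aj)))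

        column≢0 : ∀ i → NonZeroVec F (g i)
        column≢0 i gi≡0 with J (at i) in Ji
        ... | true with j , e ← indexJ Ji = u-diag j (trans (cong (u j) e) (gi≡0 j))
        -- A zero column outside `J` would be a common zero of `b` and the first row in addition to
        -- the `r` common zeros in `J`.
        ... | false = <-irrefl refl (begin-strict
          suc r                                       ≡⟨ sym (cong suc (size-J∖ zero)) ⟩
          suc (size (J ∖ atJ zero))                   ≡⟨ sym (size-∪₁ (J ∖ atJ zero) (≢true⇒false (λ h → true≢false (∖⇒S J h) Ji))) ⟩
          size ((J ∖ atJ zero) ∪₁ at i)               ≤⟨ size-mono included ⟩
          size (λ l → zeros b l ∧ zeros (u zero) l)   <⟨ few-common-zeros r≡K Cb (Cu zero) b≢0 (b-atJ zero) (u-diag zero) ⟩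
          suc r                                       ∎)
          where
          open ℕₚ.≤-Reasoning
          included : ∀ l → ((J ∖ atJ zero) ∪₁ at i) l ≡ true → zeros b l ∧ zeros (u zero) l ≡ true
          included l h with ∪₁-cases (J ∖ atJ zero) h
          ... | inj₁ Jl   = ∧-true (J⊆ l (∖⇒S J Jl)) (is0-true (u-off zero l (∖⇒S J Jl) (∖⇒≢ J Jl)))
          ... | inj₂ refl = ∧-true (at-true i) (is0-true (gi≡0 zero))

        spanning : ∀ a → NonZeroVec F a → ∃ λ i → ¬ a ∙ g i ≡ 0#
        spanning a a≢0 with j , aj ← nonZero-index a≢0 with i , e ← index (J⊆ _ (atJ-true j)) =
          i , λ h → no-zero-divisors aj (u-diag j) (trans (sym (word-at a j)) (trans (cong (word a) (sym e)) h))

        minimal-word : ∃ λ c → CodeOf F g c × NonZeroVec F c × wt F c ≡ suc d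
        minimal-word = codeword F g e₀ , (e₀ , λ _ → refl) , index-nonZero (proj₂ (spanning e₀ (index-nonZero {i = zero} e₀-zero))) ,
          +-cancelˡ-≡ r _ _ (wt-identity e₀ (≤-antisym (few-zeros e₀ {zero} e₀-zero) r≤zeros))
          where
          e₀ = unit {suc r} zero
          e₀-zero : ¬ e₀ zero ≡ 0#
          e₀-zero e = 1≢0 (trans (sym (unit-diag {suc r} zero)) e)
          word-e₀ : ∀ i → word e₀ i ≡ u zero i
          word-e₀ i = trans (∙-comm e₀ (λ j → u j i)) (∙-unit (λ j → u j i) zero)
          r≤zeros : r ≤ size (zeros (codeword F g e₀))
          r≤zeros = ≤-trans (≤-reflexive (sym (size-J∖ zero))) (≤-trans
            (size-mono {S = J ∖ atJ zero} (λ i Ji → ∧-true (J⊆ i (∖⇒S J Ji)) (is0-true (trans (word-e₀ i) (u-off zero i (∖⇒S J Ji) (∖⇒≢ J Ji))))))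
            (≤-reflexive (sym (zeros-codeword e₀))))

        minimal : ∀ c → CodeOf F g c → NonZeroVec F c → suc d ≤ wt F c
        minimal c (a , c≡) c≢0 with i , ci ← nonZero-index c≢0 with nonZero-index {x = a} a≢0
          where
          a≢0 : NonZeroVec F a
          a≢0 a≡0 = ci (trans (c≡ i) (∑-zero (λ j → trans (cong (_* g i j) (a≡0 j)) (zeroˡ _))))
        ... | j , aj = ≤-trans (wt≥ a aj) (≤-reflexive (wt-cong (λ i → sym (c≡ i))))

-- Vector algebra in three dimensions.

module Space {q : ℕ} (F : FiniteField q) where
  open FieldArithmetic F

  -- Nonzero vectors serve both as points and as lines of PG(2, q): `dot a x ≡ 0#` is incidence, and
  -- a vanishing `_×ᵛ_` is equality of points or of lines. Without eta and with abstract operations,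
  -- later terms stay in vector form instead of unfolding into coordinates.
  record V : Set where
    no-eta-equality
    pattern
    constructor vec
    field c₁ c₂ c₃ : Carrier
  open V public

  vec-cong : ∀ {x x′ y y′ z z′} → x ≡ x′ → y ≡ y′ → z ≡ z′ → vec x y z ≡ vec x′ y′ z′
  vec-cong refl refl refl = refl

  _≟ᵛ_ : (a b : V) → Dec (a ≡ b)
  vec x y z ≟ᵛ vec x′ y′ z′ with x ≟ x′ | y ≟ y′ | z ≟ z′
  ... | yes refl | yes refl | yes refl = yes refl
  ... | no ne    | _        | _        = no λ { refl → ne refl }
  ... | yes _    | no ne    | _        = no λ { refl → ne refl }
  ... | yes _    | yes _    | no ne    = no λ { refl → ne refl }

  𝟎 : V
  𝟎 = vec 0# 0# 0#

  infixr 8 _·_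
  infixl 7 _×ᵛ_
  infixl 6 _⊕_
  infixr 8 ⊖_

  abstract
    _·_ : Carrier → V → V
    l · vec x y z = vec (l * x) (l * y) (l * z)

    _⊕_ : V → V → V
    vec x y z ⊕ vec x′ y′ z′ = vec (x + x′) (y + y′) (z + z′)

    ⊖_ : V → V
    ⊖ vec x y z = vec (- x) (- y) (- z)

    _×ᵛ_ : V → V → V
    vec x y z ×ᵛ vec x′ y′ z′ = vec (y * z′ + - (z * y′)) (z * x′ + - (x * z′)) (x * y′ + - (y * x′))

    dot : V → V → Carrier
    dot (vec x y z) (vec x′ y′ z′) = x * x′ + y * y′ + z * z′

  det : V → V → V → Carrier
  det a b c = dot (a ×ᵛ b) c

  private
    -- Vectors of solver polynomials, so that identities can be stated to the solver in vector form.
    record VP (n : ℕ) : Set where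
      constructor vecP
      field d₁ d₂ d₃ : Polynomial n
    open VP

    infixr 9 _·P_
    infixl 8 _×P_
    infixl 7 _⊕P_

    _·P_ : ∀ {n} → Polynomial n → VP n → VP n
    l ·P a = vecP (l :* d₁ a) (l :* d₂ a) (l :* d₃ a)
    _⊕P_ : ∀ {n} → VP n → VP n → VP n
    a ⊕P b = vecP (d₁ a :+ d₁ b) (d₂ a :+ d₂ b) (d₃ a :+ d₃ b)
    ⊖P : ∀ {n} → VP n → VP n
    ⊖P a = vecP (:- d₁ a) (:- d₂ a) (:- d₃ a)
    _×P_ : ∀ {n} → VP n → VP n → VP n
    a ×P b = vecP (d₂ a :* d₃ b :+ :- (d₃ a :* d₂ b)) (d₃ a :* d₁ b :+ :- (d₁ a :* d₃ b)) (d₁ a :* d₂ b :+ :- (d₂ a :* d₁ b))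
    dotP : ∀ {n} → VP n → VP n → Polynomial n
    dotP a b = d₁ a :* d₁ b :+ d₂ a :* d₂ b :+ d₃ a :* d₃ b
    detP : ∀ {n} → VP n → VP n → VP n → Polynomial n
    detP a b c = dotP (a ×P b) c
    0P : ∀ {n} → Polynomial n
    0P = con (ℤ.+ 0)

  abstract
    dot-vec : ∀ x y z x′ y′ z′ → dot (vec x y z) (vec x′ y′ z′) ≡ x * x′ + y * y′ + z * z′
    dot-vec x y z x′ y′ z′ = refl

    dot-comm : ∀ a b → dot a b ≡ dot b a
    dot-comm (vec a₁ a₂ a₃) (vec b₁ b₂ b₃) = solve 6 (λ a₁ a₂ a₃ b₁ b₂ b₃ →
      dotP (vecP a₁ a₂ a₃) (vecP b₁ b₂ b₃) := dotP (vecP b₁ b₂ b₃) (vecP a₁ a₂ a₃)) refl a₁ a₂ a₃ b₁ b₂ b₃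

    dot-⊕ʳ : ∀ a b c → dot a (b ⊕ c) ≡ dot a b + dot a c
    dot-⊕ʳ (vec a₁ a₂ a₃) (vec b₁ b₂ b₃) (vec e₁ e₂ e₃) = solve 9 (λ a₁ a₂ a₃ b₁ b₂ b₃ e₁ e₂ e₃ →
      let a = vecP a₁ a₂ a₃; b = vecP b₁ b₂ b₃; c = vecP e₁ e₂ e₃ in
      dotP a (b ⊕P c) := dotP a b :+ dotP a c) refl a₁ a₂ a₃ b₁ b₂ b₃ e₁ e₂ e₃

    dot-·ʳ : ∀ a l b → dot a (l · b) ≡ l * dot a b
    dot-·ʳ (vec a₁ a₂ a₃) l (vec b₁ b₂ b₃) = solve 7 (λ a₁ a₂ a₃ l b₁ b₂ b₃ →
      dotP (vecP a₁ a₂ a₃) (l ·P vecP b₁ b₂ b₃) := l :* dotP (vecP a₁ a₂ a₃) (vecP b₁ b₂ b₃)) refl a₁ a₂ a₃ l b₁ b₂ b₃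

    dot-⊖ʳ : ∀ a b → dot a (⊖ b) ≡ - dot a b
    dot-⊖ʳ (vec a₁ a₂ a₃) (vec b₁ b₂ b₃) = solve 6 (λ a₁ a₂ a₃ b₁ b₂ b₃ →
      dotP (vecP a₁ a₂ a₃) (⊖P (vecP b₁ b₂ b₃)) := :- dotP (vecP a₁ a₂ a₃) (vecP b₁ b₂ b₃)) refl a₁ a₂ a₃ b₁ b₂ b₃

    dot-⊕ˡ : ∀ a b c → dot (a ⊕ b) c ≡ dot a c + dot b c
    dot-⊕ˡ a b c = trans (dot-comm (a ⊕ b) c) (trans (dot-⊕ʳ c a b) (cong₂ _+_ (dot-comm c a) (dot-comm c b)))

    dot-·ˡ : ∀ l a b → dot (l · a) b ≡ l * dot a b
    dot-·ˡ l a b = trans (dot-comm (l · a) b) (trans (dot-·ʳ b l a) (cong (l *_) (dot-comm b a)))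

    dot-×ˡ : ∀ a b → dot a (a ×ᵛ b) ≡ 0#
    dot-×ˡ (vec a₁ a₂ a₃) (vec b₁ b₂ b₃) = solve 6 (λ a₁ a₂ a₃ b₁ b₂ b₃ →
      dotP (vecP a₁ a₂ a₃) (vecP a₁ a₂ a₃ ×P vecP b₁ b₂ b₃) := 0P) refl a₁ a₂ a₃ b₁ b₂ b₃

    dot-×ʳ : ∀ a b → dot b (a ×ᵛ b) ≡ 0#
    dot-×ʳ (vec a₁ a₂ a₃) (vec b₁ b₂ b₃) = solve 6 (λ a₁ a₂ a₃ b₁ b₂ b₃ →
      dotP (vecP b₁ b₂ b₃) (vecP a₁ a₂ a₃ ×P vecP b₁ b₂ b₃) := 0P) refl a₁ a₂ a₃ b₁ b₂ b₃

    det-cycle : ∀ a b c → det a b c ≡ det b c a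
    det-cycle (vec a₁ a₂ a₃) (vec b₁ b₂ b₃) (vec e₁ e₂ e₃) = solve 9 (λ a₁ a₂ a₃ b₁ b₂ b₃ e₁ e₂ e₃ →
      let a = vecP a₁ a₂ a₃; b = vecP b₁ b₂ b₃; c = vecP e₁ e₂ e₃ in
      detP a b c := detP b c a) refl a₁ a₂ a₃ b₁ b₂ b₃ e₁ e₂ e₃

    ×-⊖ : ∀ a b → a ×ᵛ b ≡ ⊖ (b ×ᵛ a)
    ×-⊖ (vec a₁ a₂ a₃) (vec b₁ b₂ b₃) = vec-cong (f a₂ a₃ b₂ b₃) (f a₃ a₁ b₃ b₁) (f a₁ a₂ b₁ b₂)
      where
      f : ∀ a b c d → a * d + - (b * c) ≡ - (c * b + - (d * a))
      f = solve 4 (λ a b c d → a :* d :+ :- (b :* c) := :- (c :* b :+ :- (d :* a))) refl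

    ⊖𝟎 : ⊖ 𝟎 ≡ 𝟎
    ⊖𝟎 = vec-cong -0#≈0# -0#≈0# -0#≈0#

    ·𝟎 : ∀ l → l · 𝟎 ≡ 𝟎
    ·𝟎 l = vec-cong (zeroʳ l) (zeroʳ l) (zeroʳ l)

    0· : ∀ a → 0# · a ≡ 𝟎
    0· (vec x y z) = vec-cong (zeroˡ x) (zeroˡ y) (zeroˡ z)

    1· : ∀ a → 1# · a ≡ a
    1· (vec x y z) = vec-cong (*-identityˡ x) (*-identityˡ y) (*-identityˡ z)

    ·-assoc : ∀ l m a → l · m · a ≡ (l * m) · a
    ·-assoc l m (vec x y z) = vec-cong (sym (*-assoc l m x)) (sym (*-assoc l m y)) (sym (*-assoc l m z))

    ·-⊕ : ∀ l a b → l · (a ⊕ b) ≡ l · a ⊕ l · b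
    ·-⊕ l (vec x y z) (vec x′ y′ z′) = vec-cong (distribˡ l x x′) (distribˡ l y y′) (distribˡ l z z′)

    ⊕𝟎 : ∀ a → a ⊕ 𝟎 ≡ a
    ⊕𝟎 (vec x y z) = vec-cong (+-identityʳ x) (+-identityʳ y) (+-identityʳ z)

    𝟎⊕ : ∀ a → 𝟎 ⊕ a ≡ a
    𝟎⊕ (vec x y z) = vec-cong (+-identityˡ x) (+-identityˡ y) (+-identityˡ z)

    ×-self : ∀ a → a ×ᵛ a ≡ 𝟎
    ×-self (vec x y z) = vec-cong (f y z) (f z x) (f x y)
      where
      f : ∀ a b → a * b + - (b * a) ≡ 0#
      f = solve 2 (λ a b → a :* b :+ :- (b :* a) := 0P) refl

    ×-𝟎ʳ : ∀ a → a ×ᵛ 𝟎 ≡ 𝟎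
    ×-𝟎ʳ (vec x y z) = vec-cong (f y z) (f z x) (f x y)
      where
      f : ∀ a b → a * 0# + - (b * 0#) ≡ 0#
      f = solve 2 (λ a b → a :* 0P :+ :- (b :* 0P) := 0P) refl

    ×-·ʳ : ∀ a l b → a ×ᵛ (l · b) ≡ l · (a ×ᵛ b)
    ×-·ʳ (vec a₁ a₂ a₃) l (vec b₁ b₂ b₃) = vec-cong (f a₂ b₃ a₃ b₂) (f a₃ b₁ a₁ b₃) (f a₁ b₂ a₂ b₁)
      where
      f : ∀ a b c d → a * (l * b) + - (c * (l * d)) ≡ l * (a * b + - (c * d))
      f = λ a b c d → solve 5 (λ l a b c d → a :* (l :* b) :+ :- (c :* (l :* d)) := l :* (a :* b :+ :- (c :* d))) refl l a b c d

    ×-⊕ʳ : ∀ a b c → a ×ᵛ (b ⊕ c) ≡ (a ×ᵛ b) ⊕ (a ×ᵛ c)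
    ×-⊕ʳ (vec a₁ a₂ a₃) (vec b₁ b₂ b₃) (vec e₁ e₂ e₃) = vec-cong (f a₂ b₃ e₃ a₃ b₂ e₂) (f a₃ b₁ e₁ a₁ b₃ e₃) (f a₁ b₂ e₂ a₂ b₁ e₁)
      where
      f : ∀ a b b′ c d d′ → a * (b + b′) + - (c * (d + d′)) ≡ a * b + - (c * d) + (a * b′ + - (c * d′))
      f = solve 6 (λ a b b′ c d d′ → a :* (b :+ b′) :+ :- (c :* (d :+ d′)) := a :* b :+ :- (c :* d) :+ (a :* b′ :+ :- (c :* d′))) refl

    ×-𝟎ˡ-sym : ∀ {a b} → a ×ᵛ b ≡ 𝟎 → b ×ᵛ a ≡ 𝟎
    ×-𝟎ˡ-sym {a} {b} e = trans (×-⊖ b a) (trans (cong ⊖_ e) ⊖𝟎)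

    triple-product : ∀ a b c → a ×ᵛ (b ×ᵛ c) ≡ dot a c · b ⊕ ⊖ (dot a b · c)
    triple-product (vec a₁ a₂ a₃) (vec b₁ b₂ b₃) (vec e₁ e₂ e₃) = vec-cong
      (solve 9 (λ a₁ a₂ a₃ b₁ b₂ b₃ e₁ e₂ e₃ → let a = vecP a₁ a₂ a₃; b = vecP b₁ b₂ b₃; c = vecP e₁ e₂ e₃ in
        d₁ (a ×P (b ×P c)) := d₁ (dotP a c ·P b ⊕P ⊖P (dotP a b ·P c))) refl a₁ a₂ a₃ b₁ b₂ b₃ e₁ e₂ e₃)
      (solve 9 (λ a₁ a₂ a₃ b₁ b₂ b₃ e₁ e₂ e₃ → let a = vecP a₁ a₂ a₃; b = vecP b₁ b₂ b₃; c = vecP e₁ e₂ e₃ in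
        d₂ (a ×P (b ×P c)) := d₂ (dotP a c ·P b ⊕P ⊖P (dotP a b ·P c))) refl a₁ a₂ a₃ b₁ b₂ b₃ e₁ e₂ e₃)
      (solve 9 (λ a₁ a₂ a₃ b₁ b₂ b₃ e₁ e₂ e₃ → let a = vecP a₁ a₂ a₃; b = vecP b₁ b₂ b₃; c = vecP e₁ e₂ e₃ in
        d₃ (a ×P (b ×P c)) := d₃ (dotP a c ·P b ⊕P ⊖P (dotP a b ·P c))) refl a₁ a₂ a₃ b₁ b₂ b₃ e₁ e₂ e₃)

    cramer : ∀ u v w e → det u v e · w ≡ det w v e · u ⊕ det u w e · v ⊕ det u v w · e
    cramer (vec u₁ u₂ u₃) (vec v₁ v₂ v₃) (vec w₁ w₂ w₃) (vec e₁ e₂ e₃) = vec-cong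
      (solve 12 (λ u₁ u₂ u₃ v₁ v₂ v₃ w₁ w₂ w₃ e₁ e₂ e₃ → let u = vecP u₁ u₂ u₃; v = vecP v₁ v₂ v₃; w = vecP w₁ w₂ w₃; e = vecP e₁ e₂ e₃ in
        d₁ (detP u v e ·P w) := d₁ (detP w v e ·P u ⊕P detP u w e ·P v ⊕P detP u v w ·P e)) refl u₁ u₂ u₃ v₁ v₂ v₃ w₁ w₂ w₃ e₁ e₂ e₃)
      (solve 12 (λ u₁ u₂ u₃ v₁ v₂ v₃ w₁ w₂ w₃ e₁ e₂ e₃ → let u = vecP u₁ u₂ u₃; v = vecP v₁ v₂ v₃; w = vecP w₁ w₂ w₃; e = vecP e₁ e₂ e₃ in
        d₂ (detP u v e ·P w) := d₂ (detP w v e ·P u ⊕P detP u w e ·P v ⊕P detP u v w ·P e)) refl u₁ u₂ u₃ v₁ v₂ v₃ w₁ w₂ w₃ e₁ e₂ e₃)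
      (solve 12 (λ u₁ u₂ u₃ v₁ v₂ v₃ w₁ w₂ w₃ e₁ e₂ e₃ → let u = vecP u₁ u₂ u₃; v = vecP v₁ v₂ v₃; w = vecP w₁ w₂ w₃; e = vecP e₁ e₂ e₃ in
        d₃ (detP u v e ·P w) := d₃ (detP w v e ·P u ⊕P detP u w e ·P v ⊕P detP u v w ·P e)) refl u₁ u₂ u₃ v₁ v₂ v₃ w₁ w₂ w₃ e₁ e₂ e₃)

    det-swap : ∀ a b c → det a c b ≡ - det a b c
    det-swap (vec a₁ a₂ a₃) (vec b₁ b₂ b₃) (vec e₁ e₂ e₃) = solve 9 (λ a₁ a₂ a₃ b₁ b₂ b₃ e₁ e₂ e₃ →
      let a = vecP a₁ a₂ a₃; b = vecP b₁ b₂ b₃; c = vecP e₁ e₂ e₃ in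
      detP a c b := :- detP a b c) refl a₁ a₂ a₃ b₁ b₂ b₃ e₁ e₂ e₃

    ×-⊖ʳ : ∀ a b → a ×ᵛ ⊖ b ≡ ⊖ (a ×ᵛ b)
    ×-⊖ʳ (vec a₁ a₂ a₃) (vec b₁ b₂ b₃) = vec-cong (f a₂ b₃ a₃ b₂) (f a₃ b₁ a₁ b₃) (f a₁ b₂ a₂ b₁)
      where
      f : ∀ a b c d → a * - b + - (c * - d) ≡ - (a * b + - (c * d))
      f = solve 4 (λ a b c d → a :* :- b :+ :- (c :* :- d) := :- (a :* b :+ :- (c :* d))) refl

    ⊕-comm : ∀ a b → a ⊕ b ≡ b ⊕ a
    ⊕-comm (vec a₁ a₂ a₃) (vec b₁ b₂ b₃) = vec-cong (+-comm a₁ b₁) (+-comm a₂ b₂) (+-comm a₃ b₃)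

    ⊖≡-1· : ∀ a → ⊖ a ≡ (- 1#) · a
    ⊖≡-1· (vec a₁ a₂ a₃) = vec-cong (f a₁) (f a₂) (f a₃)
      where
      f : ∀ x → - x ≡ - 1# * x
      f x = trans (cong -_ (sym (*-identityˡ x))) (-‿distribˡ-* 1# x)

    cancel-reflection : ∀ a v → a ⊕ ⊖ (a ⊕ v) ≡ ⊖ v
    cancel-reflection (vec a₁ a₂ a₃) (vec v₁ v₂ v₃) = vec-cong (f a₁ v₁) (f a₂ v₂) (f a₃ v₃)
      where
      f : ∀ a v → a + - (a + v) ≡ - v
      f = solve 2 (λ a v → a :+ :- (a :+ v) := :- v) refl

    two-reflections : ∀ u a v → ⊖ (u ⊕ ⊖ (a ⊕ v)) ≡ v ⊕ (a ⊕ ⊖ u)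
    two-reflections (vec u₁ u₂ u₃) (vec a₁ a₂ a₃) (vec v₁ v₂ v₃) = vec-cong (f u₁ a₁ v₁) (f u₂ a₂ v₂) (f u₃ a₃ v₃)
      where
      f : ∀ u a v → - (u + - (a + v)) ≡ v + (a + - u)
      f = solve 3 (λ u a v → :- (u :+ :- (a :+ v)) := v :+ (a :+ :- u)) refl

    translate-difference : ∀ v a w u → w ⊕ (a ⊕ ⊖ v) ≡ u → w ≡ v ⊕ (u ⊕ ⊖ a)
    translate-difference (vec v₁ v₂ v₃) (vec a₁ a₂ a₃) (vec w₁ w₂ w₃) _ refl = vec-cong (f v₁ a₁ w₁) (f v₂ a₂ w₂) (f v₃ a₃ w₃)
      where
      f : ∀ v a w → w ≡ v + (w + (a + - v) + - a)
      f = solve 3 (λ v a w → w := v :+ (w :+ (a :+ :- v) :+ :- a)) refl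

    translate-fixed : ∀ v x → v ⊕ x ≡ v → x ≡ 𝟎
    translate-fixed (vec v₁ v₂ v₃) (vec x₁ x₂ x₃) e = vec-cong (f v₁ x₁ (cong c₁ e)) (f v₂ x₂ (cong c₂ e)) (f v₃ x₃ (cong c₃ e))
      where
      f : ∀ v x → v + x ≡ v → x ≡ 0#
      f v x e = trans (solve 2 (λ v x → x := v :+ x :+ :- v) refl v x) (trans (cong (_+ - v) e) (-‿inverseʳ v))

    second-translate : ∀ v a b → v ⊕ (a ⊕ ⊖ ⊖ (a ⊕ b)) ≡ v ⊕ (a ⊕ ⊖ b) ⊕ (a ⊕ (b ⊕ b))
    second-translate (vec v₁ v₂ v₃) (vec a₁ a₂ a₃) (vec b₁ b₂ b₃) = vec-cong (f v₁ a₁ b₁) (f v₂ a₂ b₂) (f v₃ a₃ b₃)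
      where
      f : ∀ v a b → v + (a + - - (a + b)) ≡ v + (a + - b) + (a + (b + b))
      f = solve 3 (λ v a b → v :+ (a :+ :- :- (a :+ b)) := v :+ (a :+ :- b) :+ (a :+ (b :+ b))) refl

    ×-sum-multiple : ∀ a v l → (a ⊕ v) ×ᵛ (a ⊕ l · v) ≡ (l + - 1#) · (a ×ᵛ v)
    ×-sum-multiple (vec a₁ a₂ a₃) (vec v₁ v₂ v₃) l = vec-cong (f a₂ a₃ v₂ v₃) (f a₃ a₁ v₃ v₁) (f a₁ a₂ v₁ v₂)
      where
      f : ∀ a b v w → (a + v) * (b + l * w) + - ((b + w) * (a + l * v)) ≡ (l + - 1#) * (a * w + - (b * v))
      f a b v w = trans
        (solve 5 (λ a b v w l → (a :+ v) :* (b :+ l :* w) :+ :- ((b :+ w) :* (a :+ l :* v)) :=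
           l :* (a :* w :+ :- (b :* v)) :+ :- (a :* w :+ :- (b :* v))) refl a b v w l)
        (trans (cong (λ z → l * (a * w + - (b * v)) + - z) (sym (*-identityˡ _)))
        (solve 3 (λ l o x → l :* x :+ :- (o :* x) := (l :+ :- o) :* x) refl l 1# (a * w + - (b * v))))

    nonzero-coordinate : ∀ {a} → ¬ a ≡ 𝟎 → ∃ λ e → ¬ dot e a ≡ 0#
    nonzero-coordinate {vec x y z} a≢𝟎 with x ≟ 0# | y ≟ 0# | z ≟ 0#
    ... | no x≢0 | _ | _ = vec 1# 0# 0# , λ e → x≢0 (trans (sym (trans (solve 4 (λ o x y z → o :* x :+ 0P :* y :+ 0P :* z := o :* x) refl 1# x y z) (*-identityˡ x))) e)
    ... | yes _ | no y≢0 | _ = vec 0# 1# 0# , λ e → y≢0 (trans (sym (trans (solve 4 (λ o x y z → 0P :* x :+ o :* y :+ 0P :* z := o :* y) refl 1# x y z) (*-identityˡ y))) e)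
    ... | yes _ | yes _ | no z≢0 = vec 0# 0# 1# , λ e → z≢0 (trans (sym (trans (solve 4 (λ o x y z → 0P :* x :+ 0P :* y :+ o :* z := o :* z) refl 1# x y z) (*-identityˡ z))) e)
    ... | yes refl | yes refl | yes refl = ⊥-elim (a≢𝟎 refl)

    ⊕⊖-cancel : ∀ {a b} → a ⊕ ⊖ b ≡ 𝟎 → a ≡ b
    ⊕⊖-cancel {vec _ _ _} {vec _ _ _} e = vec-cong (x-y≡0⇒x≡y (cong c₁ e)) (x-y≡0⇒x≡y (cong c₂ e)) (x-y≡0⇒x≡y (cong c₃ e))

    -- The vectors (y, - x, 0), (z, 0, - x) and (0, z, - y) are orthogonal to (x, y, z). The two
    -- that contain a given nonzero coordinate have its square as an entry of their cross product.
    perp : ∀ {x} → ¬ x ≡ 𝟎 → ∃ λ a → ∃ λ b → ¬ a ×ᵛ b ≡ 𝟎 × dot a x ≡ 0# × dot b x ≡ 0#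
    perp {vec x y z} nz with x ≟ 0# | y ≟ 0# | z ≟ 0#
    ... | no x≢0 | _ | _ = vec y (- x) 0# , vec z 0# (- x)
        , (λ e → no-zero-divisors x≢0 x≢0 (trans (solve 1 (λ x → x :* x := :- x :* :- x :+ :- (0P :* 0P)) refl x) (cong c₁ e)))
        , solve 3 (λ x y z → y :* x :+ :- x :* y :+ 0P :* z := 0P) refl x y z
        , solve 3 (λ x y z → z :* x :+ 0P :* y :+ :- x :* z := 0P) refl x y z
    ... | yes _ | no y≢0 | _ = vec y (- x) 0# , vec 0# z (- y)
        , (λ e → no-zero-divisors y≢0 y≢0 (trans (solve 1 (λ y → y :* y := 0P :* 0P :+ :- (y :* :- y)) refl y) (cong c₂ e)))
        , solve 3 (λ x y z → y :* x :+ :- x :* y :+ 0P :* z := 0P) refl x y z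
        , solve 3 (λ x y z → 0P :* x :+ z :* y :+ :- y :* z := 0P) refl x y z
    ... | yes _ | yes _ | no z≢0 = vec z 0# (- x) , vec 0# z (- y)
        , (λ e → no-zero-divisors z≢0 z≢0 (trans (solve 1 (λ z → z :* z := z :* z :+ :- (0P :* 0P)) refl z) (cong c₃ e)))
        , solve 3 (λ x y z → z :* x :+ 0P :* y :+ :- x :* z := 0P) refl x y z
        , solve 3 (λ x y z → 0P :* x :+ z :* y :+ :- y :* z := 0P) refl x y z
    ... | yes refl | yes refl | yes refl = ⊥-elim (nz refl)

  unscale : ∀ {l} {a b : V} → ¬ l ≡ 0# → l · a ≡ b → a ≡ l ⁻¹ · b
  unscale {l} {a} l≢0 refl = sym (trans (·-assoc (l ⁻¹) l a) (trans (cong (_· a) (trans (*-comm (l ⁻¹) l) (*-inverseʳ l≢0))) (1· a)))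

  ·-cancel : ∀ {l a} → ¬ l ≡ 0# → l · a ≡ 𝟎 → a ≡ 𝟎
  ·-cancel {l} l≢0 e = trans (unscale l≢0 e) (·𝟎 (l ⁻¹))

  -- Expanding the triple product of `e`, `a`, `b`, which is zero, gives
  -- `dot e b · a ≡ dot e a · b`.
  parallel : ∀ {a b} → ¬ a ≡ 𝟎 → a ×ᵛ b ≡ 𝟎 → ∃ λ l → b ≡ l · a
  parallel {a} {b} a≢𝟎 a×b≡𝟎 with e , ea ← nonzero-coordinate a≢𝟎 =
    dot e a ⁻¹ * dot e b , trans (unscale ea (sym swapped)) (·-assoc _ _ a)
    where
    swapped : dot e b · a ≡ dot e a · b
    swapped = ⊕⊖-cancel (trans (sym (triple-product e a b)) (trans (cong (e ×ᵛ_) a×b≡𝟎) (×-𝟎ʳ e)))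

  parallel-dot : ∀ {a b x} → ¬ a ≡ 𝟎 → a ×ᵛ b ≡ 𝟎 → dot a x ≡ 0# → dot b x ≡ 0#
  parallel-dot {a} {b} {x} a≢𝟎 a∥b ax with l , refl ← parallel a≢𝟎 a∥b = trans (dot-·ˡ l a x) (trans (cong (l *_) ax) (zeroʳ l))

  orthogonal-to-both : ∀ {a b x} → dot a x ≡ 0# → dot b x ≡ 0# → x ×ᵛ (a ×ᵛ b) ≡ 𝟎
  orthogonal-to-both {a} {b} {x} ax bx = trans (triple-product x a b)
    (trans (cong₂ (λ s t → s · a ⊕ ⊖ (t · b)) (trans (dot-comm x b) bx) (trans (dot-comm x a) ax))
    (trans (cong₂ (λ s t → s ⊕ ⊖ t) (0· a) (0· b)) (trans (cong (𝟎 ⊕_) ⊖𝟎) (⊕𝟎 𝟎))))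

  parallel-trans : ∀ {a b c} → ¬ b ≡ 𝟎 → a ×ᵛ b ≡ 𝟎 → b ×ᵛ c ≡ 𝟎 → a ×ᵛ c ≡ 𝟎
  parallel-trans {a} {b} b≢𝟎 a∥b b∥c with l , refl ← parallel b≢𝟎 b∥c = trans (×-·ʳ a l b) (trans (cong (l ·_) a∥b) (·𝟎 l))

  -- Geometrically, two distinct lines meet in only one point, and dually.
  both-orthogonal-parallel : ∀ {a b x y} → ¬ a ×ᵛ b ≡ 𝟎 → dot a x ≡ 0# → dot b x ≡ 0# → dot a y ≡ 0# → dot b y ≡ 0# → x ×ᵛ y ≡ 𝟎
  both-orthogonal-parallel {a} {b} {x} {y} a∦b ax bx ay by =
    parallel-trans a∦b (orthogonal-to-both ax bx) (×-𝟎ˡ-sym (orthogonal-to-both ay by))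

  -- Of the two distinct lines through `x` given by `perp`, at most one coincides with `a`.
  extend : ∀ {a x} → ¬ a ≡ 𝟎 → ¬ x ≡ 𝟎 → dot a x ≡ 0# → ∃ λ b → dot b x ≡ 0# × ¬ a ×ᵛ b ≡ 𝟎
  extend {a} {x} a≢𝟎 x≢𝟎 ax with b₁ , b₂ , b₁∦b₂ , b₁x , b₂x ← perp x≢𝟎 with (a ×ᵛ b₁) ≟ᵛ 𝟎
  ... | no a∦b₁  = b₁ , b₁x , a∦b₁
  ... | yes a∥b₁ = b₂ , b₂x , λ a∥b₂ → b₁∦b₂ (parallel-trans a≢𝟎 (×-𝟎ˡ-sym a∥b₁) a∥b₂)

-- Plane sets with at most three points on a line, and their 2-secants.

module Arcs {q : ℕ} (F : FiniteField q) where
  open FieldArithmetic F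
  open FiniteSubsets
  open DualPairs F
  open Space F

  -- Counts the points `f i` on the line `a` or, when `f` is a family of lines, those lines that
  -- pass through the point `a`.
  Z : ∀ {N} → (Fin N → V) → V → ℕ
  Z f a = size (λ i → is0 (dot a (f i)))

  dot-pencil : ∀ a l b x → dot (a ⊕ l · b) x ≡ dot a x + l * dot b x
  dot-pencil a l b x = trans (dot-⊕ˡ a (l · b) x) (cong (dot a x +_) (dot-·ˡ l b x))

  ×-pencil : ∀ a l b → b ×ᵛ (a ⊕ l · b) ≡ b ×ᵛ a
  ×-pencil a l b = trans (×-⊕ʳ b a (l · b)) (trans (cong ((b ×ᵛ a) ⊕_)
    (trans (×-·ʳ b l b) (trans (cong (l ·_) (×-self b)) (·𝟎 l)))) (⊕𝟎 _))

  ≢𝟎ʳ : ∀ {a b} → ¬ a ×ᵛ b ≡ 𝟎 → ¬ b ≡ 𝟎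
  ≢𝟎ʳ {a} a∦b refl = a∦b (×-𝟎ʳ a)

  pencil-≢𝟎 : ∀ {a b} → ¬ a ×ᵛ b ≡ 𝟎 → ∀ l → ¬ a ⊕ l · b ≡ 𝟎
  pencil-≢𝟎 {a} {b} a∦b l e = a∦b (×-𝟎ˡ-sym (trans (sym (×-pencil a l b)) (trans (cong (b ×ᵛ_) e) (×-𝟎ʳ b))))

  pencil-0 : ∀ {a l} b → l ≡ 0# → a ⊕ l · b ≡ a
  pencil-0 {a} b refl = trans (cong (a ⊕_) (0· b)) (⊕𝟎 a)

  pencil-dot : ∀ {a b x} → dot a x ≡ 0# → dot b x ≡ 0# → ∀ l → dot (a ⊕ l · b) x ≡ 0#
  pencil-dot {a} {b} {x} ax bx l = trans (dot-pencil a l b x) (trans (cong₂ (λ s t → s + l * t) ax bx) (trans (+-identityˡ _) (zeroʳ l)))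

  pencil : ∀ {N} (f : Fin N → V) a b →
    Z f b ℕ.+ sum (λ l → Z f (a ⊕ elt l · b)) ≡ N ℕ.+ q ℕ.* size (λ i → is0 (dot a (f i)) ∧ is0 (dot b (f i)))
  pencil f a b = trans
    (cong (Z f b ℕ.+_) (sum-cong-≗ (λ l → size-cong (λ i → cong is0 (dot-pencil a (elt l) b (f i))))))
    (pencil-sum (λ i → dot a (f i)) (λ i → dot b (f i)))

  is-zero-index : Fin q → Bool
  is-zero-index l = is0 (elt l)

  one-zero : size is-zero-index ≡ 1
  one-zero = count-solutions {is0} 0# (is0-true refl) (λ y → true⇒0)

  Z-parallel : ∀ {N} (f : Fin N → V) {a b} → ¬ a ≡ 𝟎 → ¬ b ≡ 𝟎 → a ×ᵛ b ≡ 𝟎 → Z f a ≡ Z f b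
  Z-parallel f {a} {b} a≢𝟎 b≢𝟎 a∥b = size-iff {S = λ i → is0 (dot a (f i))} {T = λ i → is0 (dot b (f i))}
    (λ i h → is0-true (parallel-dot a≢𝟎 a∥b (true⇒0 h)))
    (λ i h → is0-true (parallel-dot b≢𝟎 (×-𝟎ˡ-sym a∥b) (true⇒0 h)))

  record IsArc {N} (p : Fin N → V) : Set where
    field
      point≢𝟎     : ∀ i → ¬ p i ≡ 𝟎
      independent : ∀ {i j} → ¬ i ≡ j → ¬ p i ×ᵛ p j ≡ 𝟎
      line≤3      : ∀ {a} → ¬ a ≡ 𝟎 → Z p a ≤ 3

    same-point : ∀ {i j} → p i ×ᵛ p j ≡ 𝟎 → i ≡ j
    same-point {i} {j} e = decidable-stable (i ≟ᶠ j) (λ i≢j → independent i≢j e)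

    -- The point `p i` lies on all q + 1 lines of the pencil, every other point on exactly one.
    through-point : ∀ i {a b} → ¬ a ×ᵛ b ≡ 𝟎 → dot a (p i) ≡ 0# → dot b (p i) ≡ 0# →
      Z p b ℕ.+ sum (λ l → Z p (a ⊕ elt l · b)) ≡ N ℕ.+ q
    through-point i {a} {b} a∦b ai bi = trans (pencil p a b) (cong (N ℕ.+_) (trans (cong (q ℕ.*_) one) (ℕₚ.*-identityʳ q)))
      where
      common : Sub N
      common j = is0 (dot a (p j)) ∧ is0 (dot b (p j))
      at-i : ∀ {j} → common j ≡ true → j ≡ i
      at-i {j} h = same-point (both-orthogonal-parallel a∦b (true⇒0 (∧-trueˡ h)) (true⇒0 (∧-trueʳ {is0 (dot a (p j))} h)) ai bi)
      one : size common ≡ 1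
      one = ≤-antisym (size-≤1 common (λ h h′ → trans (at-i h) (sym (at-i h′)))) (member-size common {i} (∧-true (is0-true ai) (is0-true bi)))

    -- The other q lines through `p i` account for at most 3 incidences each.
    line-lower : ∀ i {a} → ¬ a ≡ 𝟎 → dot a (p i) ≡ 0# → N ℕ.+ q ≤ Z p a ℕ.+ q ℕ.* 3
    line-lower i {a} a≢𝟎 ai with b , bi , a∦b ← extend a≢𝟎 (point≢𝟎 i) ai =
      ≤-trans (≤-reflexive (sym (through-point i b∦a bi ai)))
        (+-monoʳ-≤ (Z p a) (sum-≤-const 3 (λ l → line≤3 (pencil-≢𝟎 b∦a (elt l)))))
      where
      b∦a : ¬ b ×ᵛ a ≡ 𝟎
      b∦a = a∦b ∘ ×-𝟎ˡ-sym

    extend-arc : ∀ {Q} → ¬ Q ≡ 𝟎 → (∀ i → ¬ Q ×ᵛ p i ≡ 𝟎) → (∀ {a} → ¬ a ≡ 𝟎 → dot a Q ≡ 0# → Z p a ≤ 2) →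
      ∃ λ (p⁺ : Fin (suc N) → V) → IsArc p⁺
    extend-arc {Q} Q≢𝟎 external lines≤2 = p⁺ , record { point≢𝟎 = nz ; independent = ind ; line≤3 = line }
      where
      p⁺ : Fin (suc N) → V
      p⁺ zero    = Q
      p⁺ (suc i) = p i
      nz : ∀ i → ¬ p⁺ i ≡ 𝟎
      nz zero    = Q≢𝟎
      nz (suc i) = point≢𝟎 i
      ind : ∀ {i j} → ¬ i ≡ j → ¬ p⁺ i ×ᵛ p⁺ j ≡ 𝟎
      ind {zero}  {zero}  ne = ⊥-elim (ne refl)
      ind {zero}  {suc j} _  = external j
      ind {suc i} {zero}  _  = external i ∘ ×-𝟎ˡ-sym
      ind {suc i} {suc j} ne = independent (ne ∘ cong suc)
      line : ∀ {a} → ¬ a ≡ 𝟎 → Z p⁺ a ≤ 3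
      line {a} a≢𝟎 with dot a Q ≟ 0#
      ... | yes aQ = s≤s (lines≤2 a≢𝟎 aQ)
      ... | no _   = line≤3 a≢𝟎

  module Tangents (3<q : 3 < q) (p : Fin (2 ℕ.* q ℕ.+ 2) → V) (arc : IsArc p) where
    open IsArc arc

    N = 2 ℕ.* q ℕ.+ 2

    line≥2 : ∀ i {a} → ¬ a ≡ 𝟎 → dot a (p i) ≡ 0# → 2 ≤ Z p a
    line≥2 i {a} a≢𝟎 ai = +-cancelʳ-≤ (q ℕ.* 3) 2 (Z p a) (≤-trans (≤-reflexive (id₁ q)) (line-lower i a≢𝟎 ai))
      where
      id₁ : ∀ q → 2 ℕ.+ q ℕ.* 3 ≡ 2 ℕ.* q ℕ.+ 2 ℕ.+ q
      id₁ = solve-∀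

    abstract
      -- The q + 1 lines through a point carry 3q + 2 incidences, one short of 3 (q + 1).
      tangent : ∀ i → ∃ λ t → ¬ t ≡ 𝟎 × dot t (p i) ≡ 0# × Z p t ≤ 2
      tangent i with a , b , a∦b , ai , bi ← perp (point≢𝟎 i) with Z p b ≤? 2
      ... | yes b≤2 = b , ≢𝟎ʳ a∦b , bi , b≤2
      ... | no b>2 with any? (λ l → Z p (a ⊕ elt l · b) ≤? 2)
      ...   | yes (l , l≤2) = a ⊕ elt l · b , pencil-≢𝟎 a∦b (elt l) , pencil-dot ai bi (elt l) , l≤2
      ...   | no none = ⊥-elim (<-irrefl refl (begin-strict
          N ℕ.+ q                                             <⟨ ≤-reflexive (id₂ q) ⟩
          3 ℕ.+ q ℕ.* 3                                       ≤⟨ +-mono-≤ (≰⇒> b>2) (const-≤-sum 3 (λ l → ≰⇒> (λ h → none (l , h)))) ⟩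
          Z p b ℕ.+ sum (λ l → Z p (a ⊕ elt l · b))           ≡⟨ through-point i a∦b ai bi ⟩
          N ℕ.+ q                                             ∎))
        where
        open ℕₚ.≤-Reasoning
        id₂ : ∀ q → suc (2 ℕ.* q ℕ.+ 2 ℕ.+ q) ≡ 3 ℕ.+ q ℕ.* 3
        id₂ = solve-∀

    -- Two such lines would leave at most 3q + 1 incidences. The line `a` is the member of the
    -- pencil with parameter 0, so the indicator `is-zero-index` fills up its count to 3.
    tangent-unique : ∀ i {a b} → ¬ a ≡ 𝟎 → ¬ b ≡ 𝟎 → dot a (p i) ≡ 0# → dot b (p i) ≡ 0# → Z p a ≤ 2 → Z p b ≤ 2 → a ×ᵛ b ≡ 𝟎
    tangent-unique i {a} {b} a≢𝟎 b≢𝟎 ai bi a≤2 b≤2 = decidable-stable ((a ×ᵛ b) ≟ᵛ 𝟎) (λ a∦b → <-irrefl refl (begin-strict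
        N ℕ.+ q ℕ.+ 1                                                     ≡⟨ cong₂ ℕ._+_ (sym (through-point i a∦b ai bi)) (sym one-zero) ⟩
        Z p b ℕ.+ sum (λ l → Z p (a ⊕ elt l · b)) ℕ.+ size is-zero-index  ≡⟨ ℕₚ.+-assoc (Z p b) _ _ ⟩
        Z p b ℕ.+ (sum (λ l → Z p (a ⊕ elt l · b)) ℕ.+ size is-zero-index)
          ≡⟨ cong (Z p b ℕ.+_) (sym (∑-distrib-+ (λ l → Z p (a ⊕ elt l · b)) (λ l → 𝟙 (is-zero-index l)))) ⟩
        Z p b ℕ.+ sum (λ l → Z p (a ⊕ elt l · b) ℕ.+ 𝟙 (is-zero-index l)) ≤⟨ +-mono-≤ b≤2 (sum-≤-const 3 (term≤3 a∦b)) ⟩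
        2 ℕ.+ q ℕ.* 3                                                     <⟨ ≤-reflexive (id₃ q) ⟩
        N ℕ.+ q ℕ.+ 1                                                     ∎))
      where
      open ℕₚ.≤-Reasoning
      id₃ : ∀ q → suc (2 ℕ.+ q ℕ.* 3) ≡ 2 ℕ.* q ℕ.+ 2 ℕ.+ q ℕ.+ 1
      id₃ = solve-∀
      term≤3 : ¬ a ×ᵛ b ≡ 𝟎 → ∀ l → Z p (a ⊕ elt l · b) ℕ.+ 𝟙 (is-zero-index l) ≤ 3
      term≤3 a∦b l with elt l ≟ 0#
      ... | yes l≡0 = +-monoˡ-≤ 1 (subst (λ v → Z p v ≤ 2) (sym (pencil-0 b l≡0)) a≤2)
      ... | no _    = ≤-trans (≤-reflexive (ℕₚ.+-identityʳ _)) (line≤3 (pencil-≢𝟎 a∦b (elt l)))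

    T : Fin N → V
    T i = proj₁ (tangent i)
    T≢𝟎 : ∀ i → ¬ T i ≡ 𝟎
    T≢𝟎 i = proj₁ (proj₂ (tangent i))
    T∋ : ∀ i → dot (T i) (p i) ≡ 0#
    T∋ i = proj₁ (proj₂ (proj₂ (tangent i)))
    T≤2 : ∀ i → Z p (T i) ≤ 2
    T≤2 i = proj₂ (proj₂ (proj₂ (tangent i)))

    T-size : ∀ i → Z p (T i) ≡ 2
    T-size i = ≤-antisym (T≤2 i) (line≥2 i (T≢𝟎 i) (T∋ i))

    -- Counts the arc points whose 2-secant passes through the given point, so every 2-secant
    -- contributes twice.
    τ : V → ℕ
    τ = Z T

    -- By uniqueness every `T m` through `p i` is the line `T i`, and the indices `m` are those of
    -- its two points.
    τ-point : ∀ i → τ (p i) ≡ 2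
    τ-point i = trans (size-iff {S = λ m → is0 (dot (p i) (T m))} {T = λ m → is0 (dot (T i) (p m))}
      (λ m h → is0-true (parallel-dot (T≢𝟎 m) (tangent-unique i (T≢𝟎 m) (T≢𝟎 i) (trans (dot-comm (T m) (p i)) (true⇒0 h)) (T∋ i) (T≤2 m) (T≤2 i)) (T∋ m)))
      (λ m h → is0-true (trans (dot-comm (p i) (T m)) (parallel-dot (T≢𝟎 i) (tangent-unique m (T≢𝟎 i) (T≢𝟎 m) (true⇒0 h) (T∋ m) (T≤2 i) (T≤2 m)) (T∋ i)))))
      (T-size i)

    -- Dual use of `pencil`: `T i` meets the line `a` in one point unless it coincides with `a`. The
    -- latter happens exactly for the points on `a`, and then all q + 1 points of `a` count.
    τ-along : ∀ {a x y} → ¬ a ≡ 𝟎 → ¬ x ×ᵛ y ≡ 𝟎 → dot a x ≡ 0# → dot a y ≡ 0# → Z p a ≤ 2 →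
      τ y ℕ.+ sum (λ l → τ (x ⊕ elt l · y)) ≡ N ℕ.+ q ℕ.* Z p a
    τ-along {a} {x} {y} a≢𝟎 x∦y ax ay a≤2 = trans (pencil T x y) (cong (λ m → N ℕ.+ q ℕ.* m) (size-iff {S = λ i → is0 (dot x (T i)) ∧ is0 (dot y (T i))} {T = λ i → is0 (dot a (p i))} to from))
      where
      to : ∀ i → is0 (dot x (T i)) ∧ is0 (dot y (T i)) ≡ true → is0 (dot a (p i)) ≡ true
      to i h = is0-true (parallel-dot (T≢𝟎 i)
        (both-orthogonal-parallel x∦y (true⇒0 (∧-trueˡ h)) (true⇒0 (∧-trueʳ {is0 (dot x (T i))} h)) (trans (dot-comm x a) ax) (trans (dot-comm y a) ay))
        (T∋ i))
      from : ∀ i → is0 (dot a (p i)) ≡ true → is0 (dot x (T i)) ∧ is0 (dot y (T i)) ≡ true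
      from i h = ∧-true (on x ax) (on y ay)
        where
        on : ∀ z → dot a z ≡ 0# → is0 (dot z (T i)) ≡ true
        on z az = is0-true (trans (dot-comm z (T i)) (parallel-dot a≢𝟎 (tangent-unique i a≢𝟎 (T≢𝟎 i) (true⇒0 h) (T∋ i) a≤2 (T≤2 i)) az))

    External : V → Set
    External Q = ¬ Q ≡ 𝟎 × (∀ i → ¬ Q ×ᵛ p i ≡ 𝟎)

    lines : V → V → Fin (suc q) → V
    lines a b zero    = b
    lines a b (suc l) = a ⊕ elt l · b

    isTangent : V → Bool
    isTangent a = does (Z p a ≤? 2)

    module External-point {Q a b : V} (ext : External Q) (a∦b : ¬ a ×ᵛ b ≡ 𝟎) (aQ : dot a Q ≡ 0#) (bQ : dot b Q ≡ 0#) where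
      L : Fin (suc q) → V
      L = lines a b

      L≢𝟎 : ∀ l → ¬ L l ≡ 𝟎
      L≢𝟎 zero    = ≢𝟎ʳ a∦b
      L≢𝟎 (suc l) = pencil-≢𝟎 a∦b (elt l)

      L∋Q : ∀ l → dot (L l) Q ≡ 0#
      L∋Q zero    = bQ
      L∋Q (suc l) = pencil-dot aQ bQ (elt l)

      one-line : ∀ i → size (λ l → is0 (dot (L l) (p i))) ≡ 1
      one-line i = trans (cong (𝟙 (is0 (dot b (p i))) ℕ.+_) (size-cong (λ l → cong is0 (dot-pencil a (elt l) b (p i)))))
        (trans (pencil-point (dot a (p i)) (dot b (p i))) (cong suc (trans (cong (λ c → q ℕ.* 𝟙 c) (≢true⇒false not-both)) (*-zeroʳ q))))
        where
        not-both : ¬ is0 (dot a (p i)) ∧ is0 (dot b (p i)) ≡ true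
        not-both h = proj₂ ext i (both-orthogonal-parallel a∦b aQ bQ (true⇒0 (∧-trueˡ h)) (true⇒0 (∧-trueʳ {is0 (dot a (p i))} h)))

      z : Fin (suc q) → ℕ
      z l = Z p (L l)

      sum-z : sum z ≡ N
      sum-z = trans (∑-comm (λ l i → 𝟙 (is0 (dot (L l) (p i))))) (trans (sum-cong-≗ one-line) (trans (sum-const N 1) (ℕₚ.*-identityʳ N)))

      z-values : ∀ l → z l ≡ 0 ⊎ z l ≡ 2 ⊎ z l ≡ 3
      z-values l with z l in e
      ... | 0 = inj₁ refl
      ... | suc m with i , on ← inhabited (λ i → is0 (dot (L l) (p i))) (subst (0 <_) (sym e) (s≤s z≤n))
          with m≤n⇒m<n∨m≡n (subst (2 ≤_) e (line≥2 i (L≢𝟎 l) (true⇒0 on)))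
      ...   | inj₂ 2≡ = inj₂ (inj₁ (sym 2≡))
      ...   | inj₁ 3≤ = inj₂ (inj₂ (≤-antisym (subst (_≤ 3) e (line≤3 (L≢𝟎 l))) 3≤))

      -- The line `T i` passes through `Q` exactly if the line joining `Q` to `p i` is a 2-secant;
      -- the points are grouped by these joining lines.
      sum-τ : τ Q ≡ sum (λ l → 𝟙 (isTangent (L l)) ℕ.* z l)
      sum-τ = begin
        sum (λ i → 𝟙 (is0 (dot Q (T i))))
          ≡⟨ sum-cong-≗ (λ i → trans (sym (ℕₚ.*-identityʳ _)) (trans (cong (𝟙 (is0 (dot Q (T i))) ℕ.*_) (sym (one-line i)))
               (sym (sum-*ˡ (𝟙 (is0 (dot Q (T i)))) (λ l → 𝟙 (is0 (dot (L l) (p i)))))))) ⟩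
        sum (λ i → sum (λ l → 𝟙 (is0 (dot Q (T i))) ℕ.* 𝟙 (is0 (dot (L l) (p i)))))
          ≡⟨ ∑-comm (λ i l → 𝟙 (is0 (dot Q (T i))) ℕ.* 𝟙 (is0 (dot (L l) (p i)))) ⟩
        sum (λ l → sum (λ i → 𝟙 (is0 (dot Q (T i))) ℕ.* 𝟙 (is0 (dot (L l) (p i)))))
          ≡⟨ sum-cong-≗ (λ l → trans (sum-cong-≗ (incident l)) (sum-*ˡ (𝟙 (isTangent (L l))) (λ i → 𝟙 (is0 (dot (L l) (p i)))))) ⟩
        sum (λ l → 𝟙 (isTangent (L l)) ℕ.* z l) ∎
        where
        open ≡-Reasoning
        incident : ∀ l i → 𝟙 (is0 (dot Q (T i))) ℕ.* 𝟙 (is0 (dot (L l) (p i))) ≡ 𝟙 (isTangent (L l)) ℕ.* 𝟙 (is0 (dot (L l) (p i)))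
        incident l i with dot (L l) (p i) ≟ 0#
        ... | no _ = trans (*-zeroʳ (𝟙 (is0 (dot Q (T i))))) (sym (*-zeroʳ (𝟙 (isTangent (L l)))))
        ... | yes on with dot Q (T i) ≟ 0# | isTangent (L l) in tan
        ...   | yes _   | true  = refl
        ...   | no _    | false = refl
        ...   | yes QTi | false = ⊥-elim (from-¬does (Z p (L l) ≤? 2) tan (subst (_≤ 2) (Z-parallel p (T≢𝟎 i) (L≢𝟎 l) TL) (T≤2 i)))
          where
          TL : T i ×ᵛ L l ≡ 𝟎
          TL = both-orthogonal-parallel (proj₂ ext i) QTi (trans (dot-comm (p i) (T i)) (T∋ i))
                 (trans (dot-comm Q (L l)) (L∋Q l)) (trans (dot-comm (p i) (L l)) on)
        ...   | no Q∉ | true = ⊥-elim (Q∉ (trans (dot-comm Q (T i)) (parallel-dot (L≢𝟎 l) (tangent-unique i (L≢𝟎 l) (T≢𝟎 i) on (T∋ i) (from-does (Z p (L l) ≤? 2) tan) (T≤2 i)) (L∋Q l))))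

      two three : ℕ → ℕ
      two 2 = 1
      two _ = 0
      three 3 = 1
      three _ = 0

      tangent-lines triple-lines : ℕ
      tangent-lines = sum (λ l → two (z l))
      triple-lines  = sum (λ l → three (z l))

      τ-even : τ Q ≡ 2 ℕ.* tangent-lines
      τ-even = trans sum-τ (trans (sum-cong-≗ f) (sum-*ˡ 2 (λ l → two (z l))))
        where
        f : ∀ l → 𝟙 (isTangent (L l)) ℕ.* z l ≡ 2 ℕ.* two (z l)
        f l with z l | z-values l
        ... | _ | inj₁ refl        = refl
        ... | _ | inj₂ (inj₁ refl) = refl
        ... | _ | inj₂ (inj₂ refl) = refl

      N-split : N ≡ 2 ℕ.* tangent-lines ℕ.+ 3 ℕ.* triple-lines
      N-split = trans (sym sum-z) (trans (sum-cong-≗ f) (trans (∑-distrib-+ (λ l → 2 ℕ.* two (z l)) (λ l → 3 ℕ.* three (z l)))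
        (cong₂ ℕ._+_ (sum-*ˡ 2 (λ l → two (z l))) (sum-*ˡ 3 (λ l → three (z l))))))
        where
        f : ∀ l → z l ≡ 2 ℕ.* two (z l) ℕ.+ 3 ℕ.* three (z l)
        f l with z l | z-values l
        ... | _ | inj₁ refl        = refl
        ... | _ | inj₂ (inj₁ refl) = refl
        ... | _ | inj₂ (inj₂ refl) = refl

      -- If every line through `Q` meets the arc, each of the q + 1 lines has at least 2 points, and
      -- N = 2 (q + 1) leaves no room for a third.
      passant-or-all-tangent : (∃ λ l → z l ≡ 0) ⊎ τ Q ≡ N
      passant-or-all-tangent with any? (λ l → z l ℕ.≟ 0)
      ... | yes found = inj₁ found
      ... | no none = inj₂ (trans sum-τ (trans (sum-cong-≗ all-tangent) sum-z))
        where
        open ℕₚ.≤-Reasoning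
        z≥2 : ∀ l → 2 ≤ z l
        z≥2 l with z l | z-values l | (λ e → none (l , e))
        ... | _ | inj₁ refl        | h = ⊥-elim (h refl)
        ... | _ | inj₂ (inj₁ refl) | _ = s≤s (s≤s z≤n)
        ... | _ | inj₂ (inj₂ refl) | _ = s≤s (s≤s z≤n)
        excess : Sub (suc q)
        excess l = does (3 ≤? z l)
        no-excess : size excess ≡ 0
        no-excess = n≤0⇒n≡0 (+-cancelˡ-≤ N _ _ (begin
          N ℕ.+ size excess                       ≡⟨ cong (ℕ._+ size excess) (id₄ q) ⟩
          suc q ℕ.* 2 ℕ.+ size excess             ≡⟨ cong (ℕ._+ size excess) (sym (sum-const (suc q) 2)) ⟩
          sum {suc q} (λ _ → 2) ℕ.+ size excess   ≡⟨ sym (∑-distrib-+ (λ _ → 2) (λ l → 𝟙 (excess l))) ⟩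
          sum (λ l → 2 ℕ.+ 𝟙 (excess l))          ≤⟨ sum-mono term ⟩
          sum z                                   ≡⟨ sum-z ⟩
          N                                       ≡⟨ sym (ℕₚ.+-identityʳ N) ⟩
          N ℕ.+ 0                                 ∎))
          where
          id₄ : ∀ q → 2 ℕ.* q ℕ.+ 2 ≡ suc q ℕ.* 2
          id₄ = solve-∀
          term : ∀ l → 2 ℕ.+ 𝟙 (excess l) ≤ z l
          term l with excess l in e
          ... | true  = from-does (3 ≤? z l) e
          ... | false = z≥2 l
        all-tangent : ∀ l → 𝟙 (isTangent (L l)) ℕ.* z l ≡ z l
        all-tangent l with isTangent (L l) in tan
        ... | true  = ℕₚ.*-identityˡ _
        ... | false = ⊥-elim (<-irrefl refl (subst (1 ≤_) no-excess
          (member-size excess {l} (dec-true (3 ≤? z l) (≰⇒> (from-¬does (Z p (L l) ≤? 2) tan))))))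

-- Completion of 2q + 2 points to 2q + 3.

module ArcCompletion {q : ℕ} (F : FiniteField q) where
  open FieldArithmetic F
  open FiniteSubsets
  open DualPairs F
  open Space F
  open Arcs F

  module Completion (3<q : 3 < q) (p : Fin (2 ℕ.* q ℕ.+ 2) → V) (arc : IsArc p) where
    open IsArc arc
    open Tangents 3<q p arc

    module _ {Q : V} (ext : External Q) where
      private
        frame = perp (proj₁ ext)
        open module E = External-point ext (proj₁ (proj₂ (proj₂ frame))) (proj₁ (proj₂ (proj₂ (proj₂ frame)))) (proj₂ (proj₂ (proj₂ (proj₂ frame))))

      -- By `N-split`, N = 2A + 3B with A the number of 2-secants through `Q`, so 3 divides A; and A
      -- is not 0.
      τ≥6 : 3 ∣ N → 1 ≤ τ Q → 6 ≤ τ Q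
      τ≥6 3∣N 1≤τ = ≤-trans (*-monoʳ-≤ 2 (at-least tangent-lines 3∣A 1≤A)) (≤-reflexive (sym τ-even))
        where
        id₀ : ∀ A → 3 ℕ.* A ≡ 2 ℕ.* A ℕ.+ A
        id₀ = solve-∀
        3∣A : 3 ∣ tangent-lines
        3∣A = ∣m+n∣m⇒∣n (subst (3 ∣_) (id₀ tangent-lines) (m∣m*n tangent-lines))
          (∣m+n∣m⇒∣n (subst (3 ∣_) (trans N-split (ℕₚ.+-comm (2 ℕ.* tangent-lines) _)) 3∣N) (m∣m*n triple-lines))
        1≤A : ¬ tangent-lines ≡ 0
        1≤A A≡0 = <-irrefl refl (subst (1 ≤_) (trans τ-even (cong (2 ℕ.*_) A≡0)) 1≤τ)
        at-least : ∀ A → 3 ∣ A → ¬ A ≡ 0 → 3 ≤ A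
        at-least zero    _ A≢0 = ⊥-elim (A≢0 refl)
        at-least (suc A) d _   = ∣⇒≤ d

      -- With no 2-secant through `Q`, all lines through it would have 0 or 3 points, and 3 would
      -- divide N.
      τ≥2 : ¬ 3 ∣ N → 2 ≤ τ Q
      τ≥2 3∤N = cases tangent-lines refl
        where
        cases : ∀ A → A ≡ tangent-lines → 2 ≤ τ Q
        cases zero    e = ⊥-elim (3∤N (divides triple-lines (trans N-split
          (trans (cong (λ A → 2 ℕ.* A ℕ.+ 3 ℕ.* triple-lines) (sym e)) (ℕₚ.*-comm 3 triple-lines)))))
        cases (suc A) e = ≤-trans (*-monoʳ-≤ 2 (s≤s (z≤n {A}))) (≤-reflexive (sym (trans τ-even (cong (2 ℕ.*_) (sym e)))))

      passant : ¬ τ Q ≡ N → ∃ λ a → ¬ a ≡ 𝟎 × dot a Q ≡ 0# × Z p a ≡ 0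
      passant τ≢N with passant-or-all-tangent
      ... | inj₁ (l , z≡0) = L l , L≢𝟎 l , L∋Q l , z≡0
      ... | inj₂ τ≡N       = ⊥-elim (τ≢N τ≡N)

    off-passant : ∀ {a x} → Z p a ≡ 0 → ¬ x ≡ 𝟎 → dot a x ≡ 0# → External x
    off-passant {a} {x} Za x≢𝟎 ax = x≢𝟎 , λ i x∥p → <-irrefl refl (subst (1 ≤_) Za
      (member-size (λ i → is0 (dot a (p i))) {i} (is0-true (trans (dot-comm a (p i)) (parallel-dot x≢𝟎 x∥p (trans (dot-comm x a) ax))))))

    -- Over the q + 1 points of an external line through `Q` the values of `τ` add up to N = 2 (q +
    -- 1), and each of them is at least 2.
    τ≤2 : ¬ 3 ∣ N → ∀ {Q} → External Q → ¬ τ Q ≡ N → τ Q ≤ 2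
    τ≤2 3∤N {Q} ext τ≢N with a , a≢𝟎 , aQ , Za ← passant ext τ≢N
      with x , xa , Q∦x ← extend (proj₁ ext) a≢𝟎 (trans (dot-comm Q a) aQ) = +-cancelʳ-≤ (q ℕ.* 2) (τ Q) 2 (begin
        τ Q ℕ.+ q ℕ.* 2                         ≤⟨ +-monoʳ-≤ (τ Q) (const-≤-sum 2 (λ l → τ≥2 (off-passant Za (pencil-≢𝟎 x∦Q (elt l)) (on l)) 3∤N)) ⟩
        τ Q ℕ.+ sum (λ l → τ (x ⊕ elt l · Q))   ≡⟨ τ-along a≢𝟎 x∦Q (trans (dot-comm a x) xa) aQ (≤-trans (≤-reflexive Za) z≤n) ⟩
        N ℕ.+ q ℕ.* Z p a                       ≡⟨ cong (λ m → N ℕ.+ q ℕ.* m) Za ⟩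
        N ℕ.+ q ℕ.* 0                           ≡⟨ id₅ q ⟩
        2 ℕ.+ q ℕ.* 2                           ∎)
      where
      open ℕₚ.≤-Reasoning
      id₅ : ∀ q → 2 ℕ.* q ℕ.+ 2 ℕ.+ q ℕ.* 0 ≡ 2 ℕ.+ q ℕ.* 2
      id₅ = solve-∀
      x∦Q : ¬ x ×ᵛ Q ≡ 𝟎
      x∦Q = Q∦x ∘ ×-𝟎ˡ-sym
      on : ∀ l → dot a (x ⊕ elt l · Q) ≡ 0#
      on l = trans (dot-comm a _) (pencil-dot xa (trans (dot-comm Q a) aQ) (elt l))

    module OnTangent (i₀ j₀ : Fin N) (tY : dot (T i₀) (p j₀) ≡ 0#) (j₀≢i₀ : ¬ j₀ ≡ i₀) where
      X Y t : V
      X = p i₀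
      Y = p j₀
      t = T i₀
      tX : dot t X ≡ 0#
      tX = T∋ i₀
      X∦Y : ¬ X ×ᵛ Y ≡ 𝟎
      X∦Y = independent (j₀≢i₀ ∘ sym)

      point : Fin q → V
      point l = X ⊕ elt l · Y

      t∋point : ∀ l → dot t (point l) ≡ 0#
      t∋point l = trans (dot-comm t (point l)) (pencil-dot (trans (dot-comm X t) tX) (trans (dot-comm Y t) tY) (elt l))

      external-point : ∀ l → ¬ elt l ≡ 0# → External (point l)
      external-point l l≢0 = pencil-≢𝟎 X∦Y (elt l) , not-on
        where
        not-on : ∀ m → ¬ point l ×ᵛ p m ≡ 𝟎
        not-on m e with m ≟ᶠ i₀ | m ≟ᶠ j₀
        ... | yes refl | _ = X∦Y (·-cancel l≢0 (trans (sym (×-·ʳ X (elt l) Y)) (trans (sym (trans (×-⊕ʳ X X (elt l · Y))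
                (trans (cong (_⊕ (X ×ᵛ (elt l · Y))) (×-self X)) (𝟎⊕ _)))) (×-𝟎ˡ-sym e))))
        ... | no _ | yes refl = X∦Y (×-𝟎ˡ-sym (trans (sym (×-pencil X (elt l) Y)) (×-𝟎ˡ-sym e)))
        ... | no m≢i | no m≢j = <-irrefl refl (≤-trans
                (size-3 (λ i → is0 (dot t (p i))) (is0-true tX) (is0-true tY)
                  (is0-true (trans (dot-comm t (p m)) (parallel-dot (pencil-≢𝟎 X∦Y (elt l)) e (trans (dot-comm (point l) t) (t∋point l)))))
                  j₀≢i₀ m≢i m≢j)
                (T≤2 i₀))

      sum-τ-points : sum (λ l → τ (point l)) ≡ 4 ℕ.* q
      sum-τ-points = +-cancelˡ-≡ 2 _ _ (trans (cong (ℕ._+ sum (λ l → τ (point l))) (sym (τ-point j₀)))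
        (trans (τ-along (T≢𝟎 i₀) X∦Y tX tY (T≤2 i₀)) (trans (cong (λ m → N ℕ.+ q ℕ.* m) (T-size i₀)) (id₆ q))))
        where
        id₆ : ∀ q → 2 ℕ.* q ℕ.+ 2 ℕ.+ q ℕ.* 2 ≡ 2 ℕ.+ 4 ℕ.* q
        id₆ = solve-∀

      τ-at-0 : ∀ l → elt l ≡ 0# → τ (point l) ≡ 2
      τ-at-0 l l≡0 = trans (cong τ (pencil-0 Y l≡0)) (τ-point i₀)

      -- The q - 1 points of `t` off the arc have values of `τ` with sum 4q - 2. Under the
      -- assumption each value is at least 6 if 3 divides N, and at most 2 if not; q > 3 excludes
      -- both. The summand with factor 4 lifts the value 2 at `X` to 6, which makes the lower bound
      -- uniform.
      few-tangents : (∀ l → ¬ elt l ≡ 0# → ¬ τ (point l) ≡ N) → Dec (3 ∣ N) → ⊥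
      few-tangents none (yes 3∣N) = <-irrefl refl (begin-strict
        4 ℕ.* q ℕ.+ 4 ℕ.* 1                                            <⟨ bound ⟩
        q ℕ.* 6                                                        ≤⟨ const-≤-sum 6 term ⟩
        sum (λ l → τ (point l) ℕ.+ 4 ℕ.* 𝟙 (is-zero-index l))
          ≡⟨ ∑-distrib-+ (λ l → τ (point l)) (λ l → 4 ℕ.* 𝟙 (is-zero-index l)) ⟩
        sum (λ l → τ (point l)) ℕ.+ sum (λ l → 4 ℕ.* 𝟙 (is-zero-index l))
          ≡⟨ cong₂ ℕ._+_ sum-τ-points (trans (sum-*ˡ 4 (λ l → 𝟙 (is-zero-index l))) (cong (4 ℕ.*_) one-zero)) ⟩
        4 ℕ.* q ℕ.+ 4 ℕ.* 1                                            ∎)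
        where
        open ℕₚ.≤-Reasoning
        bound : 4 ℕ.* q ℕ.+ 4 ℕ.* 1 < q ℕ.* 6
        bound with d , e ← m≤n⇒∃[o]m+o≡n 3<q = subst (λ q → 4 ℕ.* q ℕ.+ 4 ℕ.* 1 < q ℕ.* 6) e
          (≤-trans (m≤m+n _ (3 ℕ.+ 2 ℕ.* d)) (≤-reflexive (id₇ d)))
          where
          id₇ : ∀ d → suc (4 ℕ.* (4 ℕ.+ d) ℕ.+ 4 ℕ.* 1) ℕ.+ (3 ℕ.+ 2 ℕ.* d) ≡ (4 ℕ.+ d) ℕ.* 6
          id₇ = solve-∀
        term : ∀ l → 6 ≤ τ (point l) ℕ.+ 4 ℕ.* 𝟙 (is-zero-index l)
        term l with elt l ≟ 0#
        ... | yes l≡0 = ≤-reflexive (cong (ℕ._+ 4) (sym (τ-at-0 l l≡0)))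
        ... | no l≢0  = ≤-trans (τ≥6 (external-point l l≢0) 3∣N
          (member-size (λ i → is0 (dot (point l) (T i))) {i₀} (is0-true (trans (dot-comm (point l) t) (t∋point l))))) (m≤m+n _ _)
      few-tangents none (no 3∤N) = <-irrefl refl (begin-strict
        q ℕ.* 2                     <⟨ bound ⟩
        4 ℕ.* q                     ≡⟨ sym sum-τ-points ⟩
        sum (λ l → τ (point l))     ≤⟨ sum-≤-const 2 term ⟩
        q ℕ.* 2                     ∎)
        where
        open ℕₚ.≤-Reasoning
        bound : q ℕ.* 2 < 4 ℕ.* q
        bound with d , e ← m≤n⇒∃[o]m+o≡n 3<q = subst (λ q → q ℕ.* 2 < 4 ℕ.* q) e
          (≤-trans (m≤m+n _ (7 ℕ.+ 2 ℕ.* d)) (≤-reflexive (id₈ d)))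
          where
          id₈ : ∀ d → suc ((4 ℕ.+ d) ℕ.* 2) ℕ.+ (7 ℕ.+ 2 ℕ.* d) ≡ 4 ℕ.* (4 ℕ.+ d)
          id₈ = solve-∀
        term : ∀ l → τ (point l) ≤ 2
        term l with elt l ≟ 0#
        ... | yes l≡0 = ≤-reflexive (τ-at-0 l l≡0)
        ... | no l≢0  = τ≤2 3∤N (external-point l l≢0) (none l l≢0)

      some-concurrent : ∃ λ Q → External Q × τ Q ≡ N
      some-concurrent with any? (λ l → ¬? (elt l ≟ 0#) ×-dec (τ (point l) ℕ.≟ N))
      ... | yes (l , l≢0 , τ≡N) = point l , external-point l l≢0 , τ≡N
      ... | no none = ⊥-elim (few-tangents (λ l l≢0 e → none (l , l≢0 , e)) (3 ∣? N))

    concurrent : ∃ λ Q → External Q × τ Q ≡ N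
    concurrent = OnTangent.some-concurrent i₀ (proj₁ second) (true⇒0 (proj₁ (proj₂ second))) (proj₂ (proj₂ second))
      where
      -- Any point will do; it is transported because 2q + 2 does not reduce to a successor.
      i₀ : Fin N
      i₀ = subst Fin (ℕₚ.+-comm 2 (2 ℕ.* q)) zero
      S : Sub N
      S i = is0 (dot (T i₀) (p i))
      second : ∃ λ j → is0 (dot (T i₀) (p j)) ≡ true × ¬ j ≡ i₀
      second = let j , h = inhabited (S ∖ i₀) (≤-reflexive (sym (cong ℕ.pred (trans (sym (size-∖ S (is0-true (T∋ i₀)))) (T-size i₀)))))
               in j , ∖⇒S S h , ∖⇒≢ S h

    completion : ∃ λ (p⁺ : Fin (suc N) → V) → IsArc p⁺
    completion = complete concurrent
      where
      complete : (∃ λ Q → External Q × τ Q ≡ N) → ∃ λ (p⁺ : Fin (suc N) → V) → IsArc p⁺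
      complete (Q , ext , τ≡N) = extend-arc (proj₁ ext) (proj₂ ext) lines≤2
        where
        S : Sub N
        S i = is0 (dot Q (T i))
        all-through : ∀ i → dot (T i) Q ≡ 0#
        all-through i = trans (dot-comm (T i) Q) (decidable-stable (dot Q (T i) ≟ 0#) (λ ne → <-irrefl refl (begin-strict
          N                             ≡⟨ sym τ≡N ⟩
          size S                        <⟨ m<m+n (size S) (member-size (not ∘ S) {i} (cong not (is0-false ne))) ⟩
          size S ℕ.+ size (not ∘ S)     ≡⟨ size-complement S ⟩
          N                             ∎)))
          where open ℕₚ.≤-Reasoning
        -- If the line contains an arc point `p i`, it shares `Q` and `p i` with `T i` and coincides
        -- with it.
        lines≤2 : ∀ {a} → ¬ a ≡ 𝟎 → dot a Q ≡ 0# → Z p a ≤ 2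
        lines≤2 {a} a≢𝟎 aQ = cases (Z p a) refl
          where
          cases : ∀ m → m ≡ Z p a → Z p a ≤ 2
          cases zero    e = ≤-trans (≤-reflexive (sym e)) z≤n
          cases (suc m) e with i , on ← inhabited (λ i → is0 (dot a (p i))) (subst (0 <_) e (s≤s z≤n)) =
            subst (_≤ 2) (Z-parallel p (T≢𝟎 i) a≢𝟎 T∥a) (T≤2 i)
            where
            T∥a : T i ×ᵛ a ≡ 𝟎
            T∥a = both-orthogonal-parallel (proj₂ ext i) (trans (dot-comm Q (T i)) (all-through i)) (trans (dot-comm (p i) (T i)) (T∋ i))
                    (trans (dot-comm Q a) aQ) (trans (dot-comm (p i) a) (true⇒0 on))

-- Sets of 2q + 3 points: Segre's products and Ceva's condition.

module MaximalArcs {q : ℕ} (F : FiniteField q) where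
  open FieldArithmetic F
  open FiniteSubsets hiding (sum-single; ∑-comm; sum-cong-≗)
  open DualPairs F
  open Space F
  open Arcs F

  open MonoidSum *-commutativeMonoid using ()
    renaming (sum to prod; ∑-distrib-+ to prod-*; ∑-comm to prod-comm; sum-cong-≗ to prod-cong; ∑-permute to prod-permute)
  open SumSingle *-commutativeMonoid using () renaming (sum-single to prod-single)

  -- With the junk value 1#, points on the sides of a triangle drop out of the products below.
  ρ : Carrier → Carrier → Carrier
  ρ x y = if is0 x ∨ is0 y then 1# else x * y ⁻¹

  ρ-0ˡ : ∀ {x} y → x ≡ 0# → ρ x y ≡ 1#
  ρ-0ˡ y x≡0 rewrite is0-true x≡0 = refl

  ρ-0ʳ : ∀ x {y} → y ≡ 0# → ρ x y ≡ 1#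
  ρ-0ʳ x y≡0 rewrite is0-true y≡0 with is0 x
  ... | true  = refl
  ... | false = refl

  ρ-≢0 : ∀ {x y} → ¬ x ≡ 0# → ¬ y ≡ 0# → ρ x y ≡ x * y ⁻¹
  ρ-≢0 x≢0 y≢0 rewrite is0-false x≢0 | is0-false y≢0 = refl

  ρ-same : ∀ {x y} → x ≡ y → ρ x y ≡ 1#
  ρ-same {x} refl with x ≟ 0#
  ... | yes _  = refl
  ... | no x≢0 = *-inverseʳ x≢0

  unit-part : Carrier → Carrier
  unit-part x = if is0 x then 1# else x

  pow : Carrier → ℕ → Carrier
  pow x zero    = 1#
  pow x (suc n) = x * pow x n

  prod-indicator : ∀ {n} (S : Sub n) x → prod (λ i → if S i then x else 1#) ≡ pow x (size S)
  prod-indicator {zero}  S x = refl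
  prod-indicator {suc n} S x with S zero
  ... | true  = cong (x *_) (prod-indicator (S ∘ suc) x)
  ... | false = trans (*-identityˡ _) (prod-indicator (S ∘ suc) x)

  prod-1 : ∀ {n} {f : Fin n → Carrier} → (∀ i → f i ≡ 1#) → prod f ≡ 1#
  prod-1 {zero}  _ = refl
  prod-1 {suc n} h = trans (cong₂ _*_ (h zero) (prod-1 (h ∘ suc))) (*-identityˡ 1#)

  -- The product of the nonzero field elements squares to 1, since inversion permutes them.
  prod-squares : prod (λ l → pow (unit-part (- elt l)) 2) ≡ 1#
  prod-squares = begin
    prod (λ l → pow (w l) 2)                   ≡⟨ prod-cong (λ l → cong (w l *_) (*-identityʳ (w l))) ⟩
    prod (λ l → w l * w l)                     ≡⟨ prod-* w w ⟩
    prod w * prod w                            ≡⟨ cong (prod w *_) (prod-permute w π) ⟩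
    prod w * prod (λ l → w (idx (elt l ⁻¹)))   ≡⟨ sym (prod-* w (λ l → w (idx (elt l ⁻¹)))) ⟩
    prod (λ l → w l * w (idx (elt l ⁻¹)))      ≡⟨ prod-1 cancels ⟩
    1#                                         ∎
    where
    open ≡-Reasoning
    w : Fin q → Carrier
    w l = unit-part (- elt l)
    inv : Fin q → Fin q
    inv l = idx (elt l ⁻¹)
    inv-inv : ∀ l → inv (inv l) ≡ l
    inv-inv l = trans (cong (λ x → idx (x ⁻¹)) (elt-idx _)) (trans (cong idx (⁻¹-involutive (elt l))) (idx-elt l))
    π = permutation inv inv inv-inv inv-inv
    cancel : ∀ x → Dec (x ≡ 0#) → unit-part (- x) * unit-part (- (x ⁻¹)) ≡ 1#
    cancel x (no x≢0) rewrite is0-false (-‿≢0 x≢0) | is0-false (-‿≢0 (⁻¹-≢0 x≢0)) = trans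
      (solve 2 (λ x y → :- x :* :- y := x :* y) refl x (x ⁻¹)) (*-inverseʳ x≢0)
    cancel x (yes x≡0) rewrite is0-true (trans (cong -_ x≡0) -0#≈0#) | is0-true (trans (cong -_ (trans (cong _⁻¹ x≡0) 0⁻¹≡0)) -0#≈0#) = *-identityˡ 1#
    cancels : ∀ l → w l * w (inv l) ≡ 1#
    cancels l = trans (cong (λ y → w l * unit-part (- y)) (elt-idx (elt l ⁻¹))) (cancel (elt l) (elt l ≟ 0#))

  module MaximalArc {N : ℕ} (N≡ : N ≡ 2 ℕ.* q ℕ.+ 3) (p : Fin N → V) (arc : IsArc p) where
    open IsArc arc

    line≡3 : ∀ i {a} → ¬ a ≡ 𝟎 → dot a (p i) ≡ 0# → Z p a ≡ 3
    line≡3 i {a} a≢𝟎 ai = ≤-antisym (line≤3 a≢𝟎) (+-cancelʳ-≤ (q ℕ.* 3) 3 (Z p a)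
      (≤-trans (≤-reflexive (trans (id₁ q) (cong (ℕ._+ q) (sym N≡)))) (line-lower i a≢𝟎 ai)))
      where
      id₁ : ∀ q → 3 ℕ.+ q ℕ.* 3 ≡ 2 ℕ.* q ℕ.+ 3 ℕ.+ q
      id₁ = solve-∀

    -- Any representative of an arc point; the freedom of the factor is what the normalisations
    -- below exploit.
    On : V → Set
    On v = ∃ λ i → ∃ λ l → ¬ l ≡ 0# × v ≡ l · p i

    On-point : ∀ i → On (p i)
    On-point i = i , 1# , 1≢0 , sym (1· (p i))

    On-scale : ∀ {l v} → ¬ l ≡ 0# → On v → On (l · v)
    On-scale {l} l≢0 (i , m , m≢0 , refl) = i , l * m , no-zero-divisors l≢0 m≢0 , ·-assoc l m (p i)

    On-⊖ : ∀ {v} → On v → On (⊖ v)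
    On-⊖ {v} on = subst On (sym (⊖≡-1· v)) (On-scale (-‿≢0 1≢0) on)

    On-≢𝟎 : ∀ {v} → On v → ¬ v ≡ 𝟎
    On-≢𝟎 (i , l , l≢0 , refl) e = point≢𝟎 i (·-cancel l≢0 e)

    same-index : ∀ {u v} (on-u : On u) (on-v : On v) → proj₁ on-u ≡ proj₁ on-v → u ×ᵛ v ≡ 𝟎
    same-index (i , l , _ , refl) (.i , m , _ , refl) refl = trans (×-·ʳ (l · p i) m (p i))
      (trans (cong (m ·_) (×-𝟎ˡ-sym (trans (×-·ʳ (p i) l (p i)) (trans (cong (l ·_) (×-self (p i))) (·𝟎 l))))) (·𝟎 m))

    dot-index : ∀ {a v} (on : On v) → dot a v ≡ 0# → dot a (p (proj₁ on)) ≡ 0#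
    dot-index {a} (i , l , l≢0 , refl) e = *-zeroˡ-cancel l≢0 (trans (sym (dot-·ʳ a l (p i))) e)

    fourth-point : ∀ {a u v w x} → ¬ a ≡ 𝟎 → On u → On v → On w → On x →
      dot a u ≡ 0# → dot a v ≡ 0# → dot a w ≡ 0# → dot a x ≡ 0# →
      ¬ u ×ᵛ v ≡ 𝟎 → ¬ u ×ᵛ w ≡ 𝟎 → ¬ v ×ᵛ w ≡ 𝟎 → u ×ᵛ x ≡ 𝟎 ⊎ v ×ᵛ x ≡ 𝟎 ⊎ w ×ᵛ x ≡ 𝟎
    fourth-point {a} {u} {v} {w} {x} a≢𝟎 ou ov ow ox au av aw ax u∦v u∦w v∦w
      with (u ×ᵛ x) ≟ᵛ 𝟎 | (v ×ᵛ x) ≟ᵛ 𝟎 | (w ×ᵛ x) ≟ᵛ 𝟎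
    ... | yes e | _     | _     = inj₁ e
    ... | no _  | yes e | _     = inj₂ (inj₁ e)
    ... | no _  | no _  | yes e = inj₂ (inj₂ e)
    ... | no ux | no vx | no wx = ⊥-elim (<-irrefl refl (≤-trans
      (size-4 (λ i → is0 (dot a (p i)))
        (is0-true (dot-index ou au)) (is0-true (dot-index ov av)) (is0-true (dot-index ow aw)) (is0-true (dot-index ox ax))
        (λ e → u∦v (same-index ou ov (sym e))) (λ e → u∦w (same-index ou ow (sym e))) (λ e → v∦w (same-index ov ow (sym e)))
        (λ e → ux (same-index ou ox (sym e))) (λ e → vx (same-index ov ox (sym e))) (λ e → wx (same-index ow ox (sym e))))
      (line≤3 a≢𝟎)))

    -- By `line≡3` one arc point remains on the line. Cramer's rule, with an auxiliary `e`
    -- independent of `u` and `v`, yields its coordinates; neither is zero, so the first can be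
    -- scaled to 1.
    third-point : ∀ {u v} → On u → On v → ¬ u ×ᵛ v ≡ 𝟎 → ∃ λ ν → ¬ ν ≡ 0# × On (u ⊕ ν · v)
    third-point {u} {v} ou ov u∦v = result (inhabited (S ∖ proj₁ ou ∖ proj₁ ov) (≤-reflexive (sym size≡1)))
      where
      S : Sub N
      S i = is0 (dot (u ×ᵛ v) (p i))
      Su : S (proj₁ ou) ≡ true
      Su = is0-true (dot-index ou (trans (dot-comm (u ×ᵛ v) u) (dot-×ˡ u v)))
      Sv : S (proj₁ ov) ≡ true
      Sv = is0-true (dot-index ov (trans (dot-comm (u ×ᵛ v) v) (dot-×ʳ u v)))
      size≡1 : size (S ∖ proj₁ ou ∖ proj₁ ov) ≡ 1
      size≡1 = cong ℕ.pred (trans (sym (size-∖ (S ∖ proj₁ ou) (∖-true S Sv (λ e → u∦v (same-index ou ov (sym e))))))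
        (cong ℕ.pred (trans (sym (size-∖ S Su)) (line≡3 (proj₁ ou) u∦v (true⇒0 Su)))))
      result : (∃ λ k → (S ∖ proj₁ ou ∖ proj₁ ov) k ≡ true) → ∃ λ ν → ¬ ν ≡ 0# × On (u ⊕ ν · v)
      result (k , h) with e , D≢0 ← nonzero-coordinate u∦v =
        x ⁻¹ * y , no-zero-divisors (⁻¹-≢0 x≢0) y≢0 ,
        subst On (trans (·-⊕ (x ⁻¹) (x · u) (y · v)) (cong₂ _⊕_ (trans (·-assoc (x ⁻¹) x u) (trans (cong (_· u) (trans (*-comm (x ⁻¹) x) (*-inverseʳ x≢0))) (1· u))) (·-assoc (x ⁻¹) y v)))
          (On-scale (⁻¹-≢0 x≢0) (subst On expansion (On-scale D≢0 (On-point k))))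
        where
        w = p k
        D = dot e (u ×ᵛ v)
        x = det w v e
        y = det u w e
        k≢u : ¬ k ≡ proj₁ ou
        k≢u = ∖⇒≢ S (∖⇒S (S ∖ proj₁ ou) h)
        k≢v : ¬ k ≡ proj₁ ov
        k≢v = ∖⇒≢ (S ∖ proj₁ ou) h
        on-line : det u v w ≡ 0#
        on-line = true⇒0 (∖⇒S S (∖⇒S (S ∖ proj₁ ou) h))
        expansion : D · w ≡ x · u ⊕ y · v
        expansion = trans (cong (_· w) (dot-comm e (u ×ᵛ v))) (trans (cramer u v w e)
          (trans (cong (λ z → x · u ⊕ y · v ⊕ z · e) on-line) (trans (cong (x · u ⊕ y · v ⊕_) (0· e)) (⊕𝟎 _))))
        multiple : ∀ {z} (oz : On z) m → D · w ≡ m · z → k ≡ proj₁ oz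
        multiple {z} oz m eq = same-point (parallel-trans (On-≢𝟎 oz) w∥z (z∥pz oz))
          where
          z∥pz : ∀ {z} (oz : On z) → z ×ᵛ p (proj₁ oz) ≡ 𝟎
          z∥pz oz = same-index oz (On-point (proj₁ oz)) refl
          w∥z : w ×ᵛ z ≡ 𝟎
          w∥z = ×-𝟎ˡ-sym (·-cancel D≢0 (trans (sym (×-·ʳ z D w)) (trans (cong (z ×ᵛ_) eq) (trans (×-·ʳ z m z) (trans (cong (m ·_) (×-self z)) (·𝟎 m))))))
        x≢0 : ¬ x ≡ 0#
        x≢0 x≡0 = k≢v (multiple ov y (trans expansion (trans (cong (λ z → z · u ⊕ y · v) x≡0) (trans (cong (_⊕ y · v) (0· u)) (𝟎⊕ _)))))
        y≢0 : ¬ y ≡ 0#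
        y≢0 y≡0 = k≢u (multiple ou x (trans expansion (trans (cong (λ z → x · u ⊕ z · v) y≡0) (trans (cong (x · u ⊕_) (0· v)) (⊕𝟎 _)))))

    -- Every line f + l g through the point i, other than g = 0, contains exactly two further points.
    segre-product : ∀ i {f g} → ¬ f ×ᵛ g ≡ 𝟎 → dot f (p i) ≡ 0# → dot g (p i) ≡ 0# → prod (λ j → ρ (dot f (p j)) (dot g (p j))) ≡ 1#
    segre-product i {f} {g} f∦g fi gi = begin
      prod (λ j → ρ (dot f (p j)) (dot g (p j)))                                   ≡⟨ prod-cong pointwise ⟩
      prod (λ j → prod (λ l → if (S l ∖ i) j then c l else 1#))                    ≡⟨ prod-comm (λ j l → if (S l ∖ i) j then c l else 1#) ⟩
      prod (λ l → prod (λ j → if (S l ∖ i) j then c l else 1#))                    ≡⟨ prod-cong (λ l → trans (prod-indicator (S l ∖ i) (c l)) (cong (pow (c l)) (size≡2 l))) ⟩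
      prod (λ l → pow (c l) 2)                                                     ≡⟨ prod-squares ⟩
      1#                                                                           ∎
      where
      open ≡-Reasoning
      -- A point off `g` lies on just one line `f ⊕ elt l · g`, and there the quotient of the two
      -- functionals is `- elt l`. For `elt l ≡ 0#` the points lie on `f`, where `ρ` and `unit-part`
      -- both give `1#`. Exchanging the products groups the points by lines.
      c : Fin q → Carrier
      c l = unit-part (- elt l)
      S : Fin q → Sub N
      S l j = is0 (dot (f ⊕ elt l · g) (p j))
      size≡2 : ∀ l → size (S l ∖ i) ≡ 2
      size≡2 l = cong ℕ.pred (trans (sym (size-∖ (S l) (is0-true on))) (line≡3 i (pencil-≢𝟎 f∦g (elt l)) on))
        where
        on : dot (f ⊕ elt l · g) (p i) ≡ 0#
        on = pencil-dot fi gi (elt l)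
      skip : ∀ l j → ¬ S l j ≡ true → (if (S l ∖ i) j then c l else 1#) ≡ 1#
      skip l j h = cong (λ b → if b then c l else 1#) (≢true⇒false (λ e → h (∖⇒S (S l) e)))
      value : ∀ {x y} → Dec (x ≡ 0#) → ¬ y ≡ 0# → unit-part (- - (x * y ⁻¹)) ≡ ρ x y
      value {x} {y} (yes x≡0) y≢0 = trans (cong (λ b → if b then 1# else - - (x * y ⁻¹)) (is0-true (trans (cong (λ z → - - (z * y ⁻¹)) x≡0)
        (solve 1 (λ y → :- :- (con (ℤ.+ 0) :* y) := con (ℤ.+ 0)) refl (y ⁻¹))))) (sym (ρ-0ˡ y x≡0))
      value {x} {y} (no x≢0) y≢0 = trans (cong (λ b → if b then 1# else - - (x * y ⁻¹)) (is0-false (-‿≢0 (-‿≢0 (no-zero-divisors x≢0 (⁻¹-≢0 y≢0))))))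
        (trans (-‿involutive _) (sym (ρ-≢0 x≢0 y≢0)))
      pointwise-off : ∀ j → ¬ j ≡ i → Dec (dot g (p j) ≡ 0#) → ρ (dot f (p j)) (dot g (p j)) ≡ prod (λ l → if (S l ∖ i) j then c l else 1#)
      pointwise-off j j≢i (yes gj) = trans (ρ-0ʳ _ gj) (sym (prod-1 (λ l → skip l j (λ e → j≢i (same-point
                (both-orthogonal-parallel f∦g (f-zero l e) gj fi gi))))))
        where
        f-zero : ∀ l → S l j ≡ true → dot f (p j) ≡ 0#
        f-zero l e = trans (sym (trans (dot-pencil f (elt l) g (p j)) (trans (cong (λ z → dot f (p j) + elt l * z) gj)
          (trans (cong (dot f (p j) +_) (zeroʳ _)) (+-identityʳ _))))) (true⇒0 e)
      pointwise-off j j≢i (no gj≢0) = sym (trans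
        (prod-single (λ l → if (S l ∖ i) j then c l else 1#) (idx l₀) (λ l l≢ → skip l j (λ e → l≢ (trans (sym (idx-elt l)) (cong idx (unique l e))))))
        (trans (cong (λ b → if b then c (idx l₀) else 1#) (∖-true (S (idx l₀)) (is0-true solves) j≢i))
        (trans (cong (λ z → unit-part (- z)) (elt-idx l₀)) (value (x ≟ 0#) gj≢0))))
        where
        x = dot f (p j)
        y = dot g (p j)
        l₀ = - (x * y ⁻¹)
        solves : dot (f ⊕ elt (idx l₀) · g) (p j) ≡ 0#
        solves = begin
          dot (f ⊕ elt (idx l₀) · g) (p j)   ≡⟨ trans (dot-pencil f _ g (p j)) (cong (λ z → x + z * y) (elt-idx l₀)) ⟩
          x + - (x * y ⁻¹) * y               ≡⟨ solve 3 (λ x y y′ → x :+ :- (x :* y′) :* y := x :+ :- (x :* (y :* y′))) refl x y (y ⁻¹) ⟩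
          x + - (x * (y * y ⁻¹))             ≡⟨ cong (λ z → x + - (x * z)) (*-inverseʳ gj≢0) ⟩
          x + - (x * 1#)                     ≡⟨ cong (λ z → x + - z) (*-identityʳ x) ⟩
          x + - x                            ≡⟨ -‿inverseʳ x ⟩
          0#                                 ∎
        unique : ∀ l → S l j ≡ true → elt l ≡ l₀
        unique l e = *-cancelˡ gj≢0 (begin
          y * elt l                          ≡⟨ solve 3 (λ x y l → y :* l := (x :+ l :* y) :+ :- x) refl x y (elt l) ⟩
          (x + elt l * y) + - x              ≡⟨ cong (_+ - x) (trans (sym (dot-pencil f (elt l) g (p j))) (true⇒0 e)) ⟩
          0# + - x                           ≡⟨ cong (_+ - x) (sym (trans (sym (dot-pencil f _ g (p j))) solves)) ⟩
          (x + elt (idx l₀) * y) + - x       ≡⟨ solve 3 (λ x y l → (x :+ l :* y) :+ :- x := y :* l) refl x y (elt (idx l₀)) ⟩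
          y * elt (idx l₀)                   ≡⟨ cong (y *_) (elt-idx l₀) ⟩
          y * l₀                             ∎)
      pointwise-at : ∀ j → Dec (j ≡ i) → ρ (dot f (p j)) (dot g (p j)) ≡ prod (λ l → if (S l ∖ i) j then c l else 1#)
      pointwise-at j (yes refl) = trans (ρ-0ˡ _ fi) (sym (prod-1 (λ l → cong (λ b → if b then c l else 1#) (∖-self (S l) j))))
      pointwise-at j (no j≢i)   = pointwise-off j j≢i (dot g (p j) ≟ 0#)
      pointwise : ∀ j → ρ (dot f (p j)) (dot g (p j)) ≡ prod (λ l → if (S l ∖ i) j then c l else 1#)
      pointwise j = pointwise-at j (j ≟ᶠ i)

    det-≢0⇒∦ : ∀ {a b c} → ¬ det a b c ≡ 0# → ¬ a ×ᵛ b ≡ 𝟎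
    det-≢0⇒∦ {c = c} D≢0 e = D≢0 (trans (cong (λ z → dot z c) e) (trans (dot-comm 𝟎 c)
      (trans (cong (dot c) (sym (·𝟎 0#))) (trans (dot-·ʳ c 0# 𝟎) (zeroˡ _)))))

    det-repeat₁ : ∀ a b → det a b a ≡ 0#
    det-repeat₁ a b = trans (dot-comm (a ×ᵛ b) a) (dot-×ˡ a b)

    det-repeat₂ : ∀ a b → det a b b ≡ 0#
    det-repeat₂ a b = trans (dot-comm (a ×ᵛ b) b) (dot-×ʳ a b)

    -- Two sides meet in their common vertex: the cross product of the side lines is
    -- `det a b c · a`.
    sides-independent : ∀ {a b c} → ¬ a ≡ 𝟎 → ¬ det a b c ≡ 0# → ¬ (c ×ᵛ a) ×ᵛ (a ×ᵛ b) ≡ 𝟎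
    sides-independent {a} {b} {c} a≢𝟎 D≢0 e = a≢𝟎 (·-cancel D≢0 (begin
      det a b c · a                                          ≡⟨ sym (⊕𝟎 _) ⟩
      det a b c · a ⊕ 𝟎                                      ≡⟨ cong (det a b c · a ⊕_) (sym ⊖𝟎) ⟩
      det a b c · a ⊕ ⊖ 𝟎                                    ≡⟨ cong₂ (λ s t → s · a ⊕ ⊖ t) (trans (det-cycle a b c) (det-cycle b c a)) (sym (trans (cong (_· b) (det-repeat₂ c a)) (0· b))) ⟩
      det c a b · a ⊕ ⊖ (det c a a · b)                      ≡⟨ sym (triple-product (c ×ᵛ a) a b) ⟩
      (c ×ᵛ a) ×ᵛ (a ×ᵛ b)                                   ≡⟨ e ⟩
      𝟎                                                      ∎))
      where open ≡-Reasoning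

    triangle-product : ∀ {a b c} → On a → ¬ det a b c ≡ 0# → prod (λ j → ρ (det c a (p j)) (det a b (p j))) ≡ 1#
    triangle-product {a} {b} {c} oa D≢0 = segre-product (proj₁ oa) (sides-independent (On-≢𝟎 oa) D≢0)
      (dot-index oa (det-repeat₂ c a)) (dot-index oa (det-repeat₁ a b))

    cycle-≢0 : ∀ {a b c} → ¬ det a b c ≡ 0# → ¬ det b c a ≡ 0#
    cycle-≢0 {a} {b} {c} D≢0 e = D≢0 (trans (det-cycle a b c) e)

    det-sum : ∀ a b u v → det a b (u ⊕ v) ≡ det a b u + det a b v
    det-sum a b u v = dot-⊕ʳ (a ×ᵛ b) u v

    -- The points b, c, b + c of the side bc have a vanishing barycentric coordinate at c, a vanishing
    -- one at b, and equal ones, respectively.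
    side-ratio : ∀ {a b c} → On b → On c → On (b ⊕ c) → ¬ det a b c ≡ 0# → ∀ j → det b c (p j) ≡ 0# → ρ (det c a (p j)) (det a b (p j)) ≡ 1#
    side-ratio {a} {b} {c} ob oc obc D≢0 j on = cases (fourth-point b∦c ob oc obc (On-point j)
        (det-repeat₁ b c) (det-repeat₂ b c) (trans (det-sum b c b c) (trans (cong₂ _+_ (det-repeat₁ b c) (det-repeat₂ b c)) (+-identityˡ 0#))) on
        b∦c (λ e → b∦c (trans (sym b×) e)) (λ e → b∦c (×-𝟎ˡ-sym (trans (sym c×) e))))
      where
      b∦c : ¬ b ×ᵛ c ≡ 𝟎
      b∦c = det-≢0⇒∦ (cycle-≢0 {a} {b} {c} D≢0)
      b× : b ×ᵛ (b ⊕ c) ≡ b ×ᵛ c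
      b× = trans (×-⊕ʳ b b c) (trans (cong (_⊕ (b ×ᵛ c)) (×-self b)) (𝟎⊕ _))
      c× : c ×ᵛ (b ⊕ c) ≡ c ×ᵛ b
      c× = trans (×-⊕ʳ c b c) (trans (cong ((c ×ᵛ b) ⊕_) (×-self c)) (⊕𝟎 _))
      equal-ratio : (∃ λ l → p j ≡ l · (b ⊕ c)) → ρ (det c a (p j)) (det a b (p j)) ≡ 1#
      equal-ratio (l , eq) = ρ-same (begin
        det c a (p j)                      ≡⟨ trans (cong (det c a) eq) (dot-·ʳ (c ×ᵛ a) l (b ⊕ c)) ⟩
        l * det c a (b ⊕ c)                ≡⟨ cong (l *_) (trans (det-sum c a b c) (trans (cong (det c a b +_) (det-repeat₁ c a)) (+-identityʳ _))) ⟩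
        l * det c a b                      ≡⟨ cong (l *_) (det-cycle c a b) ⟩
        l * det a b c                      ≡⟨ cong (l *_) (sym (trans (det-sum a b b c) (trans (cong (_+ det a b c) (det-repeat₂ a b)) (+-identityˡ _)))) ⟩
        l * det a b (b ⊕ c)                ≡⟨ sym (trans (cong (det a b) eq) (dot-·ʳ (a ×ᵛ b) l (b ⊕ c))) ⟩
        det a b (p j)                      ∎)
        where open ≡-Reasoning
      cases : b ×ᵛ p j ≡ 𝟎 ⊎ c ×ᵛ p j ≡ 𝟎 ⊎ (b ⊕ c) ×ᵛ p j ≡ 𝟎 → ρ (det c a (p j)) (det a b (p j)) ≡ 1#
      cases (inj₁ b∥p) = ρ-0ʳ _ (trans (dot-comm (a ×ᵛ b) (p j)) (parallel-dot (On-≢𝟎 ob) b∥p (dot-×ʳ a b)))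
      cases (inj₂ (inj₁ c∥p)) = ρ-0ˡ _ (trans (dot-comm (c ×ᵛ a) (p j)) (parallel-dot (On-≢𝟎 oc) c∥p (dot-×ˡ c a)))
      cases (inj₂ (inj₂ bc∥p)) = equal-ratio (parallel (On-≢𝟎 obc) bc∥p)

    -- Multiply the Segre products at the three vertices. Off the sides the three ratios cancel; on
    -- the sides through `b` they are trivial by `side-ratio`. So the factor at the third point `X₀`
    -- of the side `ca` is also 1, which equates its coordinates there, proportional to 1 and `ν`.
    ceva : ∀ {a b c ν} → ¬ det a b c ≡ 0# → On a → On b → On c → On (a ⊕ b) → On (b ⊕ c) → ¬ ν ≡ 0# → On (c ⊕ ν · a) → ν ≡ 1#
    ceva {a} {b} {c} {ν} D≢0 oa ob oc oab obc ν≢0 oca@(X₀ , k , k≢0 , eq) = sym (*-cancelˡ D≢0 (begin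
      D * 1#                       ≡⟨ *-identityʳ D ⟩
      D                            ≡⟨ γ-eq ⟩
      k * γ X₀                     ≡⟨ cong (k *_) γ≡α ⟩
      k * α X₀                     ≡⟨ sym α-eq ⟩
      ν * D                        ≡⟨ *-comm ν D ⟩
      D * ν                        ∎))
      where
      open ≡-Reasoning
      D = det a b c
      α β γ : Fin N → Carrier
      α j = det b c (p j)
      β j = det c a (p j)
      γ j = det a b (p j)
      κ : Fin N → Carrier
      κ j = ρ (β j) (γ j) * (ρ (γ j) (α j) * ρ (α j) (β j))
      D₁ = cycle-≢0 {a} {b} {c} D≢0
      D₂ = cycle-≢0 {b} {c} {a} D₁

      prod-κ : prod κ ≡ 1#
      prod-κ = trans (prod-* (λ j → ρ (β j) (γ j)) (λ j → ρ (γ j) (α j) * ρ (α j) (β j)))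
        (trans (cong₂ _*_ (triangle-product oa D≢0) (trans (prod-* (λ j → ρ (γ j) (α j)) (λ j → ρ (α j) (β j)))
          (trans (cong₂ _*_ (triangle-product ob D₁) (triangle-product oc D₂)) (*-identityˡ 1#)))) (*-identityˡ 1#))

      functional-at : ∀ u v → det u v c + ν * det u v a ≡ k * det u v (p X₀)
      functional-at u v = trans (sym (trans (det-sum u v c (ν · a)) (cong (det u v c +_) (dot-·ʳ (u ×ᵛ v) ν a)))) (trans (cong (det u v) eq) (dot-·ʳ (u ×ᵛ v) k (p X₀)))
      γ-eq : D ≡ k * γ X₀
      γ-eq = trans (sym (trans (cong (λ z → D + ν * z) (det-repeat₁ a b)) (trans (cong (D +_) (zeroʳ ν)) (+-identityʳ D)))) (functional-at a b)
      α-eq : ν * D ≡ k * α X₀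
      α-eq = trans (sym (trans (cong₂ (λ y z → y + ν * z) (det-repeat₂ b c) (sym (det-cycle a b c))) (+-identityˡ _))) (functional-at b c)
      β-zero : β X₀ ≡ 0#
      β-zero = *-zeroˡ-cancel k≢0 (trans (sym (functional-at c a)) (trans (cong₂ (λ y z → y + ν * z) (det-repeat₁ c a) (det-repeat₂ c a))
        (trans (+-identityˡ _) (zeroʳ ν))))
      nonzero-factor : ∀ {x y} → ¬ x ≡ 0# → x ≡ k * y → ¬ y ≡ 0#
      nonzero-factor x≢0 e y≡0 = x≢0 (trans e (trans (cong (k *_) y≡0) (zeroʳ k)))
      γ≢0 : ¬ γ X₀ ≡ 0#
      γ≢0 = nonzero-factor D≢0 γ-eq
      α≢0 : ¬ α X₀ ≡ 0#
      α≢0 = nonzero-factor (no-zero-divisors ν≢0 D≢0) α-eq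

      κ-off : ∀ j → ¬ j ≡ X₀ → Dec (α j ≡ 0#) → Dec (β j ≡ 0#) → Dec (γ j ≡ 0#) → κ j ≡ 1#
      κ-off j j≢ (yes α0) _ _ = trans (cong₂ _*_ (side-ratio ob oc obc D≢0 j α0)
        (trans (cong₂ _*_ (ρ-0ʳ (γ j) α0) (ρ-0ˡ (β j) α0)) (*-identityˡ 1#))) (*-identityˡ 1#)
      κ-off j j≢ (no α≢) _ (yes γ0) = trans (cong₂ _*_ (ρ-0ʳ (β j) γ0)
        (trans (cong₂ _*_ (ρ-0ˡ (α j) γ0) (side-ratio oa ob oab D₂ j γ0)) (*-identityˡ 1#))) (*-identityˡ 1#)
      κ-off j j≢ (no α≢) (yes β0) (no γ≢) = ⊥-elim (cases (fourth-point c∦a oc oa oca (On-point j)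
          (det-repeat₁ c a) (det-repeat₂ c a)
          (trans (det-sum c a c (ν · a)) (trans (cong₂ _+_ (det-repeat₁ c a) (trans (dot-·ʳ (c ×ᵛ a) ν a) (trans (cong (ν *_) (det-repeat₂ c a)) (zeroʳ ν)))) (+-identityˡ 0#)))
          β0 c∦a
          (λ e → c∦a (·-cancel ν≢0 (trans (sym (×-·ʳ c ν a)) (trans (sym (trans (×-⊕ʳ c c (ν · a)) (trans (cong (_⊕ (c ×ᵛ (ν · a))) (×-self c)) (𝟎⊕ _)))) e))))
          (λ e → c∦a (×-𝟎ˡ-sym (trans (sym (×-pencil c ν a)) e)))))
        where
        c∦a : ¬ c ×ᵛ a ≡ 𝟎
        c∦a = det-≢0⇒∦ D₂
        cases : c ×ᵛ p j ≡ 𝟎 ⊎ a ×ᵛ p j ≡ 𝟎 ⊎ (c ⊕ ν · a) ×ᵛ p j ≡ 𝟎 → ⊥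
        cases (inj₁ c∥p) = α≢ (trans (dot-comm (b ×ᵛ c) (p j)) (parallel-dot (On-≢𝟎 oc) c∥p (dot-×ʳ b c)))
        cases (inj₂ (inj₁ a∥p)) = γ≢ (trans (dot-comm (a ×ᵛ b) (p j)) (parallel-dot (On-≢𝟎 oa) a∥p (dot-×ˡ a b)))
        cases (inj₂ (inj₂ ca∥p)) = j≢ (same-point (parallel-trans (On-≢𝟎 oca) (×-𝟎ˡ-sym ca∥p) (same-index oca (On-point X₀) refl)))
      κ-off j j≢ (no α≢) (no β≢) (no γ≢) = begin
        ρ (β j) (γ j) * (ρ (γ j) (α j) * ρ (α j) (β j))
          ≡⟨ cong₂ _*_ (ρ-≢0 β≢ γ≢) (cong₂ _*_ (ρ-≢0 γ≢ α≢) (ρ-≢0 α≢ β≢)) ⟩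
        β j * γ j ⁻¹ * (γ j * α j ⁻¹ * (α j * β j ⁻¹))
          ≡⟨ solve 6 (λ a a′ b b′ c c′ → b :* c′ :* (c :* a′ :* (a :* b′)) := a :* a′ :* (b :* b′) :* (c :* c′)) refl
               (α j) (α j ⁻¹) (β j) (β j ⁻¹) (γ j) (γ j ⁻¹) ⟩
        α j * α j ⁻¹ * (β j * β j ⁻¹) * (γ j * γ j ⁻¹)
          ≡⟨ cong₂ _*_ (cong₂ _*_ (*-inverseʳ α≢) (*-inverseʳ β≢)) (*-inverseʳ γ≢) ⟩
        1# * 1# * 1#
          ≡⟨ trans (*-identityʳ _) (*-identityʳ 1#) ⟩
        1# ∎

      κ-at : κ X₀ ≡ 1#
      κ-at = trans (sym (prod-single κ X₀ (λ j j≢ → κ-off j j≢ (α j ≟ 0#) (β j ≟ 0#) (γ j ≟ 0#)))) prod-κ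
      γ≡α : γ X₀ ≡ α X₀
      γ≡α = begin
        γ X₀                                        ≡⟨ sym (*-identityʳ _) ⟩
        γ X₀ * 1#                                   ≡⟨ cong (γ X₀ *_) (sym (*-inverseʳ α≢0)) ⟩
        γ X₀ * (α X₀ * α X₀ ⁻¹)                     ≡⟨ solve 3 (λ g a a′ → g :* (a :* a′) := a :* (g :* a′)) refl (γ X₀) (α X₀) (α X₀ ⁻¹) ⟩
        α X₀ * (γ X₀ * α X₀ ⁻¹)                     ≡⟨ cong (α X₀ *_) ratio ⟩
        α X₀ * 1#                                   ≡⟨ *-identityʳ _ ⟩
        α X₀                                        ∎
        where
        ratio : γ X₀ * α X₀ ⁻¹ ≡ 1#
        ratio = begin
          γ X₀ * α X₀ ⁻¹                  ≡⟨ sym (ρ-≢0 γ≢0 α≢0) ⟩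
          ρ (γ X₀) (α X₀)                 ≡⟨ sym (trans (*-identityˡ _) (*-identityʳ _)) ⟩
          1# * (ρ (γ X₀) (α X₀) * 1#)     ≡⟨ cong₂ (λ s t → s * (ρ (γ X₀) (α X₀) * t)) (sym (ρ-0ˡ (γ X₀) β-zero)) (sym (ρ-0ʳ (α X₀) β-zero)) ⟩
          κ X₀                            ≡⟨ κ-at ⟩
          1#                              ∎

    -- Two sides of the triangle `c`, `a`, `b` are normalised already, and `ceva` forces the factor
    -- on the third side to be 1.
    sum-On : ∀ {a b c} → ¬ det a b c ≡ 0# → On a → On b → On c → On (a ⊕ b) → On (a ⊕ c) → On (b ⊕ c)
    sum-On {a} {b} {c} D≢0 oa ob oc oab oac
      = from-third (third-point ob oc (det-≢0⇒∦ (cycle-≢0 {a} {b} {c} D≢0)))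
      where
      from-third : (∃ λ ν → ¬ ν ≡ 0# × On (b ⊕ ν · c)) → On (b ⊕ c)
      from-third (ν , ν≢0 , on) = subst On (cong (b ⊕_) (trans (cong (_· c) ν≡1) (1· c))) on
        where
        ν≡1 : ν ≡ 1#
        ν≡1 = ceva (cycle-≢0 {b} {c} {a} (cycle-≢0 {a} {b} {c} D≢0)) oc oa ob (subst On (⊕-comm a c) oac) oab ν≢0 on

-- Normalised vectors and the values of a functional on them.

module NoMaximalArcs {q : ℕ} (F : FiniteField q) where
  open FieldArithmetic F
  open FiniteSubsets
  open DualPairs F
  open Space F
  open Arcs F
  open MaximalArcs F

  module NoMaximalArc (3<q : 3 < q) {M : ℕ} (N≡ : suc (suc M) ≡ 2 ℕ.* q ℕ.+ 3) (p : Fin (suc (suc M)) → V) (arc : IsArc p) where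
    open IsArc arc
    open MaximalArc N≡ p arc

    a : V
    a = p zero

    oa : On a
    oa = On-point zero

    -- Each point other than a has a unique representative v such that a + v is again a point.
    U : V → Set
    U v = On v × On (a ⊕ v) × ¬ a ×ᵛ v ≡ 𝟎

    ×-reflect : ∀ v → a ×ᵛ ⊖ (a ⊕ v) ≡ ⊖ (a ×ᵛ v)
    ×-reflect v = trans (×-⊖ʳ a (a ⊕ v)) (cong ⊖_ (trans (×-⊕ʳ a a v) (trans (cong (_⊕ (a ×ᵛ v)) (×-self a)) (𝟎⊕ _))))

    ⊖-involutive : ∀ v → ⊖ ⊖ v ≡ v
    ⊖-involutive v = trans (⊖≡-1· (⊖ v)) (trans (cong ((- 1#) ·_) (⊖≡-1· v)) (trans (·-assoc (- 1#) (- 1#) v)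
      (trans (cong (_· v) (trans (solve 1 (λ o → :- o :* :- o := o :* o) refl 1#) (*-identityˡ 1#))) (1· v))))

    ⊖-≢𝟎 : ∀ {v} → ¬ v ≡ 𝟎 → ¬ ⊖ v ≡ 𝟎
    ⊖-≢𝟎 {v} v≢𝟎 e = v≢𝟎 (·-cancel (-‿≢0 1≢0) (trans (sym (⊖≡-1· v)) e))

    U-reflect : ∀ {v} → U v → U (⊖ (a ⊕ v))
    U-reflect {v} (ov , oav , a∦v) = On-⊖ oav , subst On (sym (cancel-reflection a v)) (On-⊖ ov) , λ e → ⊖-≢𝟎 a∦v (trans (sym (×-reflect v)) e)

    det-neg : ∀ u v w → det u v (⊖ w) ≡ - det u v w
    det-neg u v w = dot-⊖ʳ (u ×ᵛ v) w

    det-neg-sumʳ : ∀ u v w → det u v (⊖ (u ⊕ w)) ≡ - det u v w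
    det-neg-sumʳ u v w = trans (det-neg u v (u ⊕ w)) (cong -_ (trans (det-sum u v u w) (trans (cong (_+ det u v w) (det-repeat₁ u v)) (+-identityˡ _))))

    -- Two uses of `sum-On`: for `a`, `v`, `w` it makes v + w a point, and for `v`, `a`, - (v + w)
    -- it makes a - (v + w) a point, because v - (v + w) = - w is one.
    U-sum : ∀ {v w} → U v → U w → ¬ det a v w ≡ 0# → U (⊖ (v ⊕ w))
    U-sum {v} {w} (ov , oav , a∦v) (ow , oaw , a∦w) D≢0 = On-⊖ ovw , reflected , a∦
      where
      ovw : On (v ⊕ w)
      ovw = sum-On D≢0 oa ov ow oav oaw
      D′≢0 : ¬ det v a (⊖ (v ⊕ w)) ≡ 0#
      D′≢0 e = D≢0 (begin
        det a v w                 ≡⟨ det-cycle a v w ⟩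
        det v w a                 ≡⟨ det-swap v a w ⟩
        - det v a w               ≡⟨ sym (det-neg-sumʳ v a w) ⟩
        det v a (⊖ (v ⊕ w))       ≡⟨ e ⟩
        0#                        ∎)
        where open ≡-Reasoning
      reflected : On (a ⊕ ⊖ (v ⊕ w))
      reflected = sum-On D′≢0 ov oa (On-⊖ ovw) (subst On (⊕-comm a v) oav) (subst On (sym (cancel-reflection v w)) (On-⊖ ow))
      a∦ : ¬ a ×ᵛ ⊖ (v ⊕ w) ≡ 𝟎
      a∦ e = D≢0 (begin
        det a v w                 ≡⟨ sym (trans (cong (det a v w +_) (det-repeat₂ a w)) (+-identityʳ _)) ⟩
        det a v w + det a w w     ≡⟨ sym (dot-⊕ˡ (a ×ᵛ v) (a ×ᵛ w) w) ⟩
        dot (a ×ᵛ v ⊕ a ×ᵛ w) w   ≡⟨ cong (λ z → dot z w) (sym (×-⊕ʳ a v w)) ⟩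
        dot (a ×ᵛ (v ⊕ w)) w      ≡⟨ cong (λ z → dot z w) (decidable-stable ((a ×ᵛ (v ⊕ w)) ≟ᵛ 𝟎) (λ h → ⊖-≢𝟎 h (trans (sym (×-⊖ʳ a (v ⊕ w))) e))) ⟩
        dot 𝟎 w                   ≡⟨ trans (cong (λ z → dot z w) (sym (0· 𝟎))) (trans (dot-·ˡ 0# 𝟎 w) (zeroˡ _)) ⟩
        0#                        ∎)
        where open ≡-Reasoning

    a∦sum : ∀ {v} → ¬ a ×ᵛ v ≡ 𝟎 → ¬ a ×ᵛ (a ⊕ v) ≡ 𝟎
    a∦sum {v} a∦v e = a∦v (trans (sym (trans (×-⊕ʳ a a v) (trans (cong (_⊕ (a ×ᵛ v)) (×-self a)) (𝟎⊕ _)))) e)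

    v∦sum : ∀ {v} → ¬ a ×ᵛ v ≡ 𝟎 → ¬ v ×ᵛ (a ⊕ v) ≡ 𝟎
    v∦sum {v} a∦v e = a∦v (×-𝟎ˡ-sym (trans (sym (trans (×-⊕ʳ v a v) (trans (cong ((v ×ᵛ a) ⊕_) (×-self v)) (⊕𝟎 _)))) e))

    on-line : ∀ {v x} → U v → On x → det a v x ≡ 0# → a ×ᵛ x ≡ 𝟎 ⊎ v ×ᵛ x ≡ 𝟎 ⊎ (a ⊕ v) ×ᵛ x ≡ 𝟎
    on-line {v} {x} (ov , oav , a∦v) ox on = fourth-point a∦v oa ov oav ox (det-repeat₁ a v) (det-repeat₂ a v)
      (trans (det-sum a v a v) (trans (cong₂ _+_ (det-repeat₁ a v) (det-repeat₂ a v)) (+-identityˡ 0#))) on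
      a∦v (a∦sum a∦v) (v∦sum a∦v)

    -- For w = l v, the point a + l v is distinct from `a` and `v`, so it is the third point a + v
    -- of their line and l = 1.
    U-parallel : ∀ {v w} → U v → U w → v ×ᵛ w ≡ 𝟎 → v ≡ w
    U-parallel {v} {w} Uv@(ov , oav , a∦v) (ow , oaw , a∦w) v∥w = from-multiple (parallel (On-≢𝟎 ov) v∥w)
      where
      from-multiple : (∃ λ l → w ≡ l · v) → v ≡ w
      from-multiple (l , w≡lv) = cases (on-line Uv oaw on)
        where
        on : det a v (a ⊕ w) ≡ 0#
        on = trans (det-sum a v a w) (trans (cong₂ _+_ (det-repeat₁ a v)
          (trans (cong (det a v) w≡lv) (trans (dot-·ʳ (a ×ᵛ v) l v) (trans (cong (l *_) (det-repeat₂ a v)) (zeroʳ l))))) (+-identityˡ 0#))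
        cases : a ×ᵛ (a ⊕ w) ≡ 𝟎 ⊎ v ×ᵛ (a ⊕ w) ≡ 𝟎 ⊎ (a ⊕ v) ×ᵛ (a ⊕ w) ≡ 𝟎 → v ≡ w
        cases (inj₁ e) = ⊥-elim (a∦sum a∦w e)
        cases (inj₂ (inj₁ e)) = ⊥-elim (a∦v (×-𝟎ˡ-sym (trans (sym (×-pencil a l v)) (trans (cong (λ z → v ×ᵛ (a ⊕ z)) (sym w≡lv)) e))))
        cases (inj₂ (inj₂ e)) = sym (trans w≡lv (trans (cong (_· v) l≡1) (1· v)))
          where
          l≡1 : l ≡ 1#
          l≡1 = decidable-stable (l ≟ 1#) (λ l≢1 → a∦v (·-cancel (λ h → l≢1 (x-y≡0⇒x≡y h))
            (trans (sym (×-sum-multiple a v l)) (trans (cong (λ z → (a ⊕ v) ×ᵛ (a ⊕ z)) (sym w≡lv)) e))))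

    U-on-line : ∀ {v w} → U v → U w → det a v w ≡ 0# → w ≡ v ⊎ w ≡ ⊖ (a ⊕ v)
    U-on-line {v} {w} Uv Uw@(ow , _ , a∦w) on = cases (on-line Uv ow on)
      where
      cases : a ×ᵛ w ≡ 𝟎 ⊎ v ×ᵛ w ≡ 𝟎 ⊎ (a ⊕ v) ×ᵛ w ≡ 𝟎 → w ≡ v ⊎ w ≡ ⊖ (a ⊕ v)
      cases (inj₁ e) = ⊥-elim (a∦w e)
      cases (inj₂ (inj₁ e)) = inj₁ (sym (U-parallel Uv Uw e))
      cases (inj₂ (inj₂ e)) = inj₂ (U-parallel Uw (U-reflect Uv) (trans (×-⊖ʳ w (a ⊕ v)) (trans (cong ⊖_ (×-𝟎ˡ-sym e)) ⊖𝟎)))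

    representative : ∀ i → ∃ λ v → U v × (v ×ᵛ p (suc i) ≡ 𝟎)
    representative i = from-third (third-point oa (On-point (suc i)) (independent (λ ())))
      where
      from-third : (∃ λ ν → ¬ ν ≡ 0# × On (a ⊕ ν · p (suc i))) → ∃ λ v → U v × (v ×ᵛ p (suc i) ≡ 𝟎)
      from-third (ν , ν≢0 , on) = ν · p (suc i) , (On-scale ν≢0 (On-point (suc i)) , on ,
          λ e → independent {zero} {suc i} (λ ()) (·-cancel ν≢0 (trans (sym (×-·ʳ a ν (p (suc i)))) e))) ,
        ×-𝟎ˡ-sym (trans (×-·ʳ (p (suc i)) ν (p (suc i))) (trans (cong (ν ·_) (×-self _)) (·𝟎 ν)))

    rep : Fin (suc M) → V
    rep i = proj₁ (representative i)

    U-rep : ∀ i → U (rep i)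
    U-rep i = proj₁ (proj₂ (representative i))

    rep∥ : ∀ i → rep i ×ᵛ p (suc i) ≡ 𝟎
    rep∥ i = proj₂ (proj₂ (representative i))

    rep-injective : ∀ {i j} → rep i ≡ rep j → i ≡ j
    rep-injective {i} {j} e = suc-injective (same-point (parallel-trans (On-≢𝟎 (proj₁ (U-rep i))) (×-𝟎ˡ-sym (rep∥ i))
      (trans (cong (_×ᵛ p (suc j)) e) (rep∥ j))))

    rep-surjective : ∀ {v} → U v → ∃ λ i → rep i ≡ v
    rep-surjective {v} Uv@(ov@(j , _) , _ , a∦v) = cases j refl
      where
      cases : ∀ j → proj₁ ov ≡ j → ∃ λ i → rep i ≡ v
      cases zero    e = ⊥-elim (a∦v (same-index oa ov (sym e)))
      cases (suc i) e = i , U-parallel (U-rep i) Uv (parallel-trans (point≢𝟎 (suc i)) (rep∥ i) (same-index (On-point (suc i)) ov (sym e)))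

    -- With `rep` as a parameter, what follows depends only on the bijection between indices and
    -- normalised vectors, not on its construction.
    module Fibres (rep : Fin (suc M) → V) (U-rep : ∀ i → U (rep i)) (rep-injective : ∀ {i j} → rep i ≡ rep j → i ≡ j)
                  (rep-surjective : ∀ {v} → U v → ∃ λ i → rep i ≡ v) where
      b : V
      b = rep zero

      Ub : U b
      Ub = U-rep zero

      f : V → Carrier
      f v = det a b v

      f-sum : ∀ u v → f (u ⊕ v) ≡ f u + f v
      f-sum = det-sum a b

      f-neg : ∀ v → f (⊖ v) ≡ - f v
      f-neg = det-neg a b

      fa : f a ≡ 0#
      fa = det-repeat₁ a b

      fb : f b ≡ 0#
      fb = det-repeat₂ a b

      f-reflect : ∀ v → f (⊖ (a ⊕ v)) ≡ - f v
      f-reflect v = trans (f-neg (a ⊕ v)) (cong -_ (trans (f-sum a v) (trans (cong (_+ f v) fa) (+-identityˡ _))))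

      -- The composite of the reflections v ↦ − a − v and v ↦ − u − v.
      U-translate : ∀ {u v} → U u → U v → ¬ det a u v ≡ 0# → U (v ⊕ (a ⊕ ⊖ u))
      U-translate {u} {v} Uu Uv D≢0 = subst U (two-reflections u a v) (U-sum Uu (U-reflect Uv)
        (λ e → -‿≢0 D≢0 (trans (sym (det-neg-sumʳ a u v)) e)))

      -- Translating `w` by a - v works unless `w` is on the line through `a` and `v`. In that case
      -- `w` is first translated by a - b, which keeps its value and moves it off that line since
      -- `f v` is nonzero.
      difference : ∀ {v w} → U v → U w → ¬ f v ≡ 0# → ¬ f w ≡ 0# → ∃ λ u → U u × f u ≡ f w + - f v
      difference {v} {w} Uv Uw fv≢0 fw≢0 = by-cases (det a v w ≟ 0#)
        where
        open ≡-Reasoning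
        value : ∀ w → f (w ⊕ (a ⊕ ⊖ v)) ≡ f w + - f v
        value w = trans (f-sum w (a ⊕ ⊖ v)) (cong (f w +_) (trans (f-sum a (⊖ v)) (trans (cong₂ _+_ fa (f-neg v)) (+-identityˡ _))))
        w′ = w ⊕ (a ⊕ ⊖ b)
        fw′ : f w′ ≡ f w
        fw′ = trans (f-sum w (a ⊕ ⊖ b)) (trans (cong (f w +_) (trans (f-sum a (⊖ b)) (trans (cong₂ _+_ fa (trans (f-neg b) (trans (cong -_ fb) -0#≈0#))) (+-identityˡ _)))) (+-identityʳ _))
        by-cases : Dec (det a v w ≡ 0#) → ∃ λ u → U u × f u ≡ f w + - f v
        by-cases (no D≢0) = w ⊕ (a ⊕ ⊖ v) , U-translate Uv Uw D≢0 , value w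
        by-cases (yes D≡0) = w′ ⊕ (a ⊕ ⊖ v) , U-translate Uv (U-translate Ub Uw fw≢0) D≢0 , trans (value w′) (cong (_+ - f v) fw′)
          where
          D≢0 : ¬ det a v w′ ≡ 0#
          D≢0 e = fv≢0 (begin
            f v                                                  ≡⟨ sym (-‿involutive _) ⟩
            - - f v                                              ≡⟨ cong -_ (sym (det-swap a b v)) ⟩
            - det a v b                                          ≡⟨ sym (det-neg a v b) ⟩
            det a v (⊖ b)                                        ≡⟨ sym (trans (det-sum a v a (⊖ b)) (trans (cong (_+ det a v (⊖ b)) (det-repeat₁ a v)) (+-identityˡ _))) ⟩
            det a v (a ⊕ ⊖ b)                                    ≡⟨ sym (trans (det-sum a v w (a ⊕ ⊖ b)) (trans (cong (_+ det a v (a ⊕ ⊖ b)) D≡0) (+-identityˡ _))) ⟩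
            det a v w′                                           ≡⟨ e ⟩
            0#                                                   ∎)

      fibre : Carrier → Sub (suc M)
      fibre y i = is0 (f (rep i) + - y)

      fib : Carrier → ℕ
      fib y = size (fibre y)

      fibre-value : ∀ {y i} → fibre y i ≡ true → f (rep i) ≡ y
      fibre-value h = x-y≡0⇒x≡y (true⇒0 h)

      fibre-member : ∀ {y i} → f (rep i) ≡ y → fibre y i ≡ true
      fibre-member {y} e = is0-true (trans (cong (_+ - y) e) (-‿inverseʳ y))

      U-fibre : ∀ {y v} → U v → f v ≡ y → ∃ λ i → rep i ≡ v × fibre y i ≡ true
      U-fibre Uv fv = let i , e = rep-surjective Uv in i , e , fibre-member (trans (cong f e) fv)

      fib-empty-or-U : ∀ y → fib y ≡ 0 ⊎ (∃ λ v → U v × f v ≡ y)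
      fib-empty-or-U y = cases (fib y) refl
        where
        cases : ∀ m → fib y ≡ m → fib y ≡ 0 ⊎ (∃ λ v → U v × f v ≡ y)
        cases zero    e = inj₁ e
        cases (suc m) e = let i , h = inhabited (fibre y) (subst (0 <_) (sym e) (s≤s z≤n)) in inj₂ (rep i , U-rep i , fibre-value h)

      U-fib≢0 : ∀ {y v} → U v → f v ≡ y → ¬ fib y ≡ 0
      U-fib≢0 {y} Uv fv e = let i , _ , h = U-fibre Uv fv in <-irrefl refl (subst (1 ≤_) e (member-size (fibre y) h))

      distinct-index : ∀ {i j u v} → rep i ≡ u → rep j ≡ v → ¬ v ≡ u → ¬ j ≡ i
      distinct-index e e′ v≢u refl = v≢u (trans (sym e′) e)

      f-translate : ∀ {u} v → f u ≡ 0# → f (v ⊕ (a ⊕ ⊖ u)) ≡ f v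
      f-translate {u} v fu = trans (f-sum v (a ⊕ ⊖ u)) (trans (cong (f v +_) (trans (f-sum a (⊖ u))
        (trans (cong₂ _+_ fa (trans (f-neg u) (trans (cong -_ fu) -0#≈0#))) (+-identityˡ _)))) (+-identityʳ _))

      a∦b : ¬ a ×ᵛ b ≡ 𝟎
      a∦b = proj₂ (proj₂ Ub)

      b∦a : ¬ b ×ᵛ a ≡ 𝟎
      b∦a e = a∦b (×-𝟎ˡ-sym e)

      b′ : V
      b′ = ⊖ (a ⊕ b)

      Ub′ : U b′
      Ub′ = U-reflect Ub

      fb′ : f b′ ≡ 0#
      fb′ = trans (f-reflect b) (trans (cong -_ fb) -0#≈0#)

      b≢b′ : ¬ b′ ≡ b
      b≢b′ e = v∦sum a∦b (decidable-stable ((b ×ᵛ (a ⊕ b)) ≟ᵛ 𝟎) (λ h → ⊖-≢𝟎 h (trans (sym (×-⊖ʳ b (a ⊕ b))) (trans (cong (b ×ᵛ_) e) (×-self b)))))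

      -- The translations by a - b and a - b′ = 2a + b keep the value. They move `v`, and to
      -- different places, since these vectors and their difference a + 2b are nonzero by
      -- independence of `a` and `b`.
      fib-lower : ∀ {v} → U v → ¬ f v ≡ 0# → 3 ≤ fib (f v)
      fib-lower {v} Uv fv≢0 = size-3 (fibre (f v)) (proj₂ (proj₂ I)) (proj₂ (proj₂ I₁)) (proj₂ (proj₂ I₂))
          (distinct-index (proj₁ (proj₂ I)) (proj₁ (proj₂ I₁)) v₁≢v)
          (distinct-index (proj₁ (proj₂ I)) (proj₁ (proj₂ I₂)) v₂≢v)
          (distinct-index (proj₁ (proj₂ I₁)) (proj₁ (proj₂ I₂)) v₂≢v₁)
        where
        open ≡-Reasoning
        v₁ v₂ : V
        v₁ = v ⊕ (a ⊕ ⊖ b)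
        v₂ = v ⊕ (a ⊕ ⊖ b′)
        D′≢0 : ¬ det a b′ v ≡ 0#
        D′≢0 e = -‿≢0 fv≢0 (begin
          - f v                           ≡⟨ sym (det-swap a b v) ⟩
          det a v b                       ≡⟨ sym (-‿involutive _) ⟩
          - - det a v b                   ≡⟨ cong -_ (sym (det-neg-sumʳ a v b)) ⟩
          - det a v b′                    ≡⟨ cong -_ (trans (det-swap a b′ v) (trans (cong -_ e) -0#≈0#)) ⟩
          - 0#                            ≡⟨ -0#≈0# ⟩
          0#                              ∎)
        I = U-fibre Uv refl
        I₁ = U-fibre (U-translate Ub Uv fv≢0) (f-translate v fb)
        I₂ = U-fibre (U-translate Ub′ Uv D′≢0) (f-translate v fb′)
        v₁≢v : ¬ v₁ ≡ v
        v₁≢v e = b∦a (trans (sym (b×shift (⊖ b) (trans (×-⊖ʳ b b) (trans (cong ⊖_ (×-self b)) ⊖𝟎)))) (trans (cong (b ×ᵛ_) (translate-fixed v _ e)) (×-𝟎ʳ b)))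
          where
          b×shift : ∀ u → b ×ᵛ u ≡ 𝟎 → b ×ᵛ (a ⊕ u) ≡ b ×ᵛ a
          b×shift u h = trans (×-⊕ʳ b a u) (trans (cong ((b ×ᵛ a) ⊕_) h) (⊕𝟎 _))
        v₂≢v : ¬ v₂ ≡ v
        v₂≢v e = a∦b (begin
          a ×ᵛ b                          ≡⟨ sym (trans (×-⊕ʳ a a b) (trans (cong (_⊕ (a ×ᵛ b)) (×-self a)) (𝟎⊕ _))) ⟩
          a ×ᵛ (a ⊕ b)                    ≡⟨ sym (trans (×-⊖ʳ a b′) (trans (cong ⊖_ (×-⊖ʳ a (a ⊕ b))) (⊖-involutive _))) ⟩
          a ×ᵛ ⊖ b′                       ≡⟨ sym (trans (×-⊕ʳ a a (⊖ b′)) (trans (cong (_⊕ (a ×ᵛ ⊖ b′)) (×-self a)) (𝟎⊕ _))) ⟩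
          a ×ᵛ (a ⊕ ⊖ b′)                 ≡⟨ cong (a ×ᵛ_) (translate-fixed v _ e) ⟩
          a ×ᵛ 𝟎                          ≡⟨ ×-𝟎ʳ a ⟩
          𝟎                               ∎)
        v₂≢v₁ : ¬ v₂ ≡ v₁
        v₂≢v₁ e = b∦a (begin
          b ×ᵛ a                          ≡⟨ sym (⊕𝟎 _) ⟩
          b ×ᵛ a ⊕ 𝟎                      ≡⟨ cong (b ×ᵛ a ⊕_) (sym (trans (×-⊕ʳ b b b) (trans (cong₂ _⊕_ (×-self b) (×-self b)) (⊕𝟎 𝟎)))) ⟩
          b ×ᵛ a ⊕ b ×ᵛ (b ⊕ b)           ≡⟨ sym (×-⊕ʳ b a (b ⊕ b)) ⟩
          b ×ᵛ (a ⊕ (b ⊕ b))              ≡⟨ cong (b ×ᵛ_) (translate-fixed v₁ _ (trans (sym (second-translate v a b)) e)) ⟩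
          b ×ᵛ 𝟎                          ≡⟨ ×-𝟎ʳ b ⟩
          𝟎                               ∎)

      at-rep : V → Sub (suc M)
      at-rep u i = does (rep i ≟ᵛ u)

      at-rep≤1 : ∀ u → size (at-rep u) ≤ 1
      at-rep≤1 u = size-≤1 (at-rep u) (λ {i} {j} h h′ → rep-injective (trans (from-does (rep i ≟ᵛ u) h) (sym (from-does (rep j ≟ᵛ u) h′))))

      size-two : ∀ (S : Sub (suc M)) u v → (∀ i → S i ≡ true → rep i ≡ u ⊎ rep i ≡ v) → size S ≤ 2
      size-two S u v h = ≤-trans (size-mono {S = S} {T = λ i → at-rep u i ∨ at-rep v i} included)
        (≤-trans (size-∨ (at-rep u) (at-rep v)) (+-mono-≤ (at-rep≤1 u) (at-rep≤1 v)))
        where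
        included : ∀ i → S i ≡ true → at-rep u i ∨ at-rep v i ≡ true
        included i Si with h i Si
        ... | inj₁ e = trueˡ (dec-true (rep i ≟ᵛ u) e)
          where
          trueˡ : ∀ {x y} → x ≡ true → x ∨ y ≡ true
          trueˡ refl = refl
        ... | inj₂ e = trueʳ (at-rep u i) (dec-true (rep i ≟ᵛ v) e)
          where
          trueʳ : ∀ x {y} → y ≡ true → x ∨ y ≡ true
          trueʳ true  _ = refl
          trueʳ false e = e

      fib-0-upper : fib 0# ≤ 2
      fib-0-upper = size-two (fibre 0#) b b′ (λ i h → U-on-line Ub (U-rep i) (fibre-value h))

      fib-0-lower : 2 ≤ fib 0#
      fib-0-lower = let i , e , h = U-fibre Ub fb; j , e′ , h′ = U-fibre Ub′ fb′ in size-2 (fibre 0#) h h′ (distinct-index e e′ b≢b′)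

      -- Fix `v` in the fibre. At most two members lie on the line through `a` and `v`; translating
      -- any other by a - v gives a vector of value zero, that is `b` or `b′`.
      fib-upper : ∀ {y} → fib y ≤ 4
      fib-upper {y} = [ (λ e → ≤-trans (≤-reflexive e) z≤n) , bound ]′ (fib-empty-or-U y)
        where
        bound : (∃ λ v → U v × f v ≡ y) → fib y ≤ 4
        bound (v , Uv , fv) = ≤-trans (size-mono {S = fibre y} {T = λ i → (fibre y i ∧ coll i) ∨ (fibre y i ∧ not (coll i))} (λ i → split (fibre y i) (coll i)))
          (≤-trans (size-∨ (λ i → fibre y i ∧ coll i) (λ i → fibre y i ∧ not (coll i))) (+-mono-≤
            (size-two (λ i → fibre y i ∧ coll i) v (⊖ (a ⊕ v)) (λ i h → U-on-line Uv (U-rep i) (true⇒0 (∧-trueʳ {fibre y i} h))))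
            (size-two (λ i → fibre y i ∧ not (coll i)) (v ⊕ (b ⊕ ⊖ a)) (v ⊕ (b′ ⊕ ⊖ a)) not-collinear)))
          where
          coll : Sub (suc M)
          coll i = is0 (det a v (rep i))
          split : ∀ x y → x ≡ true → (x ∧ y) ∨ (x ∧ not y) ≡ true
          split true true  _ = refl
          split true false _ = refl
          not-collinear : ∀ i → fibre y i ∧ not (coll i) ≡ true → rep i ≡ v ⊕ (b ⊕ ⊖ a) ⊎ rep i ≡ v ⊕ (b′ ⊕ ⊖ a)
          not-collinear i h = [ (λ e → inj₁ (translate-difference v a (rep i) b e)) , (λ e → inj₂ (translate-difference v a (rep i) b′ e)) ]′
            (U-on-line Ub (U-translate Uv (U-rep i) (false⇒≢0 (not-true (∧-trueʳ {fibre y i} h)))) f≡0)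
            where
            f≡0 : f (rep i ⊕ (a ⊕ ⊖ v)) ≡ 0#
            f≡0 = trans (f-sum (rep i) (a ⊕ ⊖ v)) (trans (cong₂ _+_ (fibre-value (∧-trueˡ h))
              (trans (f-sum a (⊖ v)) (trans (cong₂ _+_ fa (trans (f-neg v) (cong -_ fv))) (+-identityˡ _)))) (-‿inverseʳ y))

      sum-fib : ∀ z → sum (λ l → fib (elt l + z)) ≡ suc M
      sum-fib z = trans (∑-comm (λ l i → 𝟙 (fibre (elt l + z) i))) (trans
        (sum-cong-≗ (λ i → count-solutions {λ y → is0 (f (rep i) + - (y + z))} (f (rep i) + - z)
          (is0-true (solve 2 (λ x z → x :+ :- (x :+ :- z :+ z) := con (ℤ.+ 0)) refl (f (rep i)) z))
          (λ y h → trans (solve 2 (λ y z → y := y :+ z :+ :- z) refl y z) (cong (_+ - z) (sym (x-y≡0⇒x≡y (true⇒0 h)))))))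
        (trans (sum-const (suc M) 1) (ℕₚ.*-identityʳ (suc M))))

      sum-zero : ∀ z → size (λ l → is0 (elt l + z)) ≡ 1
      sum-zero z = count-solutions {λ y → is0 (y + z)} (- z) (is0-true (-‿inverseˡ z))
        (λ y h → x-y≡0⇒x≡y (trans (cong (y +_) (-‿involutive z)) (true⇒0 h)))

      -- The fibre over 0 has 2 elements; it is topped up to 4, the bound for the other fibres.
      fib⁺ : Carrier → ℕ
      fib⁺ y = fib y ℕ.+ 2 ℕ.* 𝟙 (is0 y)

      sum-fib⁺ : ∀ z → sum (λ l → fib⁺ (elt l + z)) ≡ suc M ℕ.+ 2
      sum-fib⁺ z = trans (∑-distrib-+ (λ l → fib (elt l + z)) (λ l → 2 ℕ.* 𝟙 (is0 (elt l + z))))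
        (cong₂ ℕ._+_ (sum-fib z) (trans (sum-*ˡ 2 (λ l → 𝟙 (is0 (elt l + z)))) (cong (2 ℕ.*_) (sum-zero z))))

      fib⁺-≢0 : ∀ {y} → ¬ y ≡ 0# → fib⁺ y ≡ fib y
      fib⁺-≢0 {y} y≢0 = trans (cong (λ c → fib y ℕ.+ 2 ℕ.* 𝟙 c) (is0-false y≢0)) (ℕₚ.+-identityʳ _)

      fib⁺-0 : ∀ {y} → y ≡ 0# → fib⁺ y ≤ 4
      fib⁺-0 refl = +-mono-≤ fib-0-upper (≤-reflexive (cong (λ c → 2 ℕ.* 𝟙 c) (is0-true {0#} refl)))

      -- The values of f on U, together with 0, form a subgroup of F; it has more than q / 2 elements.
      no-gap : ∀ {z} → ¬ z ≡ 0# → ¬ fib z ≡ 0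
      no-gap {z} z≢0 fz = <-irrefl refl (begin-strict
          q ℕ.* 4                                                          <⟨ bound ⟩
          (suc M ℕ.+ 2) ℕ.+ (suc M ℕ.+ 2)                                  ≡⟨ cong₂ ℕ._+_ (sym (sum-fib⁺ 0#)) (sym (sum-fib⁺ z)) ⟩
          sum (λ l → fib⁺ (elt l + 0#)) ℕ.+ sum (λ l → fib⁺ (elt l + z))   ≡⟨ sym (∑-distrib-+ (λ l → fib⁺ (elt l + 0#)) (λ l → fib⁺ (elt l + z))) ⟩
          -- If y and y + z were both values, so would be their difference z. Hence one member of
          -- each pair contributes nothing. As `difference` requires nonzero values, the pairs
          -- containing 0 are treated apart.
          sum (λ l → fib⁺ (elt l + 0#) ℕ.+ fib⁺ (elt l + z))               ≤⟨ sum-≤-const 4 (λ l → subst (λ y → fib⁺ y ℕ.+ fib⁺ (elt l + z) ≤ 4) (sym (+-identityʳ (elt l))) (term (elt l) (elt l ≟ 0#) ((elt l + z) ≟ 0#))) ⟩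
          q ℕ.* 4                                                          ∎)
        where
        open ℕₚ.≤-Reasoning
        bound : q ℕ.* 4 < (suc M ℕ.+ 2) ℕ.+ (suc M ℕ.+ 2)
        bound = subst (λ m → q ℕ.* 4 < (m ℕ.+ 2) ℕ.+ (m ℕ.+ 2)) (sym (cong ℕ.pred (trans N≡ (+-suc (2 ℕ.* q) 2))))
          (≤-trans (m≤m+n _ 7) (≤-reflexive (id₁ q)))
          where
          id₁ : ∀ q → suc (q ℕ.* 4) ℕ.+ 7 ≡ (2 ℕ.* q ℕ.+ 2 ℕ.+ 2) ℕ.+ (2 ℕ.* q ℕ.+ 2 ℕ.+ 2)
          id₁ = solve-∀
        at-most : ∀ {m n} → m ≤ 4 → n ≡ 0 → m ℕ.+ n ≤ 4
        at-most {m} m≤4 refl = ≤-trans (≤-reflexive (ℕₚ.+-identityʳ m)) m≤4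
        at-most′ : ∀ {m n} → m ≡ 0 → n ≤ 4 → m ℕ.+ n ≤ 4
        at-most′ refl n≤4 = n≤4
        term : ∀ y → Dec (y ≡ 0#) → Dec (y + z ≡ 0#) → fib⁺ y ℕ.+ fib⁺ (y + z) ≤ 4
        term y (yes y≡0) _ = at-most (fib⁺-0 y≡0) (trans (cong fib⁺ (trans (cong (_+ z) y≡0) (+-identityˡ z))) (trans (fib⁺-≢0 z≢0) fz))
        term y (no y≢0) (yes yz≡0) = at-most′ (trans (fib⁺-≢0 y≢0) fy) (fib⁺-0 yz≡0)
          where
          fy : fib y ≡ 0
          fy = [ (λ e → e) , (λ { (v , Uv , fv) → ⊥-elim (U-fib≢0 (U-reflect Uv)
            (trans (f-reflect v) (trans (cong -_ fv) (x-y≡0⇒x≡y (trans (solve 2 (λ y z → :- y :+ :- z := :- (y :+ z)) refl y z) (trans (cong -_ yz≡0) -0#≈0#))))) fz) }) ]′ (fib-empty-or-U y)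
        term y (no y≢0) (no yz≢0) = [ (λ e → at-most′ (trans (fib⁺-≢0 y≢0) e) fyz≤4) ,
            (λ { (v , Uv , fv) → [ (λ e → at-most fy≤4 (trans (fib⁺-≢0 yz≢0) e)) ,
              (λ { (w , Uw , fw) → ⊥-elim (gap v w Uv Uw fv fw) }) ]′ (fib-empty-or-U (y + z)) }) ]′ (fib-empty-or-U y)
          where
          fyz≤4 : fib⁺ (y + z) ≤ 4
          fyz≤4 = ≤-trans (≤-reflexive (fib⁺-≢0 yz≢0)) fib-upper
          fy≤4 : fib⁺ y ≤ 4
          fy≤4 = ≤-trans (≤-reflexive (fib⁺-≢0 y≢0)) fib-upper
          gap : ∀ v w → U v → U w → f v ≡ y → f w ≡ y + z → ⊥
          gap v w Uv Uw fv fw with u , Uu , fu ← difference Uv Uw (λ e → y≢0 (trans (sym fv) e)) (λ e → yz≢0 (trans (sym fw) e)) =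
            U-fib≢0 Uu (trans fu (trans (cong₂ (λ s t → s + - t) fw fv) (solve 2 (λ y z → y :+ z :+ :- y := z) refl y z))) fz

      -- All values occur, so with one unit added at 0 each of the q fibres counts at least 3, and
      -- 3q ≤ 2q + 3.
      contradiction : ⊥
      contradiction = <-irrefl refl (begin-strict
          suc M ℕ.+ 1                                                      <⟨ bound ⟩
          q ℕ.* 3                                                          ≤⟨ const-≤-sum 3 (λ l → subst (λ y → 3 ≤ fib y ℕ.+ 𝟙 (is0 y)) (sym (+-identityʳ (elt l))) (term (elt l) (elt l ≟ 0#))) ⟩
          sum (λ l → fib (elt l + 0#) ℕ.+ 𝟙 (is0 (elt l + 0#)))            ≡⟨ ∑-distrib-+ (λ l → fib (elt l + 0#)) (λ l → 𝟙 (is0 (elt l + 0#))) ⟩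
          sum (λ l → fib (elt l + 0#)) ℕ.+ size (λ l → is0 (elt l + 0#))   ≡⟨ cong₂ ℕ._+_ (sum-fib 0#) (sum-zero 0#) ⟩
          suc M ℕ.+ 1                                                      ∎)
        where
        open ℕₚ.≤-Reasoning
        bound : suc M ℕ.+ 1 < q ℕ.* 3
        bound = subst (λ m → m ℕ.+ 1 < q ℕ.* 3) (sym (cong ℕ.pred (trans N≡ (+-suc (2 ℕ.* q) 2))))
          (≤-trans (≤-reflexive (id₂ q)) (≤-trans (+-monoʳ-≤ (2 ℕ.* q) 3<q) (≤-reflexive (id₃ q))))
          where
          id₂ : ∀ q → suc (2 ℕ.* q ℕ.+ 2 ℕ.+ 1) ≡ 2 ℕ.* q ℕ.+ 4
          id₂ = solve-∀
          id₃ : ∀ q → 2 ℕ.* q ℕ.+ q ≡ q ℕ.* 3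
          id₃ = solve-∀
        term : ∀ y → Dec (y ≡ 0#) → 3 ≤ fib y ℕ.+ 𝟙 (is0 y)
        term y (yes refl) = +-mono-≤ fib-0-lower (≤-reflexive (cong 𝟙 (sym (is0-true {0#} refl))))
        term y (no y≢0) = [ (λ e → ⊥-elim (no-gap y≢0 e)) ,
          (λ { (v , Uv , refl) → ≤-trans (fib-lower Uv y≢0) (m≤m+n _ _) }) ]′ (fib-empty-or-U y)

    impossible : ⊥
    impossible = Fibres.contradiction rep U-rep rep-injective rep-surjective

-- From codes with both defects 1 to plane arcs.

module PlaneProjection {q : ℕ} (F : FiniteField q) where
  open FieldArithmetic F
  open FiniteSubsets
  open LinearAlgebra F
  open DualPairs F
  open CodeBounds F
  open Space F
  open Arcs F
  open ArcCompletion F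
  open NoMaximalArcs F

  no-large-arc : 3 < q → (p : Fin (2 ℕ.* q ℕ.+ 2) → V) → ¬ IsArc p
  no-large-arc 3<q p arc = no-maximal _ (+-suc (2 ℕ.* q) 2) (proj₁ completed) (proj₂ completed)
    where
    completed = Completion.completion 3<q p arc
    -- The size is made a variable in order to be matched against `suc (suc M)`.
    no-maximal : ∀ N → 2 ℕ.* q ℕ.+ 3 ≡ N → (p : Fin N → V) → IsArc p → ⊥
    no-maximal zero e p arc with () ← subst (3 ≤_) e (m≤n+m 3 (2 ℕ.* q))
    no-maximal (suc zero) e p arc with s≤s () ← subst (3 ≤_) e (m≤n+m 3 (2 ℕ.* q))
    no-maximal (suc (suc M)) e p arc = NoMaximalArc.impossible 3<q (sym e) p arc

  module Projection {n K′ r : ℕ} {C D : Code F n} (P : DualPair C D (3 ℕ.+ r) K′) (3<q : 3 < q)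
    (zeros≤K : Bounds.ZerosAtMost P (3 ℕ.+ r)) (dual≥K : Bounds.DualWeightAtLeast P (3 ℕ.+ r)) where
    open DualPair P
    open Bounds P
    open Independent dual≥K

    -- Words of C vanishing on T, a set of K − 3 positions, are the lines of a plane whose points are
    -- the remaining positions; u₁, u₂, u₃ is a basis of this subcode.
    module Frame (J : Sub n) (sizeJ : size J ≡ 2 ℕ.+ r) (i₁ i₂ : Fin n) (Ji₁ : J i₁ ≡ true) (Ji₂ : J i₂ ≡ true) (i₂≢i₁ : ¬ i₂ ≡ i₁) where
      T : Sub n
      T = J ∖ i₁ ∖ i₂

      sizeT : size T ≡ r
      sizeT = cong ℕ.pred (trans (sym (size-∖ (J ∖ i₁) (∖-true J Ji₂ i₂≢i₁))) (cong ℕ.pred (trans (sym (size-∖ J Ji₁)) sizeJ)))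

      coordinate : ∀ i → J i ≡ true → ∃ λ x → C x × (∀ l → (J ∖ i) l ≡ true → x l ≡ 0#) × ¬ x i ≡ 0#
      coordinate i Ji = coordinate-word (J ∖ i) i (∖-self J i) (≤-reflexive (trans (sym (size-∖ J Ji)) sizeJ))

      third : ∃ λ x → C x × NonZeroVec F x × (∀ l → J l ≡ true → x l ≡ 0#)
      third = vanC J (≤-reflexive (cong suc sizeJ))

      module _ (u₁ u₂ u₃ : Vect F n) (Cu₁ : C u₁) (Cu₂ : C u₂) (Cu₃ : C u₃) (i₃ : Fin n)
        (u₁-off : ∀ l → (J ∖ i₁) l ≡ true → u₁ l ≡ 0#) (u₂-off : ∀ l → (J ∖ i₂) l ≡ true → u₂ l ≡ 0#) (u₃-off : ∀ l → J l ≡ true → u₃ l ≡ 0#)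
        (u₁-diag : ¬ u₁ i₁ ≡ 0#) (u₂-diag : ¬ u₂ i₂ ≡ 0#) (u₃-i₃ : ¬ u₃ i₃ ≡ 0#) where

        point : Fin n → V
        point l = vec (u₁ l) (u₂ l) (u₃ l)

        word : V → Vect F n
        word a l = dot a (point l)

        word-expand : ∀ x y z l → word (vec x y z) l ≡ x * u₁ l + y * u₂ l + z * u₃ l
        word-expand x y z l = dot-vec x y z (u₁ l) (u₂ l) (u₃ l)

        C-word : ∀ a → C (word a)
        C-word (vec x y z) = respC (λ l → sym (trans (word-expand x y z l) (sym (cong₂ _+_ (*-identityˡ _) refl))))
          (combC (combC Cu₁ Cu₂ x y) Cu₃ 1# z)

        i₁∈ : (J ∖ i₂) i₁ ≡ true
        i₁∈ = ∖-true J Ji₁ (i₂≢i₁ ∘ sym)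
        i₂∈ : (J ∖ i₁) i₂ ≡ true
        i₂∈ = ∖-true J Ji₂ i₂≢i₁

        T⊆J : ∀ {l} → T l ≡ true → J l ≡ true
        T⊆J h = ∖⇒S J (∖⇒S (J ∖ i₁) h)
        T⊆J₁ : ∀ {l} → T l ≡ true → (J ∖ i₁) l ≡ true
        T⊆J₁ h = ∖⇒S (J ∖ i₁) h
        T⊆J₂ : ∀ {l} → T l ≡ true → (J ∖ i₂) l ≡ true
        T⊆J₂ h = ∖-true J (T⊆J h) (∖⇒≢ (J ∖ i₁) h)

        expand-zero : ∀ x y z {u v w} → u ≡ 0# → v ≡ 0# → w ≡ 0# → x * u + y * v + z * w ≡ 0#
        expand-zero x y z refl refl refl = solve 3 (λ x y z → x :* con (ℤ.+ 0) :+ y :* con (ℤ.+ 0) :+ z :* con (ℤ.+ 0) := con (ℤ.+ 0)) refl x y z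

        word-T : ∀ a l → T l ≡ true → word a l ≡ 0#
        word-T (vec x y z) l h = trans (word-expand x y z l) (expand-zero x y z (u₁-off l (T⊆J₁ h)) (u₂-off l (T⊆J₂ h)) (u₃-off l (T⊆J h)))

        word-i₁ : ∀ x y z → word (vec x y z) i₁ ≡ x * u₁ i₁
        word-i₁ x y z = trans (word-expand x y z i₁) (trans (cong₂ (λ s t → x * u₁ i₁ + y * s + z * t) (u₂-off i₁ i₁∈) (u₃-off i₁ Ji₁))
          (solve 4 (λ x y z u → x :* u :+ y :* con (ℤ.+ 0) :+ z :* con (ℤ.+ 0) := x :* u) refl x y z (u₁ i₁)))

        word-i₂ : ∀ x y z → word (vec x y z) i₂ ≡ y * u₂ i₂
        word-i₂ x y z = trans (word-expand x y z i₂) (trans (cong₂ (λ s t → x * s + y * u₂ i₂ + z * t) (u₁-off i₂ i₂∈) (u₃-off i₂ Ji₂))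
          (solve 4 (λ x y z u → x :* con (ℤ.+ 0) :+ y :* u :+ z :* con (ℤ.+ 0) := y :* u) refl x y z (u₂ i₂)))

        word-≢0 : ∀ {a} → ¬ a ≡ 𝟎 → NonZeroVec F (word a)
        word-≢0 {vec x y z} a≢𝟎 w≡0 = a≢𝟎 (vec-cong x≡0 y≡0 z≡0)
          where
          x≡0 : x ≡ 0#
          x≡0 = *-zeroˡ-cancel u₁-diag (trans (*-comm _ x) (trans (sym (word-i₁ x y z)) (w≡0 i₁)))
          y≡0 : y ≡ 0#
          y≡0 = *-zeroˡ-cancel u₂-diag (trans (*-comm _ y) (trans (sym (word-i₂ x y z)) (w≡0 i₂)))
          z≡0 : z ≡ 0#
          z≡0 = *-zeroˡ-cancel u₃-i₃ (trans (solve 4 (λ u₁ u₂ u₃ z → u₃ :* z := con (ℤ.+ 0) :* u₁ :+ con (ℤ.+ 0) :* u₂ :+ z :* u₃) refl (u₁ i₃) (u₂ i₃) (u₃ i₃) z)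
            (trans (cong₂ (λ s t → s * u₁ i₃ + t * u₂ i₃ + z * u₃ i₃) (sym x≡0) (sym y≡0)) (trans (sym (word-expand x y z i₃)) (w≡0 i₃))))

        -- Subtracting the multiples of `u₁` and `u₂` that match `w` at `i₁` and `i₂` leaves a word
        -- vanishing on all K - 1 positions of `J`, hence a multiple of `u₃`.
        spanned : ∀ {w} → C w → (∀ l → T l ≡ true → w l ≡ 0#) → ∃ λ a → ∀ l → w l ≡ word a l
        spanned {w} Cw w-T = vec x y μ , λ l → trans (rearrange l) (sym (word-expand x y μ l))
          where
          x = w i₁ * u₁ i₁ ⁻¹
          y = w i₂ * u₂ i₂ ⁻¹
          w₀ w′ : Vect F n
          w₀ l = x * u₁ l + y * u₂ l
          w′ l = 1# * w l + - 1# * w₀ l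
          Cw′ : C w′
          Cw′ = combC Cw (combC Cu₁ Cu₂ x y) 1# (- 1#)
          cancel : ∀ {s t} → s ≡ t → 1# * s + - 1# * t ≡ 0#
          cancel {s} refl = solve 2 (λ o s → o :* s :+ :- o :* s := con (ℤ.+ 0)) refl 1# s
          recover : ∀ w u → ¬ u ≡ 0# → w ≡ w * u ⁻¹ * u
          recover w u u≢0 = sym (trans (*-assoc w (u ⁻¹) u) (trans (cong (w *_) (trans (*-comm (u ⁻¹) u) (*-inverseʳ u≢0))) (*-identityʳ w)))
          w′-J : ∀ l → J l ≡ true → w′ l ≡ 0#
          w′-J l Jl with l ≟ᶠ i₁ | l ≟ᶠ i₂
          ... | yes refl | _ = cancel (trans (recover (w i₁) (u₁ i₁) u₁-diag) (sym (trans (cong (x * u₁ i₁ +_) (trans (cong (y *_) (u₂-off i₁ i₁∈)) (zeroʳ y))) (+-identityʳ _))))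
          ... | no _ | yes refl = cancel (trans (recover (w i₂) (u₂ i₂) u₂-diag) (sym (trans (cong (_+ y * u₂ i₂) (trans (cong (x *_) (u₁-off i₂ i₂∈)) (zeroʳ x))) (+-identityˡ _))))
          ... | no l≢i₁ | no l≢i₂ = cancel (trans (w-T l (∖-true (J ∖ i₁) (∖-true J Jl l≢i₁) l≢i₂)) (sym (trans (cong₂ (λ s t → x * s + y * t) (u₁-off l (∖-true J Jl l≢i₁)) (u₂-off l (∖-true J Jl l≢i₂)))
                (trans (cong₂ _+_ (zeroʳ x) (zeroʳ y)) (+-identityˡ 0#)))))
          μ = w′ i₃ * u₃ i₃ ⁻¹
          rearrange : ∀ l → w l ≡ x * u₁ l + y * u₂ l + μ * u₃ l
          rearrange l = begin
            w l                                     ≡⟨ sym (*-identityˡ (w l)) ⟩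
            1# * w l                                ≡⟨ solve 3 (λ o w v → o :* w := o :* v :+ (o :* w :+ :- o :* v)) refl 1# (w l) (w₀ l) ⟩
            1# * w₀ l + w′ l                        ≡⟨ cong₂ _+_ (*-identityˡ (w₀ l)) (vanishing-multiple J (cong suc sizeJ) Cu₃ Cw′ u₃-off w′-J u₃-i₃ l) ⟩
            w₀ l + μ * u₃ l                         ∎
            where open ≡-Reasoning

        module _ (R : Sub n) (R⊆ : ∀ l → R l ≡ true → not (T l) ≡ true) {m : ℕ} (sizeR : size R ≡ m) where
          open Enumeration (enumerate R m sizeR)

          outside : ∀ j → T (at j) ≡ false
          outside j = not-true (R⊆ (at j) (at-true j))

          -- A coordinate word that vanishes on `T` is a line of the plane. With `T` alone
          -- prescribed it shows that a point is nonzero, with one more position that two points are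
          -- distinct.
          separating : ∀ S → (∀ l → T l ≡ true → S l ≡ true) → ∀ j → S (at j) ≡ false → size S < 2 ℕ.+ r →
            ∃ λ a → (∀ l → S l ≡ true → dot a (point l) ≡ 0#) × ¬ dot a (point (at j)) ≡ 0#
          separating S T⊆S j Sj S< = from-word (coordinate-word S (at j) Sj S<)
            where
            from-word : (∃ λ w → C w × (∀ l → S l ≡ true → w l ≡ 0#) × ¬ w (at j) ≡ 0#) →
              ∃ λ a → (∀ l → S l ≡ true → dot a (point l) ≡ 0#) × ¬ dot a (point (at j)) ≡ 0#
            from-word (w , Cw , w-S , wj) = proj₁ span , (λ l h → trans (sym (proj₂ span l)) (w-S l h)) , λ e → wj (trans (proj₂ span (at j)) e)
              where span = spanned Cw (λ l h → w-S l (T⊆S l h))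

          arc : IsArc (point ∘ at)
          arc = record { point≢𝟎 = point≢𝟎 ; independent = independent ; line≤3 = line≤3 }
            where
            dot-𝟎ʳ : ∀ a → dot a 𝟎 ≡ 0#
            dot-𝟎ʳ a = trans (cong (dot a) (sym (0· 𝟎))) (trans (dot-·ʳ a 0# 𝟎) (zeroˡ _))
            point≢𝟎 : ∀ j → ¬ point (at j) ≡ 𝟎
            point≢𝟎 j e = proj₂ (proj₂ sep) (trans (cong (dot (proj₁ sep)) e) (dot-𝟎ʳ (proj₁ sep)))
              where sep = separating T (λ _ h → h) j (outside j) (s≤s (≤-trans (≤-reflexive sizeT) (n≤1+n r)))
            independent : ∀ {i j} → ¬ i ≡ j → ¬ point (at i) ×ᵛ point (at j) ≡ 𝟎
            independent {i} {j} i≢j e = proj₂ (proj₂ sep) (trans (dot-comm a (point (at j))) (parallel-dot (point≢𝟎 i) e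
                (trans (dot-comm (point (at i)) a) (proj₁ (proj₂ sep) (at i) (∪₁-new T (at i))))))
              where
              sep = separating (T ∪₁ at i) (λ l h → ∪₁-old T h) j
                (∪₁-false T (outside j) (λ h → i≢j (sym (at-inj h)))) (s≤s (≤-reflexive (trans (size-∪₁ T (outside i)) (cong suc sizeT))))
              a = proj₁ sep
            -- The corresponding word has at most 3 + r zeros, and r of them are the positions in
            -- `T`.
            line≤3 : ∀ {a} → ¬ a ≡ 𝟎 → Z (point ∘ at) a ≤ 3
            line≤3 {a} a≢𝟎 = +-cancelʳ-≤ r _ 3 (begin
              Z (point ∘ at) a ℕ.+ r                                      ≡⟨ cong₂ ℕ._+_ (size-at (zeros (word a))) (sym sizeT) ⟩
              size (λ l → R l ∧ zeros (word a) l) ℕ.+ size T              ≡⟨ sym (∑-distrib-+ (λ l → 𝟙 (R l ∧ zeros (word a) l)) (λ l → 𝟙 (T l))) ⟩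
              sum (λ l → 𝟙 (R l ∧ zeros (word a) l) ℕ.+ 𝟙 (T l))          ≤⟨ sum-mono (λ l → disjoint (R l) (T l) (zeros (word a) l) (R⊆ l) (λ h → is0-true (word-T a l h))) ⟩
              size (zeros (word a))                                       ≤⟨ zeros≤K (word a) (C-word a) (word-≢0 a≢𝟎) ⟩
              3 ℕ.+ r                                                     ∎)
              where
              open ℕₚ.≤-Reasoning
              disjoint : ∀ x t y → (x ≡ true → not t ≡ true) → (t ≡ true → y ≡ true) → 𝟙 (x ∧ y) ℕ.+ 𝟙 t ≤ 𝟙 y
              disjoint true  true  y h _ with () ← h refl
              disjoint true  false y _ _ = ≤-reflexive (ℕₚ.+-identityʳ (𝟙 y))
              disjoint false true  y _ h = ≤-reflexive (cong 𝟙 (sym (h refl)))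
              disjoint false false y _ _ = z≤n

    near-mds-bound : n ≤ 2 ℕ.* q ℕ.+ 1 ℕ.+ r
    near-mds-bound with <-≤-connex (2 ℕ.* q ℕ.+ 1 ℕ.+ r) n
    ... | inj₂ n≤ = n≤
    ... | inj₁ <n
      with J , _ , sizeJ ← subset-of-size {n} (λ _ → true) (2 ℕ.+ r) (≤-trans (n≤1+n _) (≤-trans (m≤m+n (3 ℕ.+ r) K′) (≤-reflexive (trans dims (sym (trans (sum-const n 1) (ℕₚ.*-identityʳ n)))))))
      with i₁ , Ji₁ ← inhabited J (subst (0 <_) (sym sizeJ) (s≤s z≤n))
      with i₂ , Ji₂ ← inhabited (J ∖ i₁) (subst (0 <_) (sym (cong ℕ.pred (trans (sym (size-∖ J Ji₁)) sizeJ))) (s≤s z≤n)) =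
      ⊥-elim (absurd (coordinate i₁ Ji₁) (coordinate i₂ (∖⇒S J Ji₂)) third (subset-of-size (not ∘ T) (2 ℕ.* q ℕ.+ 2) enough))
      where
      open Frame J sizeJ i₁ i₂ Ji₁ (∖⇒S J Ji₂) (∖⇒≢ J Ji₂)
      enough : 2 ℕ.* q ℕ.+ 2 ≤ size (not ∘ T)
      enough = +-cancelˡ-≤ (size T) _ _ (≤-trans (≤-reflexive (trans (cong (ℕ._+ (2 ℕ.* q ℕ.+ 2)) sizeT) (id₁ q r)))
        (≤-trans <n (≤-reflexive (sym (size-complement T)))))
        where
        id₁ : ∀ q r → r ℕ.+ (2 ℕ.* q ℕ.+ 2) ≡ suc (2 ℕ.* q ℕ.+ 1 ℕ.+ r)
        id₁ = solve-∀
      absurd : (∃ λ x → C x × (∀ l → (J ∖ i₁) l ≡ true → x l ≡ 0#) × ¬ x i₁ ≡ 0#) →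
        (∃ λ x → C x × (∀ l → (J ∖ i₂) l ≡ true → x l ≡ 0#) × ¬ x i₂ ≡ 0#) →
        (∃ λ x → C x × NonZeroVec F x × (∀ l → J l ≡ true → x l ≡ 0#)) →
        (∃ λ R → (∀ l → R l ≡ true → not (T l) ≡ true) × size R ≡ 2 ℕ.* q ℕ.+ 2) → ⊥
      absurd (u₁ , Cu₁ , u₁-off , u₁-diag) (u₂ , Cu₂ , u₂-off , u₂-diag) (u₃ , Cu₃ , u₃≢0 , u₃-off) (R , R⊆ , sizeR)
        with i₃ , u₃-i₃ ← nonZero-index u₃≢0 =
        no-large-arc 3<q _ (arc u₁ u₂ u₃ Cu₁ Cu₂ Cu₃ i₃ u₁-off u₂-off u₃-off u₁-diag u₂-diag u₃-i₃ R R⊆ sizeR)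

-- The bounds in terms of the Singleton defects.

module ParameterBounds {q : ℕ} (F : FiniteField q) where
  open FieldArithmetic F using (0#; no-zero-divisors; _≟_) renaming (_*_ to _*F_)
  open FiniteSubsets
  open LinearAlgebra F
  open DualPairs F
  open CodeBounds F
  open PlaneProjection F
  open import Data.Nat using (_+_; _*_)

  positive-weight : ∀ {n} (x : Vect F n) → 0 < wt F x → NonZeroVec F x
  positive-weight {n} x pos x≡0 = <-irrefl refl (<-≤-trans pos (≤-trans
    (wt-≤-support x (λ _ → false) (λ i _ → x≡0 i)) (≤-reflexive (trans (sum-const n 0) (*-zeroʳ n)))))

  nonzero-weight : ∀ {n} {x : Vect F n} → NonZeroVec F x → 0 < wt F x
  nonzero-weight {x = x} x≢0 = let i , xi = nonZero-index x≢0 in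
    ≤-trans (member-size (not ∘ zeros x) {i} (cong not (is0-false xi))) (≤-reflexive (sym (wt≡size x)))

  -- Here s = 1 + s′.
  module Parameters {n K K′ : ℕ} {C D : Code F n} (P : DualPair C D K K′) {d dp s′ t : ℕ}
    (minC : IsMinDist F C d) (d+s : d + suc s′ ≡ suc K′) (minD : IsMinDist F D dp) (dp+t : dp + t ≡ suc K) where
    open DualPair P
    open Bounds P

    length : n ≡ (K + s′) + d
    length = trans (sym dims) (ℕₚ.suc-injective (trans (sym (+-suc K K′)) (trans (cong (K +_) (sym d+s)) (id₁ K s′ d))))
      where
      id₁ : ∀ K s d → K + (d + suc s) ≡ suc (K + s + d)
      id₁ = solve-∀

    zeros≤ : ZerosAtMost (K + s′)
    zeros≤ x Cx x≢0 = +-cancelʳ-≤ d _ _ (≤-trans (+-monoʳ-≤ (size (zeros x)) (proj₂ minC x Cx x≢0))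
      (≤-reflexive (trans (zeros+wt x) length)))

    zeros-of-weight : ∀ (x : Vect F n) {w} → wt F x ≡ w → size (zeros x) + w ≡ (K + s′) + d
    zeros-of-weight x refl = trans (zeros+wt x) length

    private
      c₀ = proj₁ (proj₁ minC)
      Cc₀ = proj₁ (proj₂ (proj₁ minC))
      c₀≢0 = proj₁ (proj₂ (proj₂ (proj₁ minC)))

      zeros-c₀ : size (zeros c₀) ≡ K + s′
      zeros-c₀ = +-cancelʳ-≡ d _ _ (zeros-of-weight c₀ (proj₂ (proj₂ (proj₂ (proj₁ minC)))))

    -- For t > 1 the dual distance is at most K - 1, so `length-bound⁺` applies with r = K - 2 and M
    -- = K + s′.
    defect-bound : 1 < t → n + 1 ≤ suc s′ * (q + 1) + K
    defect-bound (s≤s (s≤s {n = t′} z≤n)) = bound K refl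
      where
      x₀ = proj₁ (proj₁ minD)
      x₀≢0 = proj₁ (proj₂ (proj₂ (proj₁ minD)))
      wt-x₀ : wt F x₀ ≡ dp
      wt-x₀ = proj₂ (proj₂ (proj₂ (proj₁ minD)))
      dp+ : dp + suc t′ ≡ K
      dp+ = ℕₚ.suc-injective (trans (sym (+-suc dp (suc t′))) dp+t)
      K≥2 : 2 ≤ K
      K≥2 = ≤-trans (+-mono-≤ (subst (1 ≤_) wt-x₀ (nonzero-weight x₀≢0)) (s≤s (z≤n {t′}))) (≤-reflexive dp+)
      bound : ∀ m → K ≡ m → n + 1 ≤ suc s′ * (q + 1) + K
      bound zero          e with () ← subst (2 ≤_) e K≥2
      bound (suc zero)    e with s≤s () ← subst (2 ≤_) e K≥2
      bound (suc (suc r)) e = +-cancelʳ-≤ (q * suc r) _ _ (begin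
        n + 1 + q * suc r                                   ≡⟨ id₂ n q r ⟩
        1 + (n + q * suc r)                                 ≤⟨ s≤s (length-bound⁺ zeros≤ (≤-reflexive (sym e)) (proj₁ (proj₂ (proj₁ minD))) x₀≢0 wt≤) ⟩
        1 + ((K + s′) + q * (K + s′))                       ≡⟨ cong (λ K → 1 + ((K + s′) + q * (K + s′))) e ⟩
        1 + ((suc (suc r) + s′) + q * (suc (suc r) + s′))   ≡⟨ id₃ q r s′ ⟩
        suc s′ * (q + 1) + suc (suc r) + q * suc r          ≡⟨ cong (λ K → suc s′ * (q + 1) + K + q * suc r) (sym e) ⟩
        suc s′ * (q + 1) + K + q * suc r                    ∎)
        where
        open ℕₚ.≤-Reasoning
        wt≤ : wt F x₀ ≤ suc r
        wt≤ = ≤-pred (≤-trans (≤-reflexive (cong suc wt-x₀)) (≤-trans (m≤m+n (suc dp) t′)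
          (≤-reflexive (trans (sym (+-suc dp t′)) (trans dp+ e)))))
        id₂ : ∀ n q r → n + 1 + q * suc r ≡ 1 + (n + q * suc r)
        id₂ = solve-∀
        id₃ : ∀ q r s → 1 + ((suc (suc r) + s) + q * (suc (suc r) + s)) ≡ suc s * (q + 1) + suc (suc r) + q * suc r
        id₃ = solve-∀

    -- The word has K - 2 + α zeros, of which K - 2 are made common to the pencil.
    weight-bound : ∀ {α b} → C b → NonZeroVec F b → wt F b + α ≡ d + suc s′ + 1 → 2 ≤ K → n + 2 ≤ q * (suc s′ + 1) + K + α
    weight-bound {α} {b} Cb b≢0 wt-b K≥2 with r , e ← m≤n⇒∃[o]m+o≡n K≥2 = +-cancelʳ-≤ (q * r) _ _ (begin
        n + 2 + q * r                                   ≡⟨ id₂ n q r ⟩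
        2 + (n + q * r)                                 ≤⟨ +-monoʳ-≤ 2 (length-bound zeros≤ (≤-reflexive e) Cb b≢0 (≤-trans (m≤m+n r α) (≤-reflexive (sym zeros-b)))) ⟩
        2 + (size (zeros b) + q * (K + s′))             ≡⟨ cong₂ (λ z K → 2 + (z + q * (K + s′))) zeros-b (sym e) ⟩
        2 + ((r + α) + q * (2 + r + s′))                ≡⟨ id₃ q r s′ α ⟩
        q * (suc s′ + 1) + (2 + r) + α + q * r          ≡⟨ cong (λ K → q * (suc s′ + 1) + K + α + q * r) e ⟩
        q * (suc s′ + 1) + K + α + q * r                ∎)
      where
      open ℕₚ.≤-Reasoning
      zeros-b : size (zeros b) ≡ r + α
      zeros-b = +-cancelʳ-≡ (d + suc s′ + 1) _ _ (trans (cong (size (zeros b) +_) (sym wt-b)) (trans (sym (ℕₚ.+-assoc (size (zeros b)) (wt F b) α))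
          (trans (cong (_+ α) (zeros-of-weight b refl)) (trans (cong (λ K → K + s′ + d + α) (sym e)) (id₄ r s′ d α)))))
        where
        id₄ : ∀ r s d α → 2 + r + s + d + α ≡ r + α + (d + suc s + 1)
        id₄ = solve-∀
      id₂ : ∀ n q r → n + 2 + q * r ≡ 2 + (n + q * r)
      id₂ = solve-∀
      id₃ : ∀ q r s α → 2 + ((r + α) + q * (2 + r + s)) ≡ q * (suc s + 1) + (2 + r) + α + q * r
      id₃ = solve-∀

    -- A word of minimum weight is the case α = s + 1 of `weight-bound`.
    general-bound : 2 ≤ K → n + 2 ≤ (suc s′ + 1) * (q + 1) + K
    general-bound K≥2 = ≤-trans
      (weight-bound {suc s′ + 1} Cc₀ c₀≢0 (trans (cong (_+ (suc s′ + 1)) (proj₂ (proj₂ (proj₂ (proj₁ minC))))) (sym (ℕₚ.+-assoc d (suc s′) 1))) K≥2)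
      (≤-reflexive (id₅ q (suc s′) K))
      where
      id₅ : ∀ q s K → q * (s + 1) + K + (s + 1) ≡ (s + 1) * (q + 1) + K
      id₅ = solve-∀

    dual≥K : t ≡ 1 → DualWeightAtLeast K
    dual≥K refl y Dy y≢0 = ≤-trans (≤-reflexive (ℕₚ.suc-injective (trans (sym dp+t) (ℕₚ.+-comm dp 1)))) (proj₂ minD y Dy y≢0)

    mds-bound : t ≡ 1 → 2 ≤ K → MDSLengthAtLeast F (K ∸ 1) (K + suc s′ ∸ 1)
    mds-bound t≡1 K≥2 with r , refl ← m≤n⇒∃[o]m+o≡n K≥2 = subst (MDSLengthAtLeast F (suc r))
      (trans zeros-c₀ (cong (_∸ 1) (sym (+-suc (2 + r) s′))))
      (Independent.mds-on-zeros (dual≥K t≡1) refl Cc₀ c₀≢0 (≤-trans (n≤1+n (suc r)) (≤-trans (m≤m+n (2 + r) s′) (≤-reflexive (sym zeros-c₀)))))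

    near-mds : s′ ≡ 0 → t ≡ 1 → 3 < q → 3 ≤ K → n + 2 ≤ 2 * q + K
    near-mds refl t≡1 3<q K≥3 with r , refl ← m≤n⇒∃[o]m+o≡n K≥3 = ≤-trans
      (+-monoˡ-≤ 2 (Projection.near-mds-bound P 3<q (subst ZerosAtMost (ℕₚ.+-identityʳ (3 + r)) zeros≤) (dual≥K t≡1))) (≤-reflexive (id₆ q r))
      where
      id₆ : ∀ q r → 2 * q + 1 + r + 2 ≡ 2 * q + (3 + r)
      id₆ = solve-∀

  -- A dual word with a single nonzero position would be orthogonal to every row only if the column
  -- there were zero.
  dual-distance≥2 : ∀ {k n} (g : GenMat F k n) → (∀ i → NonZeroVec F (g i)) → ∀ {x} → Dual F (CodeOf F g) x → NonZeroVec F x → 2 ≤ wt F x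
  dual-distance≥2 g column≢0 {x} Dx x≢0 with i , xi ← nonZero-index x≢0 with l , gil ← nonZero-index (column≢0 i)
    with <-≤-connex (wt F x) 2
  ... | inj₂ 2≤ = 2≤
  ... | inj₁ <2 = ⊥-elim (no-zero-divisors xi gil (trans (sym (trans (∙-single {x = x} i others) (cong (x i *F_) (at-l i)))) (Dx (codeword F g (unit l)) (unit l , λ _ → refl))))
    where
    at-l : ∀ j → unit l ∙ g j ≡ g j l
    at-l j = trans (∙-comm (unit l) (g j)) (∙-unit (g j) l)
    others : ∀ j → ¬ j ≡ i → x j ≡ 0# ⊎ unit l ∙ g j ≡ 0#
    others j j≢i = inj₁ (decidable-stable (x j ≟ 0#) (λ xj → <-irrefl refl (<-≤-trans <2 (≤-trans
      (size-2 (not ∘ zeros x) {i} {j} (cong not (is0-false xi)) (cong not (is0-false xj)) j≢i) (≤-reflexive (sym (wt≡size x)))))))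

-- The theorem, from the bounds for a code and its dual.

open import Data.Nat using (_+_; _*_)

mainTheorem1 :
  ∀ {q : ℕ} (F : FiniteField q) (k n : ℕ) (g : GenMat F k n) (d dp s t : ℕ) →
  -- 𝒢 is a non-degenerate [n,k,d]_q code with Singleton defect s
  IsCode F g d → d + k + s ≡ suc n →
  -- its dual is an [n, n-k, dp]_q code with Singleton defect t
  IsMinDist F (Dual F (CodeOf F g)) dp → dp + (n ∸ k) + t ≡ suc n →
  1 < d → 1 ≤ s → 1 ≤ t →
  -- (1a), (1b)
  ((1 < t → n + 1 ≤ s * (q + 1) + k) ×
   (1 < s → k + 1 ≤ t * (q + 1))) ×
  -- (2)
  (t ≡ 1 → (α : ℕ) → α ≤ s + 1 →
     ∃ (λ a → wt F (codeword F g a) + α ≡ d + s + 1) →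
     n + 2 ≤ q * (s + 1) + k + α) ×
  -- (3)
  (s ≡ 1 → (n + 2 ≤ (t + 1) * (q + 1) + (n ∸ k)) ×
           (k + 2 ≤ (t + 1) * (q + 1))) ×
  -- (4)
  (s ≡ 1 → t ≡ 1 → 3 < q → 3 ≤ k →
     (n + 2 ≤ 2 * q + k) × (k + 2 < n → k + 2 ≤ 2 * q)) ×
  -- (5)  k+s-1 ≤ m(k-1,q), equivalently n ≤ m(k-1,q) + k⊥ - s + 1
  (t ≡ 1 → MDSLengthAtLeast F (k ∸ 1) (k + s ∸ 1) ×
           MDSLengthAtLeast F (k ∸ 1) (n + s ∸ ((n ∸ k) + 1))) ×
  -- (6)  k⊥+t-1 ≤ m(k⊥-1,q), so n ≤ m(k⊥-1,q) + k - t + 1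
  (s ≡ 1 → MDSLengthAtLeast F ((n ∸ k) ∸ 1) ((n ∸ k) + t ∸ 1) ×
           MDSLengthAtLeast F ((n ∸ k) ∸ 1) (n + t ∸ (k + 1))) ×
  -- (7)
  (s ≡ 1 → t ≡ 1 → MDSLengthAtLeast F (k ∸ 1) k ×
                   MDSLengthAtLeast F ((n ∸ k) ∸ 1) (n ∸ k)) ×
  -- (8)
  (k + 2 ≤ (t + 1) * (q + 1))
mainTheorem1 {q} F k n g d dp (suc s′) (suc t′) (nd , minC) d-eq minD dp-eq 1<d (s≤s z≤n) (s≤s z≤n) =
  (Code₁.defect-bound , λ 1<s → drop-k′ 1 (Dual₁.defect-bound 1<s)) ,
  (λ { t≡1 α α≤ (a , wt-a) → Code₁.weight-bound (a , λ _ → refl) (positive-weight (codeword F g a) (weight>0 α a α≤ wt-a)) wt-a k≥2 }) ,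
  (λ _ → dual-bound , drop-k′ 2 dual-bound) ,
  (λ { refl refl 3<q k≥3 → Code₁.near-mds refl refl 3<q k≥3 ,
       -- The condition n > k + 2 says that the dual code has dimension at least 3.
       λ k+2<n → drop-k′ 2 (Dual₁.near-mds refl refl 3<q (+-cancelˡ-≤ k 3 k′ (≤-trans (≤-reflexive (+-suc k 2)) (≤-trans k+2<n (≤-reflexive (sym k+k′)))))) }) ,
  (λ t≡1 → let m = Code₁.mds-bound t≡1 k≥2 in m , subst (MDSLengthAtLeast F (k ∸ 1)) (sym lengths-code) m) ,
  (λ s≡1 → let m = Dual₁.mds-bound s≡1 k′≥2 in m , subst (MDSLengthAtLeast F (k′ ∸ 1)) (sym lengths-dual) m) ,
  (λ { refl refl → subst (MDSLengthAtLeast F (k ∸ 1)) (m+n∸n≡m k 1) (Code₁.mds-bound refl k≥2) ,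
                   subst (MDSLengthAtLeast F (k′ ∸ 1)) (m+n∸n≡m k′ 1) (Dual₁.mds-bound refl k′≥2) }) ,
  drop-k′ 2 dual-bound
  where
  open FiniteSubsets
  open DualPairs F
  open ParameterBounds F
  k′ = n ∸ k
  P = codePair g nd
  k+k′ : k + k′ ≡ n
  k+k′ = DualPair.dims P
  d+s : d + suc s′ ≡ suc k′
  d+s = +-cancelˡ-≡ k _ _ (trans (id₁ k d s′) (trans d-eq (trans (cong suc (sym k+k′)) (sym (+-suc k k′)))))
    where
    id₁ : ∀ k d s → k + (d + suc s) ≡ d + k + suc s
    id₁ = solve-∀
  dp+t : dp + suc t′ ≡ suc k
  dp+t = +-cancelʳ-≡ k′ _ _ (trans (id₂ dp k′ t′) (trans dp-eq (cong suc (sym k+k′))))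
    where
    id₂ : ∀ dp k′ t → dp + suc t + k′ ≡ dp + k′ + suc t
    id₂ = solve-∀
  module Code₁ = Parameters P minC d+s minD dp+t
  module Dual₁ = Parameters (swap P) minD dp+t minC d+s
  dp≥2 : 2 ≤ dp
  dp≥2 = subst (2 ≤_) (proj₂ (proj₂ (proj₂ (proj₁ minD)))) (dual-distance≥2 g (proj₁ nd) (proj₁ (proj₂ (proj₁ minD))) (proj₁ (proj₂ (proj₂ (proj₁ minD)))))
  -- A distance of at least 2 together with a positive defect makes the dimension of the opposite
  -- code at least 2, in both directions.
  at-least-2 : ∀ {m j l} → 2 ≤ m → m + suc j ≡ suc l → 2 ≤ l
  at-least-2 {m} {j} 2≤m e = ≤-trans 2≤m (≤-trans (m≤m+n m j) (≤-reflexive (ℕₚ.suc-injective (trans (sym (+-suc m j)) e))))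
  k≥2 : 2 ≤ k
  k≥2 = at-least-2 dp≥2 dp+t
  k′≥2 : 2 ≤ k′
  k′≥2 = at-least-2 1<d d+s
  dual-bound : n + 2 ≤ (suc t′ + 1) * (q + 1) + k′
  dual-bound = Dual₁.general-bound k′≥2
  -- Bounds on n obtained from the dual code contain its dimension as a summand; since n = k + k′
  -- they are bounds on k.
  drop-k′ : ∀ c {m} → n + c ≤ m + k′ → k + c ≤ m
  drop-k′ c h = +-cancelʳ-≤ k′ _ _ (≤-trans (≤-reflexive (trans (id₃ k c k′) (cong (_+ c) k+k′))) h)
    where
    id₃ : ∀ k c k′ → k + c + k′ ≡ k + k′ + c
    id₃ = solve-∀
  weight>0 : ∀ α a → α ≤ suc s′ + 1 → wt F (codeword F g a) + α ≡ d + suc s′ + 1 → 0 < wt F (codeword F g a)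
  weight>0 α a α≤ e = +-cancelʳ-≤ (suc s′ + 1) _ _ (≤-trans (+-monoˡ-≤ (suc s′ + 1) (<⇒≤ 1<d))
    (≤-trans (≤-reflexive (trans (sym (ℕₚ.+-assoc d (suc s′) 1)) (sym e))) (+-monoʳ-≤ _ α≤)))
  lengths-code : n + suc s′ ∸ (k′ + 1) ≡ k + suc s′ ∸ 1
  lengths-code = trans (cong (λ m → m + suc s′ ∸ (k′ + 1)) (trans (sym k+k′) (ℕₚ.+-comm k k′)))
    (trans (cong (_∸ (k′ + 1)) (ℕₚ.+-assoc k′ k (suc s′))) ([m+n]∸[m+o]≡n∸o k′ (k + suc s′) 1))
  lengths-dual : n + suc t′ ∸ (k + 1) ≡ k′ + suc t′ ∸ 1
  lengths-dual = trans (cong (λ m → m + suc t′ ∸ (k + 1)) (sym k+k′))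
    (trans (cong (_∸ (k + 1)) (ℕₚ.+-assoc k k′ (suc t′))) ([m+n]∸[m+o]≡n∸o k (k′ + suc t′) 1))
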